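{- Let $G=(V,E)$ be a finite simple graph with an edge $e$. Then $$\beth^{3}(G/e)\le \beth^{3}(G).$$
   Context: All graphs are finite and simple. For an edge $e=uv$, $G/e$ is the simple graph obtained by contracting $e$: the vertices $u,v$ are replaced by a single vertex $v_e$ adjacent to exactly those other vertices that are adjacent to $u$ or $v$ in $G$ (no loops or multiple edges are created). $C(G)$ is the set of all induced cycles in $G$ (of length at least 3). Solid graphs are the graphs of the following four kinds. (1) Pyramid: a graph consisting of a cycle $C$ and a vertex $w\notin V(C)$ together with at least three edges between $w$ and $C$. (2) Trihedron: the union of three paths $P_1,P_2,P_3$, each of length at least 2, having the same two (distinct) endpoints, such that no interior vertex of any of the paths is used in another of the paths. (3) Stamp: the union of a triangle $T$ and three paths $P_1,P_2,P_3$ of length $\ge 1$ that start at the three different vertices of $T$ and all end at the same vertex $x\notin V(T)$, such that the $P_i-x$ are pairwise vertex-disjoint and each $P_i$ meets $T$ only in its starting vertex. (4) Prism: $T\cup T'\cup P_1\cup P_2\cup P_3$ where $T,T'$ are vertex-disjoint triangles with vertices $x_1,x_2,x_3$ and $y_1,y_2,y_3$ respectively, and the $P_i$ are pairwise vertex-disjoint paths from $x_i$ to $y_i$ (so $P_i$ meets $T\cup T'$ only in $x_i,y_i$). A solid in $G$ is an induced subgraph of $G$ that is isomorphic to a solid graph; $S(G)$ is the set of all solids in $G$. The third graph characteristic is $\beth^{3}(G)=|S(G)|-|C(G)|+|E(G)|-|V(G)|$. -}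

module Defs where

open import Data.Nat.Base as ℕ using (ℕ; zero; suc; pred)
import Data.Nat.Properties as ℕ
open import Data.Integer.Base using (ℤ; +_; _+_; _-_)
open import Data.Fin.Base using (Fin; zero; suc; _<_)
open import Data.Fin.Properties using (_≟_; _<?_; any?; all?; injective⇒≤)
open import Data.Fin.Subset using (Subset; inside; outside; ∣_∣)
  renaming (_∈_ to _∈ˢ_; _⊆_ to _⊆ˢ_; _∩_ to _∩ˢ_; _-_ to _-ˢ_)
open import Data.Fin.Subset.Properties using (x∈p∩q⁺; x∈p∧x≢y⇒x∈p-y)
  renaming (_∈?_ to _∈ˢ?_; _⊆?_ to _⊆ˢ?_)
open import Data.List.Base as List
  using (List; []; _∷_; _++_; _∷ʳ_; length; map; filter; head; last; zip; drop; allFin; cartesianProduct)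
open import Data.List.Relation.Unary.All as All using (All; []; _∷_)
open import Data.List.Relation.Unary.Any as Any using (Any)
open import Data.List.Relation.Unary.AllPairs using (_∷_)
open import Data.List.Relation.Unary.Linked using (Linked; linked?)
open import Data.List.Relation.Unary.Unique.Propositional using (Unique)
open import Data.List.Membership.Propositional using (_∈_; _∉_)
open import Data.List.Membership.Propositional.Properties using (∈-lookup)
import Data.List.Membership.DecPropositional as DecMembership
import Data.List.Relation.Unary.Unique.DecPropositional as DecUnique
import Data.Maybe.Properties as Maybe
open import Data.Maybe.Base using (just)
import Data.Product.Properties as Product
open import Data.Product.Base using (∃; ∃-syntax; _×_; _,_; proj₁; proj₂)
open import Data.Sum.Base using (_⊎_; inj₁; inj₂)
open import Data.Unit.Base using (⊤)
open import Data.Vec.Base as Vec using (Vec; []; _∷_; lookup; toList)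
open import Data.Vec.Relation.Unary.All as VecAll using ([]; _∷_)
  renaming (All to VecAll)
open import Data.Vec.Relation.Unary.All.Properties using () renaming (lookup⁻ to vecAll-lookup⁻)
open import Function.Base using (_∘_; _$_)
open import Relation.Binary.PropositionalEquality
  using (_≡_; _≢_; refl; sym; cong)
open import Relation.Nullary using (Dec; yes; no; ¬_; contradiction)
open import Relation.Nullary.Decidable using (map′; _×-dec_; _⊎-dec_; _→-dec_; ¬?)
open import Relation.Unary using (Decidable)

private
  variable
    N : ℕ

-- The vertices form a subset of a finite stock Fin N of names, so that
-- induced subgraphs and contractions stay within Graph N.

record Graph (N : ℕ) : Set₁ where
  infix 4 _~_ _~?_
  field
    V        : Subset N
    _~_      : Fin N → Fin N → Set
    _~?_     : ∀ x y → Dec (x ~ y)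
    ~⇒∈V     : ∀ {x y} → x ~ y → x ∈ˢ V
    ~-sym    : ∀ {x y} → x ~ y → y ~ x
    ~-irrefl : ∀ {x} → ¬ (x ~ x)

open Graph using (V)

infix 10 _[_]

_[_] : Graph N → Subset N → Graph N
G [ S ] = record
  { V        = V G ∩ˢ S
  ; _~_      = λ x y → x ∈ˢ S × y ∈ˢ S × x ~ y
  ; _~?_     = λ x y → (x ∈ˢ? S) ×-dec (y ∈ˢ? S) ×-dec (x ~? y)
  ; ~⇒∈V     = λ (x∈S , _ , x~y) → x∈p∩q⁺ (~⇒∈V x~y , x∈S)
  ; ~-sym    = λ (x∈S , y∈S , x~y) → y∈S , x∈S , ~-sym x~y
  ; ~-irrefl = λ (_ , _ , x~x) → ~-irrefl x~x
  }
  where open Graph G using (_~_; _~?_; ~⇒∈V; ~-sym; ~-irrefl)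

-- In G/uv the name v is dropped and u becomes the name of the vertex
-- that replaces u and v.

contract : (G : Graph N) {u v : Fin N} → Graph._~_ G u v → Graph N
contract G {u} {v} u~v = record
  { V        = V G -ˢ v
  ; _~_      = _≈_
  ; _~?_     = λ x y → ¬? (x ≟ v) ×-dec ¬? (y ≟ v) ×-dec ¬? (x ≟ y) ×-dec
                 ((x ~? y) ⊎-dec ((x ≟ u) ×-dec (v ~? y)) ⊎-dec ((y ≟ u) ×-dec (x ~? v)))
  ; ~⇒∈V     = λ (x≢v , _ , _ , adj) → x∈p∧x≢y⇒x∈p-y (end∈V adj) x≢v
  ; ~-sym    = λ (x≢v , y≢v , x≢y , adj) → y≢v , x≢v , x≢y ∘ sym , swap adj
  ; ~-irrefl = λ (_ , _ , x≢x , _) → x≢x refl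
  }
  where
  open Graph G using (_~_; _~?_; ~⇒∈V; ~-sym)

  Adj : Fin _ → Fin _ → Set
  Adj x y = x ~ y ⊎ (x ≡ u × v ~ y) ⊎ (y ≡ u × x ~ v)

  _≈_ : Fin _ → Fin _ → Set
  x ≈ y = x ≢ v × y ≢ v × x ≢ y × Adj x y

  end∈V : ∀ {x y} → Adj x y → x ∈ˢ V G
  end∈V (inj₁ x~y)                = ~⇒∈V x~y
  end∈V (inj₂ (inj₁ (refl , _)))  = ~⇒∈V u~v
  end∈V (inj₂ (inj₂ (_ , x~v)))   = ~⇒∈V x~v

  swap : ∀ {x y} → Adj x y → Adj y x
  swap (inj₁ x~y)               = inj₁ (~-sym x~y)
  swap (inj₂ (inj₁ (x≡u , v~y))) = inj₂ (inj₂ (x≡u , ~-sym v~y))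
  swap (inj₂ (inj₂ (y≡u , x~v))) = inj₂ (inj₁ (y≡u , ~-sym x~v))

-- A walk is the list of its vertices in order; a cycle is listed without
-- repeating its first vertex, which close appends.

Walk : ℕ → Set
Walk N = List (Fin N)

walkLength : Walk N → ℕ
walkLength p = pred (length p)

steps : Walk N → List (Fin N × Fin N)
steps p = zip p (drop 1 p)

close : Walk N → Walk N
close []      = []
close (x ∷ p) = (x ∷ p) ∷ʳ x

MeetOnlyIn : Walk N → Walk N → List (Fin N) → Set
MeetOnlyIn p q zs = ∀ x → x ∈ p → x ∈ q → x ∈ zs

Disjoint : Walk N → Walk N → Set
Disjoint p q = MeetOnlyIn p q []

module _ (G : Graph N) where
  open Graph G using (_~_; _~?_)

  IsPath : Fin N → Fin N → Walk N → Set
  IsPath x y p =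
    head p ≡ just x × last p ≡ just y ×
    Unique p × All (_∈ˢ V G) p × Linked _~_ p

  IsCycle : Walk N → Set
  IsCycle c = 3 ℕ.≤ length c × Unique c × Linked _~_ (close c)

  IsTriangle : Vec (Fin N) 3 → Set
  IsTriangle T = ∀ i j → i ≢ j → lookup T i ~ lookup T j

  -- For walks of G this says that G is their union; that the vertices
  -- and steps of the walks belong to G is part of IsPath, IsCycle, etc.

  IsUnionOf : List (Walk N) → Set
  IsUnionOf ws =
    (∀ x → x ∈ˢ V G → Any (x ∈_) ws) ×
    (∀ x y → x ~ y → Any (λ w → (x , y) ∈ steps w ⊎ (y , x) ∈ steps w) ws)

  -- These properties are invariant under isomorphism, so an induced subgraph
  -- is isomorphic to such a graph exactly when it has the property itself.

  CycleGraph : Set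
  CycleGraph = ∃[ c ] IsCycle c × IsUnionOf (close c ∷ [])

  nbrsIn : Fin N → Walk N → List (Fin N)
  nbrsIn w c = filter (w ~?_) c

  Pyramid : Set
  Pyramid = ∃[ c ] ∃[ w ]
    IsCycle c × w ∉ c × 3 ℕ.≤ length (nbrsIn w c) ×
    IsUnionOf (close c ∷ map (λ x → w ∷ x ∷ []) (nbrsIn w c))

  Trihedron : Set
  Trihedron = ∃[ P ] ∃[ a ] ∃[ b ]
    a ≢ b ×
    (∀ i → IsPath a b (lookup P i) × 2 ℕ.≤ walkLength (lookup P i)) ×
    (∀ i j → i ≢ j → MeetOnlyIn (lookup P i) (lookup P j) (a ∷ b ∷ [])) ×
    IsUnionOf (toList {n = 3} P)

  Stamp : Set
  Stamp = ∃[ P ] ∃[ T ] ∃[ x ]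
    IsTriangle T × x ∉ toList T ×
    (∀ i → IsPath (lookup T i) x (lookup P i) × 1 ℕ.≤ walkLength (lookup P i)) ×
    (∀ i j → i ≢ j → MeetOnlyIn (lookup P i) (lookup P j) (x ∷ [])) ×
    (∀ i → MeetOnlyIn (lookup P i) (toList T) (lookup T i ∷ [])) ×
    IsUnionOf (close (toList T) ∷ toList P)

  Prism : Set
  Prism = ∃[ P ] ∃[ T ] ∃[ T′ ]
    IsTriangle T × IsTriangle T′ × Disjoint (toList T) (toList T′) ×
    (∀ i → IsPath (lookup T i) (lookup T′ i) (lookup P i)) ×
    (∀ i j → i ≢ j → Disjoint (lookup P i) (lookup P j)) ×
    IsUnionOf (close (toList T) ∷ close (toList T′) ∷ toList P)

  SolidGraph : Set
  SolidGraph = Pyramid ⊎ Trihedron ⊎ Stamp ⊎ Prism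

-- Exhaustive search for a P; the bound Q makes it finite.

Searchable : {A : Set} → (A → Set) → Set₁
Searchable {A} Q =
  {P : A → Set} → Decidable P → (∀ {x} → P x → Q x) → Dec (∃ P)

searchVec : ∀ {A : Set} {Q : A → Set} n →
            Searchable Q → Searchable {Vec A n} (VecAll Q)
searchVec zero    s P? P⇒Q = map′ (_ ,_) (λ { ([] , p) → p }) (P? [])
searchVec (suc n) s P? P⇒Q =
  map′ (λ (x , xs , p) → x ∷ xs , p) (λ { (x ∷ xs , p) → x , xs , p }) $
  s (λ x → searchVec n s (λ xs → P? (x ∷ xs)) (VecAll.tail ∘ P⇒Q))
    (λ (_ , p) → VecAll.head (P⇒Q p))

searchShort : ∀ n → Searchable {Walk N} (λ p → length p ℕ.≤ n)
searchShort zero {P} P? P⇒≤ = map′ (_ ,_) from (P? [])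
  where
  from : ∃ P → P []
  from ([]    , p) = p
  from (_ ∷ _ , p) = contradiction (P⇒≤ p) λ ()
searchShort {N} (suc n) {P} P? P⇒≤ = map′ to from (P? [] ⊎-dec any? λ x →
    searchShort n (λ xs → P? (x ∷ xs)) (ℕ.≤-pred ∘ P⇒≤))
  where
  to : P [] ⊎ ∃[ x ] ∃[ xs ] P (x ∷ xs) → ∃ P
  to (inj₁ p)            = [] , p
  to (inj₂ (x , xs , p)) = x ∷ xs , p
  from : ∃ P → P [] ⊎ ∃[ x ] ∃[ xs ] P (x ∷ xs)
  from ([]     , p) = inj₁ p
  from (x ∷ xs , p) = inj₂ (x , xs , p)

lookup-injective : {p : Walk N} → Unique p →
                   ∀ {i j} → List.lookup p i ≡ List.lookup p j → i ≡ j
lookup-injective (_   ∷ _) {zero}  {zero}  _  = refl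
lookup-injective (x≢p ∷ _) {zero}  {suc j} eq =
  contradiction eq (All.lookup x≢p (∈-lookup j))
lookup-injective (x≢p ∷ _) {suc i} {zero}  eq =
  contradiction (sym eq) (All.lookup x≢p (∈-lookup i))
lookup-injective (_   ∷ u) {suc i} {suc j} eq = cong suc (lookup-injective u eq)

searchUnique : Searchable {Walk N} Unique
searchUnique {N} P? P⇒U =
  searchShort N P? (λ p → injective⇒≤ (lookup-injective (P⇒U p)))

searchUnique³ : {P : Vec (Walk N) 3 → Set} → Decidable P →
                (∀ {p} → P p → ∀ i → Unique (lookup p i)) → Dec (∃ P)
searchUnique³ P? P⇒U = searchVec 3 searchUnique P? (vecAll-lookup⁻ ∘ P⇒U)

anyVec? : ∀ {n} {P : Vec (Fin N) n → Set} → Decidable P → Dec (∃ P)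
anyVec? {n = n} P? =
  searchVec {Q = λ _ → ⊤} n (λ P? _ → any? P?) P? (λ _ → VecAll.universal _ _)

_∈?_ : (x : Fin N) (p : List (Fin N)) → Dec (x ∈ p)
_∈?_ = DecMembership._∈?_ _≟_

meetOnlyIn? : (p q zs : List (Fin N)) → Dec (MeetOnlyIn p q zs)
meetOnlyIn? p q zs = all? λ x → (x ∈? p) →-dec (x ∈? q) →-dec (x ∈? zs)

module _ (G : Graph N) where
  open Graph G using (_~?_)

  isPath? : ∀ x y p → Dec (IsPath G x y p)
  isPath? x y p =
    Maybe.≡-dec _≟_ _ _ ×-dec Maybe.≡-dec _≟_ _ _ ×-dec
    DecUnique.unique? _≟_ p ×-dec All.all? (_∈ˢ? V G) p ×-dec linked? _~?_ p

  isCycle? : ∀ c → Dec (IsCycle G c)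
  isCycle? c =
    (3 ℕ.≤? length c) ×-dec DecUnique.unique? _≟_ c ×-dec linked? _~?_ (close c)

  isTriangle? : ∀ T → Dec (IsTriangle G T)
  isTriangle? T = all? λ i → all? λ j → ¬? (i ≟ j) →-dec (lookup T i ~? lookup T j)

  isUnionOf? : ∀ ws → Dec (IsUnionOf G ws)
  isUnionOf? ws =
    (all? λ x → (x ∈ˢ? V G) →-dec Any.any? (x ∈?_) ws) ×-dec
    (all? λ x → all? λ y → (x ~? y) →-dec
      Any.any? (λ w → ((x , y) ∈²? steps w) ⊎-dec ((y , x) ∈²? steps w)) ws)
    where open DecMembership (Product.≡-dec (_≟_ {N}) (_≟_ {N})) renaming (_∈?_ to _∈²?_)

  cycleGraph? : Dec (CycleGraph G)
  cycleGraph? = searchUnique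
    (λ c → isCycle? c ×-dec isUnionOf? _)
    (λ ((_ , u , _) , _) → u)

  pyramid? : Dec (Pyramid G)
  pyramid? = searchUnique
    (λ c → any? λ w → isCycle? c ×-dec ¬? (w ∈? c) ×-dec
                      (3 ℕ.≤? length (nbrsIn G w c)) ×-dec isUnionOf? _)
    (λ (_ , (_ , u , _) , _) → u)

  trihedron? : Dec (Trihedron G)
  trihedron? = searchUnique³
    (λ P → any? λ a → any? λ b → ¬? (a ≟ b) ×-dec
      (all? λ i → isPath? _ _ _ ×-dec (2 ℕ.≤? _)) ×-dec
      (all? λ i → all? λ j → ¬? (i ≟ j) →-dec meetOnlyIn? _ _ _) ×-dec
      isUnionOf? _)
    (λ (_ , _ , _ , paths , _) i → let ((_ , _ , u , _) , _) = paths i in u)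

  stamp? : Dec (Stamp G)
  stamp? = searchUnique³
    (λ P → anyVec? λ T → any? λ x → isTriangle? T ×-dec ¬? (x ∈? toList T) ×-dec
      (all? λ i → isPath? _ _ _ ×-dec (1 ℕ.≤? _)) ×-dec
      (all? λ i → all? λ j → ¬? (i ≟ j) →-dec meetOnlyIn? _ _ _) ×-dec
      (all? λ i → meetOnlyIn? _ _ _) ×-dec
      isUnionOf? _)
    (λ (_ , _ , _ , _ , paths , _) i → let ((_ , _ , u , _) , _) = paths i in u)

  prism? : Dec (Prism G)
  prism? = searchUnique³
    (λ P → anyVec? λ T → anyVec? λ T′ →
      isTriangle? T ×-dec isTriangle? T′ ×-dec meetOnlyIn? _ _ [] ×-dec
      (all? λ i → isPath? _ _ _) ×-dec
      (all? λ i → all? λ j → ¬? (i ≟ j) →-dec meetOnlyIn? _ _ []) ×-dec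
      isUnionOf? _)
    (λ (_ , _ , _ , _ , _ , paths , _) i → let (_ , _ , u , _) = paths i in u)

  solidGraph? : Dec (SolidGraph G)
  solidGraph? = pyramid? ⊎-dec trihedron? ⊎-dec stamp? ⊎-dec prism?

subsets : ∀ N → List (Subset N)
subsets zero    = [] ∷ []
subsets (suc N) = map (outside ∷_) (subsets N) ++ map (inside ∷_) (subsets N)

module _ {N} (G : Graph N) where
  open Graph G using (_~_; _~?_)

  -- An induced subgraph is represented by its vertex set.

  inducedCycles : List (Subset N)
  inducedCycles =
    filter (λ S → (S ⊆ˢ? V G) ×-dec cycleGraph? (G [ S ])) (subsets N)

  solids : List (Subset N)
  solids =
    filter (λ S → (S ⊆ˢ? V G) ×-dec solidGraph? (G [ S ])) (subsets N)

  edges : List (Fin N × Fin N)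
  edges = filter (λ (x , y) → (x <? y) ×-dec (x ~? y))
                 (cartesianProduct (allFin N) (allFin N))

  ℶ³ : ℤ
  ℶ³ = + length solids - + length inducedCycles + + length edges - + ∣ V G ∣

{-# OPTIONS --safe #-}
-- Let e = uv and let w be the vertex of G/e that replaces u and v. Sort the
-- induced subgraphs of both graphs by their trace X outside u, v and w. For
-- every X, the number of solids on X+w in G/e plus the number of induced cycles
-- other than triangles on X+u, X+v, X+u+v in G is at most the number of solids
-- on those three sets in G plus the number of induced cycles on X+w in G/e; the
-- triangles on e account for the edges lost besides e itself. If X+u or X+v is
-- an induced cycle, then X+w is one or X+u+v is a solid (a cycle and a vertex),
-- and both hold if X+u and X+v are induced cycles; moreover X is then an
-- induced path, so that X+w is not a solid. What remains is that one of X+u,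
-- X+v and X+u+v is a solid if X+w is.
--
-- For this all solids are treated alike, as ears: an induced cycle C together
-- with a disjoint induced path Q only the ends of which have neighbours in C.
-- If Q is a single vertex, its neighbours in C must not lie in a vertex or an
-- edge of C; otherwise each end of Q has its neighbours in a vertex or an edge
-- of C, but the two ends together do not. The ear for X+w can be chosen with w
-- on Q, or with w on C and at most the first vertex of a longer Q attached to
-- w, and to w only. Replacing w by u, by v or by the edge uv, within C or Q,
-- gives an ear again, apart from two cases in which the cycle must be rerouted.

module Submission where

open import Defs
open import Data.Bool.Base using (true; false; if_then_else_)
import Data.Bool.Properties as Bool
open import Data.Empty using (⊥)
open import Data.Fin.Base using (Fin; zero; suc; _<_)
open import Data.Fin.Properties using (_≟_; _<?_; any?; <-cmp; <-irrefl; <-trans)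
open import Data.Fin.Subset using (Subset; inside; outside; ∣_∣; ⁅_⁆)
  renaming (_∈_ to _∈ˢ_; _∉_ to _∉ˢ_; _⊆_ to _⊆ˢ_; _∩_ to _∩ˢ_; _-_ to _-ˢ_)
open import Data.Fin.Subset.Properties
  using (x∈p∩q⁺; x∈p∩q⁻; ⊆-antisym; x∈⁅x⁆; x∈⁅y⁆⇒x≡y; p⊆q⇒∣p∣≤∣q∣; x∈p∧x≢y⇒x∈p-y)
  renaming (_⊆?_ to _⊆ˢ?_)
open import Data.Integer.Base as ℤ using (+_; +≤+; _≤_)
import Data.Integer.Properties as ℤ
open import Data.Integer.Tactic.RingSolver using () renaming (solve-∀ to solve-∀ℤ)
open import Data.List.Base as List
  using (List; []; _∷_; _++_; _∷ʳ_; length; reverse; map; filter; allFin; cartesianProduct)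
import Data.List.Properties as List
open import Data.List.Membership.Propositional using (_∈_; _∉_; lose; find)
open import Data.List.Membership.Propositional.Properties
  using (∈-++⁺ˡ; ∈-++⁺ʳ; ∈-++⁻; ∈-∃++; ∈-map⁻; ∈-map⁺; ∈-filter⁺; ∈-filter⁻;
         ∈-allFin; ∈-cartesianProduct⁺)
open import Data.List.Relation.Binary.Disjoint.Propositional
  using () renaming (Disjoint to Apart)
open import Data.List.Relation.Binary.Permutation.Propositional
  using (_↭_; ↭-refl; ↭-sym; ↭-trans; ↭-reflexive; prep; swap; ↭⇒↭ₛ)
import Data.List.Relation.Binary.Permutation.Propositional.Properties as ↭
import Data.List.Relation.Binary.Permutation.Setoid.Properties as ↭ₛ
open import Data.List.Relation.Unary.All as All using (All; []; _∷_)
open import Data.List.Relation.Unary.AllPairs using ([]; _∷_)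
open import Data.List.Relation.Unary.Any as Any using (Any; here; there)
import Data.List.Relation.Unary.Any.Properties as Any
open import Data.List.Relation.Unary.Linked using (Linked; []; [-]; _∷_)
open import Data.List.Relation.Unary.Unique.Propositional using (Unique)
import Data.List.Relation.Unary.Unique.Propositional.Properties as Unique
open import Data.Maybe.Base using (just)
open import Data.Nat.Base as ℕ using (ℕ; zero; suc; z≤n; s≤s)
import Data.Nat.Properties as ℕ
open import Data.Nat.Tactic.RingSolver using (solve-∀)
open import Data.Product.Base using (∃; ∃-syntax; _×_; _,_; _,′_; proj₁; proj₂)
open import Data.Sum.Base as Sum using (_⊎_; inj₁; inj₂; [_,_]′)
open import Data.Vec.Base as Vec using (Vec; []; _∷_; lookup; toList; _[_]≔_)
open import Data.Vec.Properties
  using (lookup⇒[]=; []=⇒lookup; lookup∘update; lookup∘update′; lookup-zipWith; ∷-injectiveʳ; ≡-dec)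
open import Function.Base using (_∘_; _$_; id; case_of_)
open import Relation.Binary.Definitions using (tri<; tri≈; tri>)
open import Relation.Binary.PropositionalEquality
  using (_≡_; _≢_; refl; sym; trans; cong; cong₂; subst; subst₂; setoid)
open import Relation.Nullary using (Dec; yes; no; does; ¬_; contradiction)
open import Relation.Nullary.Decidable using (_×-dec_; _⊎-dec_; ¬?; map′; decidable-stable)
open import Relation.Unary using (Decidable)

-- Walks

-- Splitting `w` can change the kind of a solid: a wheel whose hub is split may become a prism.
-- Hence the common form for the four kinds. It is translated both ways: a solid is decomposed into
-- an ear that suits the position of `w`, and the vertex set of any ear carries a solid. The second
-- direction is more than a change of notation, since the neighbourhoods of the two ends of an ear
-- may share a vertex of the cycle; that vertex is then the hub of a wheel on the same vertices.
-- What keeps the cases of the splitting few is that `u` and `v` may be assumed to have, each, a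
-- neighbour in X that the other lacks. If `v` has none, then `u` has the same neighbours in X as
-- `w`, and X+u is a copy of X+w. These private neighbours decide which of `u` and `v` inherits
-- which edge at `w`. In the count, the edge e cancels against the lost vertex. Each common
-- neighbour of `u` and `v` costs one further edge, and it is the apex of one triangle on e, the
-- only kind of induced cycle through e that does not contract to an induced cycle.

module _ {A : Set} where

  private
    variable
      x y z s t : A
      p q : List A

  -- Consecutive vertices regardless of direction: `ereh` is `here` read backwards. Edges of a graph
  -- are symmetric and walks are often reversed, so this is handier than the directed `steps`, to
  -- which it is converted only at the interface with the definitions.
  data Adj : List A → A → A → Set where
    here  : Adj (x ∷ y ∷ p) x y
    ereh  : Adj (x ∷ y ∷ p) y x
    there : Adj p x y → Adj (z ∷ p) x y

  data First : List A → A → Set where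
    first : First (x ∷ p) x

  data Last : List A → A → Set where
    last  : Last (x ∷ []) x
    there : Last p x → Last (y ∷ p) x

  Adj-sym : Adj p x y → Adj p y x
  Adj-sym here      = ereh
  Adj-sym ereh      = here
  Adj-sym (there a) = there (Adj-sym a)

  Adj⇒∈ : Adj p x y → x ∈ p
  Adj⇒∈ here      = here refl
  Adj⇒∈ ereh      = there (here refl)
  Adj⇒∈ (there a) = there (Adj⇒∈ a)

  Adj⇒∈ʳ : Adj p x y → y ∈ p
  Adj⇒∈ʳ = Adj⇒∈ ∘ Adj-sym

  First⇒∈ : First p x → x ∈ p
  First⇒∈ first = here refl

  Last⇒∈ : Last p x → x ∈ p
  Last⇒∈ last      = here refl
  Last⇒∈ (there l) = there (Last⇒∈ l)

  First-unique : First p x → First p y → x ≡ y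
  First-unique first first = refl

  Last-unique : Last p x → Last p y → x ≡ y
  Last-unique last      last      = refl
  Last-unique (there k) (there l) = Last-unique k l

  ∃First : x ∈ p → ∃ (First p)
  ∃First {p = y ∷ _} _ = y , first

  ∃Last : x ∈ p → ∃ (Last p)
  ∃Last {p = y ∷ []}    _ = y , last
  ∃Last {p = _ ∷ z ∷ p} _ = let l , m = ∃Last {p = z ∷ p} (here refl) in l , there m

  First-++ : First p x → First (p ++ q) x
  First-++ first = first

  Last-++ : ∀ p → Last q x → Last (p ++ q) x
  Last-++ []      l = l
  Last-++ (_ ∷ p) l = there (Last-++ p l)

  Last-reverse : First p x → Last (reverse p) x
  Last-reverse {p = x ∷ p} first
    rewrite List.unfold-reverse x p = Last-++ (reverse p) last

  First-reverse : Last p x → First (reverse p) x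
  First-reverse last = first
  First-reverse {p = y ∷ p} (there l)
    rewrite List.unfold-reverse y p = First-++ (First-reverse l)

  Adj-++ˡ : Adj p x y → Adj (p ++ q) x y
  Adj-++ˡ here      = here
  Adj-++ˡ ereh      = ereh
  Adj-++ˡ (there a) = there (Adj-++ˡ a)

  Adj-++ʳ : ∀ p → Adj q x y → Adj (p ++ q) x y
  Adj-++ʳ []      a = a
  Adj-++ʳ (_ ∷ p) a = there (Adj-++ʳ p a)

  Link : List A → List A → A → A → Set
  Link p q x y = Last p x × First q y ⊎ Last p y × First q x

  Adj-link : Last p x → First q y → Adj (p ++ q) x y
  Adj-link last      first = here
  Adj-link (there l) f     = there (Adj-link l f)

  Adj-Link : Link p q x y → Adj (p ++ q) x y
  Adj-Link (inj₁ (l , f)) = Adj-link l f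
  Adj-Link (inj₂ (l , f)) = Adj-sym (Adj-link l f)

  Adj-++⁻ : ∀ p → Adj (p ++ q) x y → Adj p x y ⊎ Adj q x y ⊎ Link p q x y
  Adj-++⁻ []              a         = inj₂ (inj₁ a)
  Adj-++⁻ (_ ∷ [])        here      = inj₂ (inj₂ (inj₁ (last , first)))
  Adj-++⁻ (_ ∷ [])        ereh      = inj₂ (inj₂ (inj₂ (last , first)))
  Adj-++⁻ (_ ∷ [])        (there a) = inj₂ (inj₁ a)
  Adj-++⁻ (_ ∷ _ ∷ p)     here      = inj₁ here
  Adj-++⁻ (_ ∷ _ ∷ p)     ereh      = inj₁ ereh
  Adj-++⁻ (_ ∷ p@(_ ∷ _)) (there a) =
    Sum.map there (Sum.map₂ (Sum.map (λ (l , f) → there l , f) (λ (l , f) → there l , f)))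
            (Adj-++⁻ p a)

  Adj-reverse : Adj p x y → Adj (reverse p) x y
  Adj-reverse {p = z ∷ p} a with reverse (z ∷ p) | List.unfold-reverse z p
  Adj-reverse {p = x ∷ y ∷ p} here      | _ | refl =
    Adj-sym (Adj-link (Last-reverse {p = y ∷ p} first) first)
  Adj-reverse {p = x ∷ y ∷ p} ereh      | _ | refl =
    Adj-link (Last-reverse {p = y ∷ p} first) first
  Adj-reverse                 (there a) | _ | refl = Adj-++ˡ (Adj-reverse a)

  Adj-reverse⁻ : Adj (reverse p) x y → Adj p x y
  Adj-reverse⁻ {p = p} a = subst (λ q → Adj q _ _) (List.reverse-involutive p) (Adj-reverse a)

  Adj-head⁻ : z ∉ p → Adj (z ∷ p) z y → First p y
  Adj-head⁻ z∉p here      = first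
  Adj-head⁻ z∉p ereh      = contradiction (here refl) z∉p
  Adj-head⁻ z∉p (there a) = contradiction (Adj⇒∈ a) z∉p

  Adj-tail⁻ : x ≢ z → y ≢ z → Adj (z ∷ p) x y → Adj p x y
  Adj-tail⁻ x≢z y≢z here      = contradiction refl x≢z
  Adj-tail⁻ x≢z y≢z ereh      = contradiction refl y≢z
  Adj-tail⁻ x≢z y≢z (there a) = a

  Adj⇒split : Adj p x y → ∃[ p₁ ] ∃[ p₂ ]
              (p ≡ p₁ ++ x ∷ y ∷ p₂ ⊎ p ≡ p₁ ++ y ∷ x ∷ p₂)
  Adj⇒split here = [] , _ , inj₁ refl
  Adj⇒split ereh = [] , _ , inj₂ refl
  Adj⇒split {p = z ∷ _} (there a) with Adj⇒split a
  ... | p₁ , p₂ , inj₁ refl = z ∷ p₁ , p₂ , inj₁ refl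
  ... | p₁ , p₂ , inj₂ refl = z ∷ p₁ , p₂ , inj₂ refl

  Unique-head : Unique (x ∷ p) → x ∉ p
  Unique-head (x≢p ∷ _) x∈p = All.lookup x≢p x∈p refl

  Unique-resp-↭ : p ↭ q → Unique p → Unique q
  Unique-resp-↭ = ↭ₛ.Unique-resp-↭ (setoid A) ∘ ↭⇒↭ₛ

  Unique-++⁻ : ∀ p → Unique (p ++ q) → Unique p × Unique q × Apart p q
  Unique-++⁻ []      u = [] , u , λ ()
  Unique-++⁻ (x ∷ p) (x≢ ∷ u) =
    let u₁ , u₂ , d = Unique-++⁻ p u in
    All.tabulate (λ m → All.lookup x≢ (∈-++⁺ˡ m)) ∷ u₁ , u₂ ,
    λ { (here refl , m) → All.lookup x≢ (∈-++⁺ʳ p m) refl ; (there n , m) → d (n , m) }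

  Unique-reverse : Unique p → Unique (reverse p)
  Unique-reverse {p} = Unique-resp-↭ (↭-sym (↭.↭-reverse p))

  ∈-reverse⁻ : x ∈ reverse p → x ∈ p
  ∈-reverse⁻ = Any.reverse⁻

  ∈⇒↭ : x ∈ p → ∃[ q ] p ↭ x ∷ q
  ∈⇒↭ x∈p with ∈-∃++ x∈p
  ... | p₁ , p₂ , refl = p₁ ++ p₂ , ↭.shift _ p₁ p₂

module _ {N : ℕ} {p q : Walk N} where

  private
    variable
      x y : Fin N

  -- Closing turns the concatenation into two arcs joined by two links. This description is
  -- symmetric in `p` and `q`, which is what later makes a rotated cycle a cycle again.
  Adj-close-++⁻ : ∀ {a d} → First p a → Last q d →
    Adj (close (p ++ q)) x y → Adj p x y ⊎ Adj q x y ⊎ Link p q x y ⊎ Link q p x y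
  Adj-close-++⁻ {a = a} {d} f@(first {p = p′}) l adj with Adj-++⁻ (a ∷ p′ ++ q) adj
  ... | inj₂ (inj₁ (there ()))
  ... | inj₂ (inj₂ (inj₁ (m , first)))
      rewrite Last-unique m (Last-++ p l) = inj₂ (inj₂ (inj₂ (inj₁ (l , f))))
  ... | inj₂ (inj₂ (inj₂ (m , first)))
      rewrite Last-unique m (Last-++ p l) = inj₂ (inj₂ (inj₂ (inj₂ (l , f))))
  ... | inj₁ adj′ = Sum.map₂ (Sum.map₂ inj₁) (Adj-++⁻ p adj′)

  Adj-close-++⁺ : ∀ {a} → First p a →
    Adj p x y ⊎ Adj q x y ⊎ Link p q x y ⊎ Link q p x y → Adj (close (p ++ q)) x y
  Adj-close-++⁺ first (inj₁ a)               = Adj-++ˡ (Adj-++ˡ a)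
  Adj-close-++⁺ first (inj₂ (inj₁ a))        = Adj-++ˡ (Adj-++ʳ p a)
  Adj-close-++⁺ first (inj₂ (inj₂ (inj₁ k))) = Adj-++ˡ (Adj-Link k)
  Adj-close-++⁺ first (inj₂ (inj₂ (inj₂ (inj₁ (l , first))))) = Adj-link (Last-++ p l) first
  Adj-close-++⁺ first (inj₂ (inj₂ (inj₂ (inj₂ (l , first))))) =
    Adj-sym (Adj-link (Last-++ p l) first)

-- Induced paths and cycles

module Induced {N : ℕ} (G : Graph N) where
  open Graph G using (_~_; _~?_; ~-sym; ~-irrefl)

  private
    variable
      a b c d l r s t w x y : Fin N
      p q : Walk N

  ~⇒≢ : x ~ y → x ≢ y
  ~⇒≢ x~x refl = ~-irrefl x~x

  record Path (s t : Fin N) (p : Walk N) : Set where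
    field
      unique : Unique p
      start  : First p s
      end    : Last p t
      adj⇒~  : Adj p x y → x ~ y
      ~⇒adj  : x ∈ p → y ∈ p → x ~ y → Adj p x y

  record Cyc (c : Walk N) : Set where
    field
      long   : 3 ℕ.≤ length c
      unique : Unique c
      adj⇒~  : Adj (close c) x y → x ~ y
      ~⇒adj  : x ∈ c → y ∈ c → x ~ y → Adj (close c) x y

  -- Cross p q b c: the only possible edge between p and q is bc.
  Cross : Walk N → Walk N → Fin N → Fin N → Set
  Cross p q b c = ∀ {x y} → x ∈ p → y ∈ q → x ~ y → x ≡ b × y ≡ c

  Path-[] : Path s s (s ∷ [])
  Path-[] = record
    { unique = [] ∷ [] ; start = first ; end = last
    ; adj⇒~ = λ { (there ()) }
    ; ~⇒adj = λ { (here refl) (here refl) x~x → contradiction x~x ~-irrefl }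
    }

  Path-++ : Path s b p → Path c t q → b ~ c → Apart p q → Cross p q b c → Path s t (p ++ q)
  Path-++ {p = p} {q = q} P Q b~c dis cross = record
    { unique = Unique.++⁺ P.unique Q.unique dis
    ; start  = First-++ P.start
    ; end    = Last-++ p Q.end
    ; adj⇒~  = to ∘ Adj-++⁻ p
    ; ~⇒adj  = λ x∈ y∈ → from (∈-++⁻ p x∈) (∈-++⁻ p y∈)
    }
    where
    module P = Path P
    module Q = Path Q
    to : Adj p x y ⊎ Adj q x y ⊎ Link p q x y → x ~ y
    to (inj₁ a) = P.adj⇒~ a
    to (inj₂ (inj₁ a)) = Q.adj⇒~ a
    to (inj₂ (inj₂ (inj₁ (l , f))))
      rewrite Last-unique l P.end | First-unique f Q.start = b~c
    to (inj₂ (inj₂ (inj₂ (l , f))))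
      rewrite Last-unique l P.end | First-unique f Q.start = ~-sym b~c
    from : x ∈ p ⊎ x ∈ q → y ∈ p ⊎ y ∈ q → x ~ y → Adj (p ++ q) x y
    from (inj₁ x∈) (inj₁ y∈) e = Adj-++ˡ (P.~⇒adj x∈ y∈ e)
    from (inj₂ x∈) (inj₂ y∈) e = Adj-++ʳ p (Q.~⇒adj x∈ y∈ e)
    from (inj₁ x∈) (inj₂ y∈) e with cross x∈ y∈ e
    ... | refl , refl = Adj-link P.end Q.start
    from (inj₂ x∈) (inj₁ y∈) e with cross y∈ x∈ (~-sym e)
    ... | refl , refl = Adj-sym (Adj-link P.end Q.start)

  Path-∷ : Path c t q → b ~ c → b ∉ q → (∀ {y} → y ∈ q → b ~ y → y ≡ c) → Path b t (b ∷ q)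
  Path-∷ Q b~c b∉q only = Path-++ Path-[] Q b~c
    (λ { (here refl , m) → b∉q m })
    (λ { (here refl) y∈ e → refl , only y∈ e })

  Path-∷ʳ : Path s b p → b ~ c → c ∉ p → (∀ {x} → x ∈ p → x ~ c → x ≡ b) → Path s c (p ∷ʳ c)
  Path-∷ʳ P b~c c∉p only = Path-++ P Path-[] b~c
    (λ { (m , here refl) → c∉p m })
    (λ { x∈ (here refl) e → only x∈ e , refl })

  Path-reverse : Path s t p → Path t s (reverse p)
  Path-reverse P = record
    { unique = Unique-reverse P.unique
    ; start  = First-reverse P.end
    ; end    = Last-reverse P.start
    ; adj⇒~  = P.adj⇒~ ∘ Adj-reverse⁻
    ; ~⇒adj  = λ x∈ y∈ e → Adj-reverse (P.~⇒adj (∈-reverse⁻ x∈) (∈-reverse⁻ y∈) e)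
    }
    where module P = Path P

  record Split (s t : Fin N) (p q : Walk N) : Set where
    field
      {mid₁ mid₂} : Fin N
      left  : Path s mid₁ p
      right : Path mid₂ t q
      mid~  : mid₁ ~ mid₂
      apart : Apart p q
      cross : Cross p q mid₁ mid₂

  Path-split : First p a → First q b → Path s t (p ++ q) → Split s t p q
  Path-split {p = p} {q = q} fp fq P = record
    { left  = record
      { unique = u₁ ; start = subst (First p) (First-unique (First-++ fp) start) fp
      ; end = lp ; adj⇒~ = adj⇒~ ∘ Adj-++ˡ
      ; ~⇒adj = λ x∈ y∈ e → inˡ x∈ y∈ (Adj-++⁻ p (~⇒adj (∈-++⁺ˡ x∈) (∈-++⁺ˡ y∈) e)) }
    ; right = record
      { unique = u₂ ; start = fq
      ; end = subst (Last q) (Last-unique (Last-++ p lq) end) lq ; adj⇒~ = adj⇒~ ∘ Adj-++ʳ p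
      ; ~⇒adj = λ x∈ y∈ e → inʳ x∈ y∈ (Adj-++⁻ p (~⇒adj (∈-++⁺ʳ p x∈) (∈-++⁺ʳ p y∈) e)) }
    ; mid~  = adj⇒~ (Adj-link lp fq)
    ; apart = dis
    ; cross = λ x∈ y∈ e → inˣ x∈ y∈ (Adj-++⁻ p (~⇒adj (∈-++⁺ˡ x∈) (∈-++⁺ʳ p y∈) e))
    }
    where
    open Path P
    u₁ = proj₁ (Unique-++⁻ p unique)
    u₂ = proj₁ (proj₂ (Unique-++⁻ p unique))
    dis = proj₂ (proj₂ (Unique-++⁻ p unique))
    lp = proj₂ (∃Last (First⇒∈ fp))
    lq = proj₂ (∃Last (First⇒∈ fq))
    inˡ : x ∈ p → y ∈ p → Adj p x y ⊎ Adj q x y ⊎ Link p q x y → Adj p x y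
    inˡ x∈ y∈ (inj₁ a) = a
    inˡ x∈ y∈ (inj₂ (inj₁ a)) = contradiction (x∈ , Adj⇒∈ a) dis
    inˡ x∈ y∈ (inj₂ (inj₂ (inj₁ (_ , f)))) = contradiction (y∈ , First⇒∈ f) dis
    inˡ x∈ y∈ (inj₂ (inj₂ (inj₂ (_ , f)))) = contradiction (x∈ , First⇒∈ f) dis
    inʳ : x ∈ q → y ∈ q → Adj p x y ⊎ Adj q x y ⊎ Link p q x y → Adj q x y
    inʳ x∈ y∈ (inj₁ a) = contradiction (Adj⇒∈ a , x∈) dis
    inʳ x∈ y∈ (inj₂ (inj₁ a)) = a
    inʳ x∈ y∈ (inj₂ (inj₂ (inj₁ (l , _)))) = contradiction (Last⇒∈ l , x∈) dis
    inʳ x∈ y∈ (inj₂ (inj₂ (inj₂ (l , _)))) = contradiction (Last⇒∈ l , y∈) dis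
    inˣ : x ∈ p → y ∈ q → Adj p x y ⊎ Adj q x y ⊎ Link p q x y → x ≡ _ × y ≡ _
    inˣ x∈ y∈ (inj₁ a) = contradiction (Adj⇒∈ʳ a , y∈) dis
    inˣ x∈ y∈ (inj₂ (inj₁ a)) = contradiction (x∈ , Adj⇒∈ a) dis
    inˣ x∈ y∈ (inj₂ (inj₂ (inj₁ (l , f)))) = Last-unique l lp , First-unique f fq
    inˣ x∈ y∈ (inj₂ (inj₂ (inj₂ (l , _)))) = contradiction (Last⇒∈ l , y∈) dis

  -- The length bound excludes only the case of two single vertices, where the two joining edges
  -- coincide.
  ring : Path a b p → Path c d q → b ~ c → d ~ a → Apart p q →
         (∀ {x y} → x ∈ p → y ∈ q → x ~ y → x ≡ b × y ≡ c ⊎ x ≡ a × y ≡ d) →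
         3 ℕ.≤ length (p ++ q) → Cyc (p ++ q)
  ring {a = a} {b} {p} {c} {d} {q} P Q b~c d~a dis cross long = record
    { long   = long
    ; unique = Unique.++⁺ P.unique Q.unique dis
    ; adj⇒~  = to ∘ Adj-close-++⁻ P.start Q.end
    ; ~⇒adj  = λ x∈ y∈ e → Adj-close-++⁺ P.start (from (∈-++⁻ p x∈) (∈-++⁻ p y∈) e)
    }
    where
    module P = Path P
    module Q = Path Q
    to : Adj p x y ⊎ Adj q x y ⊎ Link p q x y ⊎ Link q p x y → x ~ y
    to (inj₁ a) = P.adj⇒~ a
    to (inj₂ (inj₁ a)) = Q.adj⇒~ a
    to (inj₂ (inj₂ (inj₁ (inj₁ (l , f)))))
      rewrite Last-unique l P.end | First-unique f Q.start = b~c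
    to (inj₂ (inj₂ (inj₁ (inj₂ (l , f)))))
      rewrite Last-unique l P.end | First-unique f Q.start = ~-sym b~c
    to (inj₂ (inj₂ (inj₂ (inj₁ (l , f)))))
      rewrite Last-unique l Q.end | First-unique f P.start = d~a
    to (inj₂ (inj₂ (inj₂ (inj₂ (l , f)))))
      rewrite Last-unique l Q.end | First-unique f P.start = ~-sym d~a
    from : x ∈ p ⊎ x ∈ q → y ∈ p ⊎ y ∈ q → x ~ y →
           Adj p x y ⊎ Adj q x y ⊎ Link p q x y ⊎ Link q p x y
    from (inj₁ x∈) (inj₁ y∈) e = inj₁ (P.~⇒adj x∈ y∈ e)
    from (inj₂ x∈) (inj₂ y∈) e = inj₂ (inj₁ (Q.~⇒adj x∈ y∈ e))
    from (inj₁ x∈) (inj₂ y∈) e with cross x∈ y∈ e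
    ... | inj₁ (refl , refl) = inj₂ (inj₂ (inj₁ (inj₁ (P.end , Q.start))))
    ... | inj₂ (refl , refl) = inj₂ (inj₂ (inj₂ (inj₂ (Q.end , P.start))))
    from (inj₂ x∈) (inj₁ y∈) e with cross y∈ x∈ (~-sym e)
    ... | inj₁ (refl , refl) = inj₂ (inj₂ (inj₁ (inj₂ (P.end , Q.start))))
    ... | inj₂ (refl , refl) = inj₂ (inj₂ (inj₂ (inj₁ (Q.end , P.start))))

  -- An induced cycle as seen from its vertex `w`: the rest is an induced path, and the two
  -- neighbours of `w` are its ends. This is the form in which a single vertex of a cycle can be
  -- exchanged.
  record Hoop (w l r : Fin N) (p : Walk N) : Set where
    field
      path : Path l r p
      w∉p  : w ∉ p
      l≢r  : l ≢ r
      w~l  : w ~ l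
      w~r  : w ~ r
      w~⇒  : x ∈ p → w ~ x → x ≡ l ⊎ x ≡ r

  hoop⇒cyc : Hoop w l r p → Cyc (w ∷ p)
  hoop⇒cyc {w} {l} {r} {p} H = ring Path-[] path w~l (~-sym w~r)
    (λ { (here refl , m) → w∉p m })
    (λ { (here refl) y∈ e → Sum.map (refl ,_) (refl ,_) (w~⇒ y∈ e) })
    (s≤s (len (Path.start path) (Path.end path)))
    where
    open Hoop H
    len : ∀ {p} → First p l → Last p r → 2 ℕ.≤ length p
    len first last              = contradiction refl l≢r
    len first (there last)      = s≤s (s≤s z≤n)
    len first (there (there _)) = s≤s (s≤s z≤n)

  cyc⇒hoop : Cyc (w ∷ p) → ∃[ l ] ∃[ r ] Hoop w l r p
  cyc⇒hoop {w} {p@(l ∷ p′@(_ ∷ _))} C = l , _ , record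
    { path = record
      { unique = proj₁ (proj₂ u) ; start = first ; end = there end
      ; adj⇒~ = λ a → adj⇒~ (Adj-close-++⁺ (first {x = w} {p = []}) (inj₂ (inj₁ a)))
      ; ~⇒adj = λ x∈ y∈ e → within x∈ y∈ (split (there x∈) (there y∈) e) }
    ; w∉p = w∉p
    ; l≢r = λ { refl → Unique-head (proj₁ (proj₂ u)) (Last⇒∈ end) }
    ; w~l = adj⇒~ here
    ; w~r = adj⇒~ (Adj-sym (Adj-link (there (there end)) first))
    ; w~⇒ = λ x∈ e → ends x∈ (split (here refl) (there x∈) e)
    }
    where
    open Cyc C
    u = Unique-++⁻ (w ∷ []) unique
    w∉p : w ∉ p
    w∉p m = proj₂ (proj₂ u) (here refl , m)
    r₁ = proj₁ (∃Last {p = p′} (here refl))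
    end = proj₂ (∃Last {p = p′} (here refl))
    split : x ∈ w ∷ p → y ∈ w ∷ p → x ~ y →
            Adj (w ∷ []) x y ⊎ Adj p x y ⊎ Link (w ∷ []) p x y ⊎ Link p (w ∷ []) x y
    split x∈ y∈ e = Adj-close-++⁻ first (there end) (~⇒adj x∈ y∈ e)
    within : x ∈ p → y ∈ p → Adj (w ∷ []) x y ⊎ Adj p x y ⊎ Link (w ∷ []) p x y ⊎ Link p (w ∷ []) x y →
             Adj p x y
    within x∈ y∈ (inj₁ (there ()))
    within x∈ y∈ (inj₂ (inj₁ a)) = a
    within x∈ y∈ (inj₂ (inj₂ (inj₁ (inj₁ (last , _))))) = contradiction x∈ w∉p
    within x∈ y∈ (inj₂ (inj₂ (inj₁ (inj₂ (last , _))))) = contradiction y∈ w∉p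
    within x∈ y∈ (inj₂ (inj₂ (inj₂ (inj₁ (_ , first))))) = contradiction y∈ w∉p
    within x∈ y∈ (inj₂ (inj₂ (inj₂ (inj₂ (_ , first))))) = contradiction x∈ w∉p
    ends : x ∈ p → Adj (w ∷ []) w x ⊎ Adj p w x ⊎ Link (w ∷ []) p w x ⊎ Link p (w ∷ []) w x → x ≡ l ⊎ x ≡ r₁
    ends x∈ (inj₁ (there ()))
    ends x∈ (inj₂ (inj₁ a)) = contradiction (Adj⇒∈ a) w∉p
    ends x∈ (inj₂ (inj₂ (inj₁ (inj₁ (_ , first))))) = inj₁ refl
    ends x∈ (inj₂ (inj₂ (inj₁ (inj₂ (last , _))))) = contradiction x∈ w∉p
    ends x∈ (inj₂ (inj₂ (inj₂ (inj₁ (_ , first))))) = contradiction x∈ w∉p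
    ends x∈ (inj₂ (inj₂ (inj₂ (inj₂ (k , _))))) = inj₂ (Last-unique k (there end))
  cyc⇒hoop {w} {[]}     C = contradiction (Cyc.long C) λ { (s≤s ()) }
  cyc⇒hoop {w} {_ ∷ []} C = contradiction (Cyc.long C) λ { (s≤s (s≤s ())) }

  hoopAt : Cyc p → w ∈ p → ∃[ q ] ∃[ l ] ∃[ r ] p ↭ w ∷ q × Hoop w l r q
  hoopAt {w = w} C w∈p with ∈-∃++ w∈p
  ... | [] , q , refl = q , let l , r , H = cyc⇒hoop C in l , r , ↭-refl , H
  ... | x ∷ p₁ , q , refl = q ++ x ∷ p₁ , let l , r , H = cyc⇒hoop rotated in l , r , perm , H
    where
    open Cyc C
    p₀ = x ∷ p₁
    perm : p₀ ++ w ∷ q ↭ w ∷ q ++ p₀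
    perm = ↭.++-comm p₀ (w ∷ q)
    lq = proj₂ (∃Last {p = w ∷ q} (here refl))
    -- Rotating a closed walk swaps its two arcs and its two links and changes nothing else.
    turn : ∀ {A B C D : Set} → A ⊎ B ⊎ C ⊎ D → B ⊎ A ⊎ D ⊎ C
    turn (inj₁ a)               = inj₂ (inj₁ a)
    turn (inj₂ (inj₁ b))        = inj₁ b
    turn (inj₂ (inj₂ (inj₁ c))) = inj₂ (inj₂ (inj₂ c))
    turn (inj₂ (inj₂ (inj₂ d))) = inj₂ (inj₂ (inj₁ d))
    rotated : Cyc (w ∷ q ++ p₀)
    rotated = record
      { long   = subst (3 ℕ.≤_) (↭.↭-length perm) long
      ; unique = Unique-resp-↭ perm unique
      ; adj⇒~  = adj⇒~ ∘ Adj-close-++⁺ {p = p₀} first ∘ turn ∘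
                 Adj-close-++⁻ {p = w ∷ q} first (proj₂ (∃Last {p = p₀} (here refl)))
      ; ~⇒adj  = λ x∈ y∈ e → Adj-close-++⁺ {p = w ∷ q} first $ turn $
                 Adj-close-++⁻ {p = p₀} first lq
                   (~⇒adj (↭.∈-resp-↭ (↭-sym perm) x∈) (↭.∈-resp-↭ (↭-sym perm) y∈) e)
      }

  hoop-reverse : Hoop w l r p → Hoop w r l (reverse p)
  hoop-reverse H = record
    { path = Path-reverse path
    ; w∉p = w∉p ∘ ∈-reverse⁻
    ; l≢r = l≢r ∘ sym
    ; w~l = w~r
    ; w~r = w~l
    ; w~⇒ = λ x∈ e → Sum.swap (w~⇒ (∈-reverse⁻ x∈) e)
    }
    where open Hoop H

-- Ears

module _ {N : ℕ} (G : Graph N) where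
  open Graph G using (_~_; _~?_; ~-sym; ~-irrefl)
  open Induced G

  private
    variable
      P P′ : Fin N → Set
      x y z : Fin N

  -- For a subset of an induced cycle: not contained in a vertex or an edge
  -- of the cycle.
  data Spread (P : Fin N → Set) : Set where
    three : P x → P y → P z → x ≢ y → x ≢ z → y ≢ z → Spread P
    far   : P x → P y → x ≢ y → ¬ x ~ y → Spread P

  spread? : Decidable P → Dec (Spread P)
  spread? P? = map′
    [ (λ (_ , _ , _ , px , py , pz , a , b , c) → three px py pz a b c)
    , (λ (_ , _ , px , py , a , b) → far px py a b) ]′
    (λ { (three px py pz a b c) → inj₁ (_ , _ , _ , px , py , pz , a , b , c)
       ; (far px py a b) → inj₂ (_ , _ , px , py , a , b) })
    ((any? λ x → any? λ y → any? λ z →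
        P? x ×-dec P? y ×-dec P? z ×-dec ¬? (x ≟ y) ×-dec ¬? (x ≟ z) ×-dec ¬? (y ≟ z))
     ⊎-dec (any? λ x → any? λ y → P? x ×-dec P? y ×-dec ¬? (x ≟ y) ×-dec ¬? (x ~? y)))

  ¬spread⇒~ : ¬ Spread P → P x → P y → x ≢ y → x ~ y
  ¬spread⇒~ {x = x} {y} ns px py x≢y =
    decidable-stable (x ~? y) λ x≁y → ns (far px py x≢y x≁y)

  ¬spread⇒pair : ¬ Spread P → P x → P y → x ≢ y → P z → z ≡ x ⊎ z ≡ y
  ¬spread⇒pair {x = x} {y} {z} ns px py x≢y pz with z ≟ x | z ≟ y
  ... | yes z≡x | _       = inj₁ z≡x
  ... | no _    | yes z≡y = inj₂ z≡y
  ... | no z≢x  | no z≢y  = contradiction (three px py pz x≢y (z≢x ∘ sym) (z≢y ∘ sym)) ns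

  pair⇒¬spread : x ~ y → (∀ {z} → P z → z ≡ x ⊎ z ≡ y) → ¬ Spread P
  pair⇒¬spread x~y only (three p q r p≢q p≢r q≢r) with only p | only q | only r
  ... | inj₁ refl | inj₁ refl | _         = p≢q refl
  ... | inj₂ refl | inj₂ refl | _         = p≢q refl
  ... | inj₁ refl | inj₂ refl | inj₁ refl = p≢r refl
  ... | inj₁ refl | inj₂ refl | inj₂ refl = q≢r refl
  ... | inj₂ refl | inj₁ refl | inj₁ refl = q≢r refl
  ... | inj₂ refl | inj₁ refl | inj₂ refl = p≢r refl
  pair⇒¬spread x~y only (far p q p≢q p≁q) with only p | only q
  ... | inj₁ refl | inj₁ refl = p≢q refl
  ... | inj₂ refl | inj₂ refl = p≢q refl
  ... | inj₁ refl | inj₂ refl = p≁q x~y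
  ... | inj₂ refl | inj₁ refl = p≁q (~-sym x~y)

  one⇒¬spread : (∀ {z} → P z → z ≡ x) → ¬ Spread P
  one⇒¬spread only (three p q _ p≢q _ _) = p≢q (trans (only p) (sym (only q)))
  one⇒¬spread only (far p q p≢q _)       = p≢q (trans (only p) (sym (only q)))

  spread⇒other : Spread P → ∀ w → ∃[ x ] P x × x ≢ w
  spread⇒other s w = case pick s of λ (x , y , px , py , x≢y) → choose px py x≢y
    where
    pick : Spread P → ∃[ x ] ∃[ y ] P x × P y × x ≢ y
    pick (three p q _ p≢q _ _) = _ , _ , p , q , p≢q
    pick (far p q p≢q _)       = _ , _ , p , q , p≢q
    choose : P x → P y → x ≢ y → ∃[ x ] P x × x ≢ w
    choose {x = x} {y = y} px py x≢y with x ≟ w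
    ... | yes refl = y , py , x≢y ∘ sym
    ... | no x≢w   = x , px , x≢w

  record Nbr (s : Fin N) (C : Walk N) (x : Fin N) : Set where
    constructor nbr
    field
      ∈C : x ∈ C
      s~ : s ~ x

  nbr? : ∀ s C → Decidable (Nbr s C)
  nbr? s C x = map′ (λ (a , b) → nbr a b) (λ (nbr a b) → a , b) ((x ∈? C) ×-dec (s ~? x))

  -- The condition on the ends of an ear, with neighbourhoods A and B in
  -- the cycle.
  data Ends (s t : Fin N) (A B : Fin N → Set) : Set where
    single : s ≡ t → Spread A → Ends s t A B
    double : s ≢ t → ∃ A → ¬ Spread A → ∃ B → ¬ Spread B →
             Spread (λ x → A x ⊎ B x) → Ends s t A B

  -- Every solid is an induced cycle C together with a path Q outside C of
  -- which only the ends have neighbours in C.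
  record Ear (C Q : Walk N) (s t : Fin N) : Set where
    field
      cyc   : Cyc C
      path  : Path s t Q
      apart : Apart Q C
      inner : ∀ {q c} → q ∈ Q → c ∈ C → q ~ c → q ≡ s ⊎ q ≡ t
      ends  : Ends s t (Nbr s C) (Nbr t C)

  -- Up to permutation, because only the vertex set of an ear enters the count.
  EarOn : Walk N → Set
  EarOn L = ∃[ C ] ∃[ Q ] ∃[ s ] ∃[ t ] Ear C Q s t × C ++ Q ↭ L

Spread-map : ∀ {N} {G H : Graph N} {P P′ : Fin N → Set} (f : Fin N → Fin N) →
  (∀ {x} → P x → P′ (f x)) → (∀ {x y} → P x → P y → f x ≡ f y → x ≡ y) →
  (∀ {x y} → P x → P y → Graph._~_ H (f x) (f y) → Graph._~_ G x y) → Spread G P → Spread H P′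
Spread-map f to inj refl~ (three p q r p≢q p≢r q≢r) =
  three (to p) (to q) (to r) (p≢q ∘ inj p q) (p≢r ∘ inj p r) (q≢r ∘ inj q r)
Spread-map f to inj refl~ (far p q p≢q p≁q) = far (to p) (to q) (p≢q ∘ inj p q) (p≁q ∘ refl~ p q)

Spread-mono : ∀ {N} {G : Graph N} {P P′ : Fin N → Set} → (∀ {x} → P x → P′ x) →
              Spread G P → Spread G P′
Spread-mono to = Spread-map id to (λ _ _ → id) (λ _ _ → id)

-- The constructor `single` speaks of the first neighbourhood only, so exchanging the two requires
-- passing from `A` to `B` when the ends coincide.
Ends-reverse : ∀ {N} {G : Graph N} {s t} {A B : Fin N → Set} → (s ≡ t → ∀ {x} → A x → B x) →
               Ends G s t A B → Ends G t s B A
Ends-reverse A⇒B (single refl sp)         = single refl (Spread-mono (A⇒B refl) sp)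
Ends-reverse A⇒B (double s≢t a ¬a b ¬b sp) =
  double (s≢t ∘ sym) b ¬b a ¬a (Spread-mono Sum.swap sp)

module _ {N : ℕ} {G : Graph N} where

  open Graph G using (_~_; ~-sym)
  open Induced G

  Ear-reverse : ∀ {C Q s t} → Ear G C Q s t → Ear G C (reverse Q) t s
  Ear-reverse E = record
    { cyc   = cyc
    ; path  = Path-reverse path
    ; apart = λ (x∈ , y∈) → apart (∈-reverse⁻ x∈ , y∈)
    ; inner = λ q∈ c∈ e → Sum.swap (inner (∈-reverse⁻ q∈) c∈ e)
    ; ends  = Ends-reverse (λ { refl a → a }) ends
    }
    where open Ear E

  -- The rerouted cycle runs along Q instead of m, which becomes the centre of
  -- a wheel.
  bypass : ∀ {C Q m a b s t} → Cyc C → m ∈ C → a ∈ C → b ∈ C → m ~ a → m ~ b → a ≢ b →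
           Path s t Q → Apart Q C → s ~ a → t ~ b →
           (∀ {q y} → q ∈ Q → y ∈ C → y ≢ m → q ~ y → q ≡ s × y ≡ a ⊎ q ≡ t × y ≡ b) →
           (∃[ q ] q ∈ Q × m ~ q) →
           ∃[ C′ ] Ear G C′ (m ∷ []) m m × C′ ++ m ∷ [] ↭ C ++ Q
  bypass {C} {Q} {m} {a} {b} {s} {t} cyc m∈C a∈C b∈C m~a m~b a≢b path apart s~a t~b cross (q , q∈Q , m~q)
    with hoopAt cyc m∈C
  -- Two distinct neighbours of `m` on the cycle are the two ends of the path `J` left by removing
  -- `m`. `J` is oriented so as to lead from `b` back to `a` after `Q`.
  ... | J , l , r , C↭ , H = case w~⇒ (inJ a∈C m~a) m~a , w~⇒ (inJ b∈C m~b) m~b of λ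
    { (inj₁ refl , inj₁ refl) → contradiction refl a≢b
    ; (inj₂ refl , inj₂ refl) → contradiction refl a≢b
    ; (inj₂ refl , inj₁ refl) → close-up (Hoop.path H) id ↭-refl
    ; (inj₁ refl , inj₂ refl) → close-up (Path-reverse (Hoop.path H)) ∈-reverse⁻ (↭.↭-reverse J)
    }
    where
    open Hoop H using (w~⇒; w∉p)
    inJ : ∀ {x} → x ∈ C → m ~ x → x ∈ J
    inJ x∈C m~x with ↭.∈-resp-↭ C↭ x∈C
    ... | here refl = contradiction refl (~⇒≢ m~x)
    ... | there x∈J = x∈J
    J⊆C : ∀ {x} → x ∈ J → x ∈ C
    J⊆C = ↭.∈-resp-↭ (↭-sym C↭) ∘ there
    J≢m : ∀ {x} → x ∈ J → x ≢ m
    J≢m x∈J refl = w∉p x∈J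
    close-up : ∀ {J′} → Path b a J′ → (∀ {x} → x ∈ J′ → x ∈ J) → J′ ↭ J →
               ∃[ C′ ] Ear G C′ (m ∷ []) m m × C′ ++ m ∷ [] ↭ C ++ Q
    close-up {J′} π ⊆J J′↭ = Q ++ J′ , record
      { cyc = ring path π t~b (~-sym s~a)
          (λ (x∈ , y∈) → apart (x∈ , J⊆C (⊆J y∈)))
          (λ q∈ y∈ e → Sum.swap (cross q∈ (J⊆C (⊆J y∈)) (J≢m (⊆J y∈)) e))
          (long (Path.start path) (Path.start π) (Path.end π))
      ; path = Path-[]
      ; apart = λ { (here refl , x∈) → [ (λ k → apart (k , m∈C)) , w∉p ∘ ⊆J ]′ (∈-++⁻ Q x∈) }
      ; inner = λ { (here refl) _ _ → inj₁ refl }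
      -- `m` keeps its cycle neighbours `a` and `b` and gains the vertex `q` of the new arc, so that
      -- its neighbourhood is spread.
      ; ends = single refl $ three
          (nbr (∈-++⁺ʳ Q (Last⇒∈ (Path.end π))) m~a)
          (nbr (∈-++⁺ʳ Q (First⇒∈ (Path.start π))) m~b)
          (nbr (∈-++⁺ˡ q∈Q) m~q)
          a≢b (λ { refl → apart (q∈Q , a∈C) }) (λ { refl → apart (q∈Q , b∈C) })
      } ,
      ↭-trans (↭-sym (↭.∷↭∷ʳ m (Q ++ J′)))
        (↭-trans (prep m (↭-trans (↭.++-comm Q J′) (↭.++⁺ʳ Q J′↭))) (↭.++⁺ʳ Q (↭-sym C↭)))
      where
      long : ∀ {Q J} → First Q s → First J b → Last J a → 3 ℕ.≤ length (Q ++ J)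
      long (first {p = Q}) first last = contradiction refl a≢b
      long (first {p = Q}) (first {p = _ ∷ J}) (there _) =
        s≤s (subst (2 ℕ.≤_) (sym (List.length-++ Q)) (ℕ.≤-trans (s≤s (s≤s z≤n)) (ℕ.m≤n+m _ (length Q))))

-- Transport of paths, cycles and ears along embeddings

module _ {A B : Set} (f : A → B) where

  Adj-map⁺ : ∀ {p x y} → Adj p x y → Adj (map f p) (f x) (f y)
  Adj-map⁺ here      = here
  Adj-map⁺ ereh      = ereh
  Adj-map⁺ (there a) = there (Adj-map⁺ a)

  Adj-map⁻ : ∀ p {a b} → Adj (map f p) a b → ∃[ x ] ∃[ y ] a ≡ f x × b ≡ f y × Adj p x y
  Adj-map⁻ (x ∷ y ∷ p) here      = x , y , refl , refl , here
  Adj-map⁻ (x ∷ y ∷ p) ereh      = y , x , refl , refl , ereh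
  Adj-map⁻ (_ ∷ p)     (there a) =
    let x , y , eq , eq′ , a′ = Adj-map⁻ p a in x , y , eq , eq′ , there a′

  First-map : ∀ {p x} → First p x → First (map f p) (f x)
  First-map first = first

  Last-map : ∀ {p x} → Last p x → Last (map f p) (f x)
  Last-map last      = last
  Last-map (there l) = there (Last-map l)

  Unique-map : ∀ {p} → (∀ {x y} → x ∈ p → y ∈ p → f x ≡ f y → x ≡ y) → Unique p → Unique (map f p)
  Unique-map {[]}    inj []        = []
  Unique-map {x ∷ p} inj (x≢ ∷ u) =
    All.tabulate (λ m eq → let y , y∈ , eq′ = ∈-map⁻ f m in
      All.lookup x≢ y∈ (inj (here refl) (there y∈) (trans eq eq′)))
    ∷ Unique-map (λ a b → inj (there a) (there b)) u

close-map : ∀ {N} (f : Fin N → Fin N) c → close (map f c) ≡ map f (close c)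
close-map f []      = refl
close-map f (x ∷ c) = sym (List.map-++ f (x ∷ c) (x ∷ []))

close-∈ : ∀ {N} {x : Fin N} c → x ∈ close c → x ∈ c
close-∈ (y ∷ c) x∈ with ∈-++⁻ (y ∷ c) x∈
... | inj₁ x∈′        = x∈′
... | inj₂ (here eq)  = here eq

module _ {N : ℕ} {H G : Graph N} where
  open Graph H using () renaming (_~_ to _≈_)
  open Graph G using (_~_)
  private
    module H = Induced H
    module G = Induced G

  -- The map need only behave well on the vertices of `p`. With `f = id` this compares a graph with
  -- an induced subgraph, or `G` with its contraction away from the contracted edge.
  record Embedding (f : Fin N → Fin N) (p : Walk N) : Set where
    field
      inj  : ∀ {x y} → x ∈ p → y ∈ p → f x ≡ f y → x ≡ y
      to   : ∀ {x y} → x ∈ p → y ∈ p → x ≈ y → f x ~ f y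
      from : ∀ {x y} → x ∈ p → y ∈ p → f x ~ f y → x ≈ y

  Embedding-⊆ : ∀ {f p q} → (∀ {x} → x ∈ q → x ∈ p) → Embedding f p → Embedding f q
  Embedding-⊆ ⊆ emb = record
    { inj = λ a b → inj (⊆ a) (⊆ b) ; to = λ a b → to (⊆ a) (⊆ b) ; from = λ a b → from (⊆ a) (⊆ b) }
    where open Embedding emb

  Path-map : ∀ {f s t p} → Embedding f p → H.Path s t p → G.Path (f s) (f t) (map f p)
  Path-map {f} {p = p} emb π = record
    { unique = Unique-map f inj unique
    ; start  = First-map f start
    ; end    = Last-map f end
    ; adj⇒~  = λ a → case Adj-map⁻ f p a of λ
      { (_ , _ , refl , refl , a′) → to (Adj⇒∈ a′) (Adj⇒∈ʳ a′) (adj⇒~ a′) }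
    ; ~⇒adj  = λ x∈ y∈ e → case ∈-map⁻ f x∈ , ∈-map⁻ f y∈ of λ
      { ((_ , x∈′ , refl) , (_ , y∈′ , refl)) → Adj-map⁺ f (~⇒adj x∈′ y∈′ (from x∈′ y∈′ e)) }
    }
    where
    open Embedding emb
    open H.Path π

  Cyc-map : ∀ {f c} → Embedding f c → H.Cyc c → G.Cyc (map f c)
  Cyc-map {f} {c} emb C = record
    { long   = subst (3 ℕ.≤_) (sym (List.length-map f c)) long
    ; unique = Unique-map f inj unique
    ; adj⇒~  = λ a → case Adj-map⁻ f (close c) (subst (λ q → Adj q _ _) (close-map f c) a) of λ
      { (_ , _ , refl , refl , a′) →
          to (close-∈ c (Adj⇒∈ a′)) (close-∈ c (Adj⇒∈ʳ a′)) (adj⇒~ a′) }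
    ; ~⇒adj  = λ x∈ y∈ e → case ∈-map⁻ f x∈ , ∈-map⁻ f y∈ of λ
      { ((_ , x∈′ , refl) , (_ , y∈′ , refl)) →
          subst (λ q → Adj q _ _) (sym (close-map f c))
            (Adj-map⁺ f (~⇒adj x∈′ y∈′ (from x∈′ y∈′ e))) }
    }
    where
    open Embedding emb
    open H.Cyc C

  private
    Embedding-id : ∀ {p} → (∀ {x y} → x ∈ p → y ∈ p → x ≈ y → x ~ y) →
                   (∀ {x y} → x ∈ p → y ∈ p → x ~ y → x ≈ y) → Embedding id p
    Embedding-id to from = record { inj = λ _ _ → id ; to = to ; from = from }

  Path-resp : ∀ {s t p} → (∀ {x y} → x ∈ p → y ∈ p → x ≈ y → x ~ y) →
              (∀ {x y} → x ∈ p → y ∈ p → x ~ y → x ≈ y) → H.Path s t p → G.Path s t p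
  Path-resp to from π = subst (G.Path _ _) (List.map-id _) (Path-map (Embedding-id to from) π)

  Cyc-resp : ∀ {c} → (∀ {x y} → x ∈ c → y ∈ c → x ≈ y → x ~ y) →
             (∀ {x y} → x ∈ c → y ∈ c → x ~ y → x ≈ y) → H.Cyc c → G.Cyc c
  Cyc-resp to from C = subst G.Cyc (List.map-id _) (Cyc-map (Embedding-id to from) C)

  Ear-map : ∀ {f C Q s t} → Embedding f (C ++ Q) → Ear H C Q s t →
            Ear G (map f C) (map f Q) (f s) (f t)
  Ear-map {f} {C} {Q} {s} {t} emb E = record
    { cyc   = Cyc-map (Embedding-⊆ ∈-++⁺ˡ emb) cyc
    ; path  = Path-map (Embedding-⊆ (∈-++⁺ʳ C) emb) path
    ; apart = λ (x∈ , y∈) → case ∈-map⁻ f x∈ , ∈-map⁻ f y∈ of λ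
      { ((_ , x∈′ , refl) , (_ , y∈′ , eq)) →
          apart (x∈′ , subst (_∈ C) (sym (inj (∈-++⁺ʳ C x∈′) (∈-++⁺ˡ y∈′) eq)) y∈′) }
    ; inner = λ x∈ y∈ e → case ∈-map⁻ f x∈ , ∈-map⁻ f y∈ of λ
      { ((_ , x∈′ , refl) , (_ , y∈′ , refl)) → Sum.map (cong f) (cong f)
          (inner x∈′ y∈′ (from (∈-++⁺ʳ C x∈′) (∈-++⁺ˡ y∈′) e)) }
    ; ends  = move ends
    }
    where
    open Embedding emb
    open Ear E
    s∈ = First⇒∈ (H.Path.start path)
    t∈ = Last⇒∈ (H.Path.end path)
    nbr⁺ : ∀ {s x} → s ∈ Q → Nbr H s C x → Nbr G (f s) (map f C) (f x)
    nbr⁺ s∈ (nbr x∈ e) = nbr (∈-map⁺ f x∈) (to (∈-++⁺ʳ C s∈) (∈-++⁺ˡ x∈) e)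
    nbr⁻ : ∀ {s y} → s ∈ Q → Nbr G (f s) (map f C) y → ∃[ x ] y ≡ f x × Nbr H s C x
    nbr⁻ s∈ (nbr y∈ e) with ∈-map⁻ f y∈
    ... | x , x∈ , refl = x , refl , nbr x∈ (from (∈-++⁺ʳ C s∈) (∈-++⁺ˡ x∈) e)
    inj′ : ∀ {x y} → x ∈ C → y ∈ C → f x ≡ f y → x ≡ y
    inj′ x∈ y∈ = inj (∈-++⁺ˡ x∈) (∈-++⁺ˡ y∈)
    from′ : ∀ {x y} → x ∈ C → y ∈ C → f x ~ f y → x ≈ y
    from′ x∈ y∈ = from (∈-++⁺ˡ x∈) (∈-++⁺ˡ y∈)
    ¬move : ∀ {s} → s ∈ Q → ¬ Spread H (Nbr H s C) → ¬ Spread G (Nbr G (f s) (map f C))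
    ¬move s∈ ¬sp (three a b c a≢b a≢c b≢c) with nbr⁻ s∈ a | nbr⁻ s∈ b | nbr⁻ s∈ c
    ... | _ , refl , a′ | _ , refl , b′ | _ , refl , c′ =
      ¬sp (three a′ b′ c′ (a≢b ∘ cong f) (a≢c ∘ cong f) (b≢c ∘ cong f))
    ¬move s∈ ¬sp (far a b a≢b a≁b) with nbr⁻ s∈ a | nbr⁻ s∈ b
    ... | _ , refl , a′@(nbr x∈ _) | _ , refl , b′@(nbr y∈ _) =
      ¬sp (far a′ b′ (a≢b ∘ cong f) (a≁b ∘ to (∈-++⁺ˡ x∈) (∈-++⁺ˡ y∈)))
    ∈∪ : ∀ {x} → Nbr H s C x ⊎ Nbr H t C x → x ∈ C
    ∈∪ = [ Nbr.∈C , Nbr.∈C ]′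
    move : Ends H s t (Nbr H s C) (Nbr H t C) →
           Ends G (f s) (f t) (Nbr G (f s) (map f C)) (Nbr G (f t) (map f C))
    move (single refl sp) = single refl $ Spread-map f (nbr⁺ s∈)
      (λ a b → inj′ (Nbr.∈C a) (Nbr.∈C b)) (λ a b → from′ (Nbr.∈C a) (Nbr.∈C b)) sp
    move (double s≢t (_ , a) ¬a (_ , b) ¬b sp) =
      double (s≢t ∘ inj (∈-++⁺ʳ C s∈) (∈-++⁺ʳ C t∈))
        (_ , nbr⁺ s∈ a) (¬move s∈ ¬a) (_ , nbr⁺ t∈ b) (¬move t∈ ¬b)
        (Spread-map f (Sum.map (nbr⁺ s∈) (nbr⁺ t∈))
          (λ a b → inj′ (∈∪ a) (∈∪ b)) (λ a b → from′ (∈∪ a) (∈∪ b)) sp)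

  EarOn-map : ∀ {f L} → Embedding f L → EarOn H L → EarOn G (map f L)
  EarOn-map {f} emb (C , Q , s , t , E , perm) =
    map f C , map f Q , f s , f t ,
    Ear-map (Embedding-⊆ (↭.∈-resp-↭ perm) emb) E ,
    subst (_↭ _) (List.map-++ f C Q) (↭.map⁺ f perm)

  EarOn-resp : ∀ {L} → (∀ {x y} → x ∈ L → y ∈ L → x ≈ y → x ~ y) →
               (∀ {x y} → x ∈ L → y ∈ L → x ~ y → x ≈ y) → EarOn H L → EarOn G L
  EarOn-resp to from E = subst (EarOn G) (List.map-id _) (EarOn-map (Embedding-id to from) E)

-- Splitting a vertex of an ear

replace-↭ : ∀ {A : Set} {w : A} {R xs} P m → P ++ w ∷ R ↭ w ∷ xs → P ++ m ++ R ↭ m ++ xs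
replace-↭ P m p = ↭-trans (↭.shifts P m) (↭.++⁺ˡ m (↭.drop-mid P [] p))

replace-↭₂ : ∀ {A : Set} {w : A} {R xs} C P m → C ++ P ++ w ∷ R ↭ w ∷ xs →
             C ++ P ++ m ++ R ↭ m ++ xs
replace-↭₂ {R = R} C P m p =
  ↭-trans (↭-reflexive (sym (List.++-assoc C P (m ++ R))))
    (replace-↭ (C ++ P) m (↭-trans (↭-reflexive (List.++-assoc C P _)) p))

module _ {N : ℕ} where

  rename : Fin N → Fin N → Fin N → Fin N
  rename w z x = if does (x ≟ w) then z else x

  rename-same : ∀ w z → rename w z w ≡ z
  rename-same w z with w ≟ w
  ... | yes _   = refl
  ... | no w≢w = contradiction refl w≢w

  rename-≢ : ∀ {w z x} → x ≢ w → rename w z x ≡ x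
  rename-≢ {w} {x = x} x≢w with x ≟ w
  ... | yes x≡w = contradiction x≡w x≢w
  ... | no _    = refl

module _ {N : ℕ} (G : Graph N) where

  open Graph G using (_~_)

  Outcome : Fin N → Fin N → Walk N → Set
  Outcome u v xs = EarOn G (u ∷ v ∷ xs) ⊎ EarOn G (u ∷ xs) ⊎ EarOn G (v ∷ xs)

  -- A private neighbour of `v`. If there is none, `u` can play the role of `w` by itself, so the
  -- case analysis proceeds with one for each of `u` and `v`.
  Extra : Fin N → Fin N → Walk N → Set
  Extra u v xs = ∃[ a ] a ∈ xs × v ~ a × ¬ u ~ a

module _ {N : ℕ} {G : Graph N} where

  EarOn-↭ : ∀ {L M} → L ↭ M → EarOn G L → EarOn G M
  EarOn-↭ L↭M (C , Q , s , t , E , p) = C , Q , s , t , E , ↭-trans p L↭M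

  flip-Outcome : ∀ {u v xs} → Outcome G v u xs → Outcome G u v xs
  flip-Outcome (inj₁ E)        = inj₁ (EarOn-↭ (swap _ _ ↭-refl) E)
  flip-Outcome (inj₂ (inj₁ E)) = inj₂ (inj₂ E)
  flip-Outcome (inj₂ (inj₂ E)) = inj₂ (inj₁ E)

-- All that is used of the contraction near the vertices `xs`. `contract` itself treats its two
-- endpoints differently, by reusing one of the names; these conditions are symmetric in `u` and
-- `v`, so that every case needs to be treated for one of them only.
record Splitting {N} (H G : Graph N) (w u v : Fin N) (xs : Walk N) : Set where
  open Graph H using () renaming (_~_ to _≈_)
  open Graph G using (_~_)
  field
    u~v  : u ~ v
    w∉   : w ∉ xs
    u∉   : u ∉ xs
    v∉   : v ∉ xs
    to   : ∀ {x y} → x ∈ xs → y ∈ xs → x ≈ y → x ~ y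
    from : ∀ {x y} → x ∈ xs → y ∈ xs → x ~ y → x ≈ y
    w⇒   : ∀ {x} → x ∈ xs → w ≈ x → u ~ x ⊎ v ~ x
    u⇒   : ∀ {x} → x ∈ xs → u ~ x → w ≈ x
    v⇒   : ∀ {x} → x ∈ xs → v ~ x → w ≈ x

module _ {N : ℕ} {H G : Graph N} where

  open Graph H using () renaming (_~_ to _≈_; ~-sym to ≈-sym)
  open Graph G using (_~_; _~?_; ~-sym; ~-irrefl)
  private
    module H = Induced H
  open Induced G

  private
    variable
      w u v : Fin N
      xs : Walk N

  flip-Splitting : Splitting H G w u v xs → Splitting H G w v u xs
  flip-Splitting S = record
    { u~v = ~-sym u~v ; w∉ = w∉ ; u∉ = v∉ ; v∉ = u∉ ; to = to ; from = from
    ; w⇒ = λ x∈ e → Sum.swap (w⇒ x∈ e) ; u⇒ = v⇒ ; v⇒ = u⇒ }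
    where open Splitting S

  module _ (S : Splitting H G w u v xs) where
    open Splitting S

    spread⇒ : {P P′ : Fin N → Set} → (∀ {x} → P x → x ∈ xs) → (∀ {x} → P x → P′ x) →
              Spread H P → Spread G P′
    spread⇒ P⇒∈ P⇒P′ = Spread-map id P⇒P′ (λ _ _ → id) (λ a b → from (P⇒∈ a) (P⇒∈ b))

    spread⇐ : {P P′ : Fin N → Set} → (∀ {x} → P x → x ∈ xs) → (∀ {x} → P x → P′ x) →
              Spread G P → Spread H P′
    spread⇐ P⇒∈ P⇒P′ = Spread-map id P⇒P′ (λ _ _ → id) (λ a b → to (P⇒∈ a) (P⇒∈ b))

    -- Passing from `w` to `u` or `v` only loses edges. Distinct vertices stay distinct and
    -- nonadjacent ones nonadjacent, so a spread set stays spread.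
    spread-rename : ∀ {P P′ : Fin N → Set} z → (∀ {x} → P x → x ≡ w ⊎ x ∈ xs) → (P w → P′ z) →
                    (∀ {x} → x ∈ xs → P x → P′ x) → z ∉ xs →
                    (∀ {x} → x ∈ xs → z ~ x → w ≈ x) → Spread H P → Spread G P′
    spread-rename {P} {P′} z P⇒ Pw Px z∉ z⇒ = Spread-map f
      (λ p → [ (λ { refl → subst P′ (sym f-w) (Pw p) })
             , (λ x∈ → subst P′ (sym (f-∈ x∈)) (Px x∈ p)) ]′ (P⇒ p))
      (λ p q → inj (P⇒ p) (P⇒ q))
      (λ p q → back (P⇒ p) (P⇒ q))
      where
      f : Fin N → Fin N
      f = rename w z
      f-w : f w ≡ z
      f-w = rename-same w z
      f-∈ : ∀ {x} → x ∈ xs → f x ≡ x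
      f-∈ x∈ = rename-≢ λ { refl → w∉ x∈ }
      inj : ∀ {x y} → x ≡ w ⊎ x ∈ xs → y ≡ w ⊎ y ∈ xs → f x ≡ f y → x ≡ y
      inj (inj₁ refl) (inj₁ refl) _ = refl
      inj (inj₁ refl) (inj₂ y∈) eq rewrite f-w | f-∈ y∈ = contradiction (subst (_∈ xs) (sym eq) y∈) z∉
      inj (inj₂ x∈) (inj₁ refl) eq rewrite f-w | f-∈ x∈ = contradiction (subst (_∈ xs) eq x∈) z∉
      inj (inj₂ x∈) (inj₂ y∈) eq rewrite f-∈ x∈ | f-∈ y∈ = eq
      back : ∀ {x y} → x ≡ w ⊎ x ∈ xs → y ≡ w ⊎ y ∈ xs → f x ~ f y → x ≈ y
      back (inj₁ refl) (inj₁ refl) e = contradiction e ~-irrefl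
      back (inj₁ refl) (inj₂ y∈) e rewrite f-w | f-∈ y∈ = z⇒ y∈ e
      back (inj₂ x∈) (inj₁ refl) e rewrite f-w | f-∈ x∈ = ≈-sym (z⇒ x∈ (~-sym e))
      back (inj₂ x∈) (inj₂ y∈) e rewrite f-∈ x∈ | f-∈ y∈ = from x∈ y∈ e

    path⇒ : ∀ {s t p} → (∀ {x} → x ∈ p → x ∈ xs) → H.Path s t p → Path s t p
    path⇒ ⊆xs = Path-resp (λ a b → to (⊆xs a) (⊆xs b)) (λ a b → from (⊆xs a) (⊆xs b))

    cyc⇒ : ∀ {c} → (∀ {x} → x ∈ c → x ∈ xs) → H.Cyc c → Cyc c
    cyc⇒ ⊆xs = Cyc-resp (λ a b → to (⊆xs a) (⊆xs b)) (λ a b → from (⊆xs a) (⊆xs b))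

  -- The contracted vertex w lies on the cycle w ∷ J of an ear and has no
  -- neighbours on the path Q except possibly its start.
  record Site (w u v : Fin N) (xs J Q : Walk N) (l r s t : Fin N) : Set where
    field
      split : Splitting H G w u v xs
      hoop  : H.Hoop w l r J
      ear   : Ear H (w ∷ J) Q s t
      perm  : J ++ Q ↭ xs
      only  : s ≡ t ⊎ (∀ {c} → c ∈ w ∷ J → s ≈ c → c ≡ w)
    open Splitting split public
    open H.Hoop hoop using (path; l≢r; w~l; w~r; w~⇒) public
    open Ear ear using (apart; inner; ends) renaming (path to pathQ) public
    J⊆ : ∀ {x} → x ∈ J → x ∈ xs
    J⊆ = ↭.∈-resp-↭ perm ∘ ∈-++⁺ˡ
    Q⊆ : ∀ {x} → x ∈ Q → x ∈ xs
    Q⊆ = ↭.∈-resp-↭ perm ∘ ∈-++⁺ʳ J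
    s∈ : s ∈ Q
    s∈ = First⇒∈ (H.Path.start pathQ)
    t∈ : t ∈ Q
    t∈ = Last⇒∈ (H.Path.end pathQ)
    data EndsAt : Set where
      single : s ≡ t → Spread H (Nbr H s (w ∷ J)) → EndsAt
      double : s ≢ t → s ≈ w → (∀ {c} → c ∈ J → ¬ s ≈ c) → ¬ t ≈ w →
               ∃ (Nbr H t (w ∷ J)) → ¬ Spread H (Nbr H t (w ∷ J)) →
               Spread H (λ x → Nbr H s (w ∷ J) x ⊎ Nbr H t (w ∷ J) x) → EndsAt
    endsAt : EndsAt
    endsAt with only | ends
    ... | _          | single s≡t sp = single s≡t sp
    ... | inj₁ s≡t   | double s≢t _ _ _ _ _ = contradiction s≡t s≢t
    ... | inj₂ only′ | double s≢t (c , nbr c∈ s≈c) _ b ¬b sp =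
      double s≢t (subst (s ≈_) (only′ c∈ s≈c) s≈c)
        (λ c∈ s≈c → w∉ (subst (_∈ xs) (only′ (there c∈) s≈c) (J⊆ c∈)))
        -- If `t` were adjacent to `w`, the only neighbour of `s` on the cycle, then the union of
        -- both neighbourhoods would be that of `t`, which is not spread.
        (λ t≈w → ¬b (Spread-mono
          [ (λ (nbr c∈ s≈c) → subst (Nbr H t (w ∷ J)) (sym (only′ c∈ s≈c)) (nbr (here refl) t≈w)) , id ]′ sp))
        b ¬b sp
    w≈Q : ∀ {q} → q ∈ Q → w ≈ q → q ≡ s
    w≈Q q∈ w≈q with inner q∈ (here refl) (≈-sym w≈q) | endsAt
    ... | inj₁ q≡s  | _                         = q≡s
    ... | inj₂ refl | single s≡t _              = sym s≡t
    ... | inj₂ refl | double _ _ _ ¬t≈w _ _ _ = contradiction (≈-sym w≈q) ¬t≈w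

  flip-Site : ∀ {J Q l r s t} → Site w u v xs J Q l r s t → Site w v u xs J Q l r s t
  flip-Site A = record
    { split = flip-Splitting split ; hoop = hoop ; ear = ear ; perm = perm ; only = only }
    where open Site A

  -- Being adjacent to both `l` and `r`, `u` takes the place of `w` on the cycle. Then `v` is put in
  -- front of `Q`, or left out if a single vertex `s` still has a spread neighbourhood. The vertex
  -- `b` ensures that the neighbours of `v` on the new cycle lie within the edge `ub`.
  whole-end : ∀ {J Q l r s t} → Site w u v xs J Q l r s t → u ~ l → u ~ r → v ~ s → ¬ u ~ s →
              (∃[ b ] u ~ b × (∀ {x} → x ∈ J → v ~ x → x ≡ b)) → Outcome G u v xs
  whole-end {w} {u} {v} {xs} {J} {Q} {l} {r} {s} {t} A u~l u~r v~s u≁s (b , u~b , v~⇒) =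
    case endsAt of λ
      { (single refl sp) → case spread? G (nbr? G s (u ∷ J)) of λ
        { (yes sp′) → inj₂ (inj₁ (u ∷ J , Q , s , t , record
            { cyc = hoop⇒cyc hoopᵘ ; path = path⇒ split Q⊆ pathQ ; apart = apartᵘ
            ; inner = λ q∈ c∈ e → case c∈ of λ
              { (here refl) → inj₁ (w≈Q q∈ (u⇒ (Q⊆ q∈) (~-sym e)))
              ; (there c∈) → inner q∈ (there c∈) (from (Q⊆ q∈) (J⊆ c∈) e) }
            ; ends = single refl sp′ } , prep u perm))
        -- Having lost `w`, the neighbourhood of `s` is no longer spread, so `s` can be the far end
        -- of the longer path. It is not empty, because a spread set has a member besides `w`.
        ; (no ¬sp′) → case spread⇒other H sp w of λ
          { (x , nbr (here refl) _ , x≢w) → contradiction refl x≢w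
          ; (x , nbr (there x∈) s≈x , _) → extended (x , nbr (there x∈) (to (Q⊆ s∈) (J⊆ x∈) s≈x)) ¬sp′
              (λ {x} (nbr x∈ s≈x) → case x∈ of λ
                { (here eq) → inj₁ eq ; (there x∈) → inj₂ (nbr x∈ s≈x) }) sp }
        }
      ; (double s≢t s≈w s≉J t≉w (b , nbr b∈ t≈b) ¬b sp) → case b∈ of λ
        { (here refl) → contradiction t≈b t≉w
        ; (there b∈) → extended (b , nbr (there b∈) (to (Q⊆ t∈) (J⊆ b∈) t≈b))
          (¬b ∘ spread⇐ split tJ⊆ λ { (nbr (here refl) e) → contradiction (v⇒t e) t≉w
                                     ; (nbr (there x∈) e) → nbr (there x∈) (from (Q⊆ t∈) (J⊆ x∈) e) })
          [ (λ { (nbr (here eq) _) → inj₁ eq ; (nbr (there c∈) e) → contradiction e (s≉J c∈) })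
          , (λ { (nbr (here refl) e) → contradiction e t≉w ; (nbr (there c∈) e) → inj₂ (nbr c∈ e) }) ]′
          sp
        }
      }
    where
    open Site A
    v⇒t : t ~ u → t ≈ w
    v⇒t e = ≈-sym (u⇒ (Q⊆ t∈) (~-sym e))
    u≁t : ¬ t ~ u
    u≁t e = u≁s (subst (u ~_) (w≈Q t∈ (u⇒ (Q⊆ t∈) (~-sym e))) (~-sym e))
    tJ⊆ : ∀ {x} → Nbr G t (u ∷ J) x → x ∈ xs
    tJ⊆ (nbr (here refl) e) = contradiction e u≁t
    tJ⊆ (nbr (there x∈) _) = J⊆ x∈
    hoopᵘ : Hoop u l r J
    hoopᵘ = record
      { path = path⇒ split J⊆ path ; w∉p = u∉ ∘ J⊆ ; l≢r = l≢r ; w~l = u~l ; w~r = u~r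
      ; w~⇒ = λ x∈ e → w~⇒ x∈ (u⇒ (J⊆ x∈) e) }
    apartᵘ : Apart Q (u ∷ J)
    apartᵘ (x∈ , here refl) = u∉ (Q⊆ x∈)
    apartᵘ (x∈ , there x∈′) = apart (x∈ , there x∈′)
    v≢u : v ≢ u
    v≢u refl = ~-irrefl u~v
    extended : ∃ (Nbr G t (u ∷ J)) → ¬ Spread G (Nbr G t (u ∷ J)) →
               ∀ {P} → (∀ {x} → P x → x ≡ w ⊎ Nbr H t J x) → Spread H P → Outcome G u v xs
    extended b ¬b P⇒ sp = inj₁ (u ∷ J , v ∷ Q , v , t , record
      { cyc = hoop⇒cyc hoopᵘ
      ; path = Path-∷ (path⇒ split Q⊆ pathQ) v~s (v∉ ∘ Q⊆) (λ q∈ e → w≈Q q∈ (v⇒ (Q⊆ q∈) e))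
      ; apart = λ { (here refl , here eq) → v≢u eq
                  ; (here refl , there x∈) → v∉ (J⊆ x∈)
                  ; (there x∈ , y∈) → apartᵘ (x∈ , y∈) }
      ; inner = λ { (here refl) _ _ → inj₁ refl
                  ; (there q∈) (here refl) e → contradiction
                      (subst (u ~_) (w≈Q q∈ (u⇒ (Q⊆ q∈) (~-sym e))) (~-sym e)) u≁s
                  ; (there q∈) (there c∈) e → inj₂ (innerᵗ q∈ c∈ (from (Q⊆ q∈) (J⊆ c∈) e)) }
      ; ends = double (λ { refl → v∉ (Q⊆ t∈) })
          (u , nbr (here refl) (~-sym u~v))
          (pair⇒¬spread G u~b λ { (nbr (here eq) _) → inj₁ eq ; (nbr (there x∈) e) → inj₂ (v~⇒ x∈ e) })
          b ¬b
          (spread-rename split u (Sum.map₂ (J⊆ ∘ Nbr.∈C) ∘ P⇒)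
            (λ _ → inj₁ (nbr (here refl) (~-sym u~v)))
            (λ x∈ p → case P⇒ p of λ
              { (inj₁ refl) → contradiction x∈ w∉
              ; (inj₂ (nbr y∈ e)) → inj₂ (nbr (there y∈) (to (Q⊆ t∈) (J⊆ y∈) e)) })
            u∉ u⇒ sp)
      } , ↭-trans (↭.shift v (u ∷ J) Q) (swap v u perm))
      where
      innerᵗ : ∀ {q c} → q ∈ Q → c ∈ J → q ≈ c → q ≡ t
      innerᵗ q∈ c∈ e with inner q∈ (there c∈) e | endsAt
      ... | inj₂ q≡t  | _                       = q≡t
      ... | inj₁ refl | single s≡t _            = s≡t
      ... | inj₁ refl | double _ _ s≉J _ _ _ _ = contradiction e (s≉J c∈)

  -- Each of `u` and `v` inherits one cycle edge at `w`, so the edge `uv` takes the place of `w` and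
  -- `Q` stays as it is. Should `s` see both `u` and `v`, these still form an edge of the cycle.
  shared-end : ∀ {J Q l r s t} → Site w u v xs J Q l r s t → u ~ l → ¬ u ~ r → v ~ r → ¬ v ~ l →
               Outcome G u v xs
  shared-end {w} {u} {v} {xs} {J} {Q} {l} {r} {s} {t} A u~l u≁r v~r v≁l = inj₁ (C , Q , s , t , record
    { cyc = hoop⇒cyc record
        { path = Path-∷ (path⇒ split J⊆ path) u~l (u∉ ∘ J⊆)
            (λ y∈ e → [ id , (λ { refl → contradiction e u≁r }) ]′ (w~⇒ y∈ (u⇒ (J⊆ y∈) e)))
        ; w∉p = λ { (here refl) → ~-irrefl u~v ; (there v∈) → v∉ (J⊆ v∈) }
        ; l≢r = λ { refl → u∉ (J⊆ (Last⇒∈ (H.Path.end path))) }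
        ; w~l = ~-sym u~v
        ; w~r = v~r
        ; w~⇒ = λ { (here eq) _ → inj₁ eq
                  ; (there x∈) e → [ (λ { refl → contradiction e v≁l }) , inj₂ ]′ (w~⇒ x∈ (v⇒ (J⊆ x∈) e)) }
        }
    ; path = path⇒ split Q⊆ pathQ
    ; apart = λ { (x∈ , here refl) → v∉ (Q⊆ x∈) ; (x∈ , there (here refl)) → u∉ (Q⊆ x∈)
                ; (x∈ , there (there y∈)) → apart (x∈ , there y∈) }
    ; inner = λ { q∈ (here refl) e → inj₁ (w≈Q q∈ (v⇒ (Q⊆ q∈) (~-sym e)))
                ; q∈ (there (here refl)) e → inj₁ (w≈Q q∈ (u⇒ (Q⊆ q∈) (~-sym e)))
                ; q∈ (there (there c∈)) e → inner q∈ (there c∈) (from (Q⊆ q∈) (J⊆ c∈) e) }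
    ; ends = case chosen of λ (z , z∈ , z∉ , s≈w⇒ , z⇒) → case endsAt of λ
      { (single s≡t sp) → single s≡t (spread-rename split z
          (λ { (nbr (here eq) _) → inj₁ eq ; (nbr (there x∈) _) → inj₂ (J⊆ x∈) })
          (λ (nbr _ e) → nbr z∈ (s≈w⇒ e)) (λ x∈ (nbr x∈′ e) → lift s∈ x∈ x∈′ e) z∉ z⇒ sp)
      ; (double s≢t s≈w s≉J t≉w (b , nbr b∈ t≈b) ¬b sp) → double s≢t
          (z , nbr z∈ (s≈w⇒ s≈w))
          (pair⇒¬spread G (~-sym u~v) λ
            { (nbr (here eq) _) → inj₁ eq ; (nbr (there (here eq)) _) → inj₂ eq
            ; (nbr (there (there x∈)) e) → contradiction (from (Q⊆ s∈) (J⊆ x∈) e) (s≉J x∈) })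
          (case b∈ of λ { (here refl) → contradiction t≈b t≉w
                        ; (there b∈) → b , lift t∈ (J⊆ b∈) (there b∈) t≈b })
          (¬b ∘ spread⇐ split (proj₁ ∘ unlift t≉w) (proj₂ ∘ unlift t≉w))
          (spread-rename split z
            (λ { (inj₁ (nbr (here eq) _)) → inj₁ eq ; (inj₁ (nbr (there x∈) _)) → inj₂ (J⊆ x∈)
               ; (inj₂ (nbr (here eq) _)) → inj₁ eq ; (inj₂ (nbr (there x∈) _)) → inj₂ (J⊆ x∈) })
            (λ _ → inj₁ (nbr z∈ (s≈w⇒ s≈w)))
            (λ x∈ → Sum.map (λ (nbr x∈′ e) → lift s∈ x∈ x∈′ e) (λ (nbr x∈′ e) → lift t∈ x∈ x∈′ e))
            z∉ z⇒ sp)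
      }
    } , prep′)
    where
    open Site A
    C = v ∷ u ∷ J
    prep′ : C ++ Q ↭ u ∷ v ∷ xs
    prep′ = swap v u perm
    lift : ∀ {q x} → q ∈ Q → x ∈ xs → x ∈ w ∷ J → q ≈ x → Nbr G q C x
    lift q∈ x∈ (here refl) e = contradiction x∈ w∉
    lift q∈ x∈ (there x∈′) e = nbr (there (there x∈′)) (to (Q⊆ q∈) x∈ e)
    unlift : ¬ t ≈ w → ∀ {x} → Nbr G t C x → x ∈ xs × Nbr H t (w ∷ J) x
    unlift t≉w (nbr (here refl) e) = contradiction (≈-sym (v⇒ (Q⊆ t∈) (~-sym e))) t≉w
    unlift t≉w (nbr (there (here refl)) e) = contradiction (≈-sym (u⇒ (Q⊆ t∈) (~-sym e))) t≉w
    unlift t≉w (nbr (there (there x∈)) e) = J⊆ x∈ , nbr (there x∈) (from (Q⊆ t∈) (J⊆ x∈) e)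
    -- One of `u` and `v` inherits the adjacency of `w` to `s`, and it stands in for `w` in the sets
    -- that have to stay spread.
    chosen : ∃[ z ] z ∈ C × z ∉ xs × (s ≈ w → s ~ z) × (∀ {x} → x ∈ xs → z ~ x → w ≈ x)
    chosen with u ~? s
    ... | yes u~s = u , there (here refl) , u∉ , (λ _ → ~-sym u~s) , u⇒
    ... | no u≁s  = v , here refl , v∉ ,
      (λ e → [ (λ u~s → contradiction u~s u≁s) , ~-sym ]′ (w⇒ (Q⊆ s∈) (≈-sym e))) , v⇒

  on-cycle : ∀ {J Q l r s t} → Site w u v xs J Q l r s t → Extra G u v xs → Extra G v u xs → Outcome G u v xs
  on-cycle {w} {u} {v} {xs} {J} {Q} {l} {r} {s} {t} A extraᵛ extraᵘ =
    case (u ~? l) , (u ~? r) , (v ~? l) , (v ~? r) of λ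
      { (yes u~l , yes u~r , _ , _) → whole A extraᵛ extraᵘ u~l u~r
      ; (_ , _ , yes v~l , yes v~r) → flip-Outcome (whole (flip-Site A) extraᵘ extraᵛ v~l v~r)
      ; (yes u~l , no u≁r , no v≁l , yes v~r) → shared-end A u~l u≁r v~r v≁l
      ; (no u≁l , yes u~r , yes v~l , no v≁r) →
          flip-Outcome (shared-end (flip-Site A) v~l v≁r u~r u≁l)
      ; (no u≁l , _ , no v≁l , _) → contradiction (w⇒ (J⊆ l∈) w~l) [ u≁l , v≁l ]′
      ; (_ , no u≁r , _ , no v≁r) → contradiction (w⇒ (J⊆ r∈) w~r) [ u≁r , v≁r ]′
      }
    where
    open Site A
    l∈ = First⇒∈ (H.Path.start path)
    r∈ = Last⇒∈ (H.Path.end path)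
    whole : ∀ {u v} → Site w u v xs J Q l r s t → Extra G u v xs → Extra G v u xs → u ~ l → u ~ r →
            Outcome G u v xs
    whole {u} {v} A (a , a∈ , v~a , u≁a) (b , b∈ , u~b , v≁b) u~l u~r =
      whole-end A u~l u~r (proj₁ at-s) (proj₂ at-s) (rest (∈-++⁻ J (↭.∈-resp-↭ (↭-sym perm) b∈)))
      where
      open Site A using () renaming (v⇒ to v⇒′; u⇒ to u⇒′)
      -- The private neighbour of `v` cannot be `l` or `r`, which `u` sees, and the only other
      -- neighbour that `w` can have is `s`.
      at-s : v ~ s × ¬ u ~ s
      at-s with ∈-++⁻ J (↭.∈-resp-↭ (↭-sym perm) a∈)
      ... | inj₁ a∈J with w~⇒ a∈J (v⇒′ a∈ v~a)
      ...   | inj₁ refl = contradiction u~l u≁a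
      ...   | inj₂ refl = contradiction u~r u≁a
      at-s | inj₂ a∈Q with w≈Q a∈Q (v⇒′ a∈ v~a)
      ... | refl = v~a , u≁a
      -- As `u` misses `s`, its private neighbour is `l` or `r`. This leaves `v` only the other one
      -- of these two on `J`.
      rest : b ∈ J ⊎ b ∈ Q → ∃[ c ] u ~ c × (∀ {x} → x ∈ J → v ~ x → x ≡ c)
      rest (inj₂ b∈Q) with w≈Q b∈Q (u⇒′ b∈ u~b)
      ... | refl = contradiction u~b (proj₂ at-s)
      rest (inj₁ b∈J) with w~⇒ b∈J (u⇒′ b∈ u~b)
      ... | inj₁ refl = r , u~r , λ x∈ e →
        [ (λ { refl → contradiction e v≁b }) , id ]′ (w~⇒ x∈ (v⇒′ (J⊆ x∈) e))
      ... | inj₂ refl = l , u~l , λ x∈ e →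
        [ id , (λ { refl → contradiction e v≁b }) ]′ (w~⇒ x∈ (v⇒′ (J⊆ x∈) e))

-- The contracted vertex on the path of an ear

module _ {N : ℕ} {G : Graph N} where

  open Graph G using (_~_; ~-sym; ~-irrefl)
  open Induced G

  Path-tail : ∀ {s t x y q} → Path s t (x ∷ y ∷ q) →
              s ≡ x × s ~ y × Path y t (y ∷ q) × (∀ {z} → z ∈ y ∷ q → s ~ z → z ≡ y)
  Path-tail {s} {t} {x} {y} {q} P with Path-split {p = x ∷ []} {q = y ∷ q} first first P
  ... | sp with Path.start left | Path.end left | Path.start right
    where open Split sp
  ... | first | last | first = refl , Split.mid~ sp , Split.right sp ,
                               λ z∈ e → proj₂ (Split.cross sp (here refl) z∈ e)

  Path-edge : ∀ {l r p} → Path l r p → l ~ r → p ≡ l ∷ r ∷ []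
  Path-edge {l} {r} P l~r with Path.start P | Path.end P
  ... | first | last = contradiction l~r ~-irrefl
  ... | first {p = p} | there end
      with Adj-head⁻ (Unique-head (Path.unique P)) (Path.~⇒adj P (here refl) (there (Last⇒∈ end)) l~r)
  ...   | first with end
  ...     | last     = refl
  ...     | there m = contradiction (Last⇒∈ m) (Unique-head (Unique-tail (Path.unique P)))
    where
    Unique-tail : ∀ {x : Fin N} {q} → Unique (x ∷ q) → Unique q
    Unique-tail (_ ∷ u) = u

  -- Seen from `a`, the rest of the cycle is an induced path with ends `b` and `c`; as these are
  -- adjacent, it has no further vertices.
  triangle-↭ : ∀ {C a b c} → Cyc C → a ∈ C → b ∈ C → c ∈ C → a ~ b → a ~ c → b ~ c →
               C ↭ a ∷ b ∷ c ∷ []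
  triangle-↭ {C} {a} {b} {c} cyc a∈ b∈ c∈ a~b a~c b~c with hoopAt cyc a∈
  ... | J , l , r , C↭ , H = ↭-trans C↭ (prep a (case w~⇒ (inJ b∈ a~b) a~b , w~⇒ (inJ c∈ a~c) a~c of λ
      { (inj₁ refl , inj₁ refl) → contradiction b~c ~-irrefl
      ; (inj₂ refl , inj₂ refl) → contradiction b~c ~-irrefl
      ; (inj₁ refl , inj₂ refl) → ↭-reflexive (Path-edge path b~c)
      ; (inj₂ refl , inj₁ refl) → ↭-trans (↭-reflexive (Path-edge path (~-sym b~c))) (swap c b ↭-refl)
      }))
    where
    open Hoop H
    inJ : ∀ {x} → x ∈ C → a ~ x → x ∈ J
    inJ x∈C a~x with ↭.∈-resp-↭ C↭ x∈C
    ... | here refl = contradiction refl (~⇒≢ a~x)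
    ... | there x∈J = x∈J

module _ {N : ℕ} {H G : Graph N} where

  open Graph H using () renaming (_~_ to _≈_; ~-sym to ≈-sym)
  open Graph G using (_~_; _~?_; ~-sym; ~-irrefl)
  private
    module H = Induced H
  open Induced G

  private
    variable
      w u v : Fin N
      xs : Walk N

  -- The contracted vertex w is the first vertex of the path of an ear.
  record Head (w u v : Fin N) (xs C : Walk N) (y : Fin N) (Q : Walk N) (t : Fin N) : Set where
    field
      split : Splitting H G w u v xs
      ear   : Ear H C (w ∷ y ∷ Q) w t
      perm  : C ++ w ∷ y ∷ Q ↭ w ∷ xs
    open Splitting split public
    open Ear ear public
    perm′ : C ++ y ∷ Q ↭ xs
    perm′ = ↭.drop-mid C [] perm
    C⊆ : ∀ {x} → x ∈ C → x ∈ xs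
    C⊆ = ↭.∈-resp-↭ perm′ ∘ ∈-++⁺ˡ
    Q⊆ : ∀ {x} → x ∈ y ∷ Q → x ∈ xs
    Q⊆ = ↭.∈-resp-↭ perm′ ∘ ∈-++⁺ʳ C
    tail : w ≈ y × H.Path y t (y ∷ Q) × (∀ {z} → z ∈ y ∷ Q → w ≈ z → z ≡ y)
    tail = proj₂ (Path-tail path)
    pathQ : Path y t (y ∷ Q)
    pathQ = path⇒ split Q⊆ (proj₁ (proj₂ tail))
    t∈ : t ∈ y ∷ Q
    t∈ = Last⇒∈ (Path.end pathQ)
    y∈ : y ∈ xs
    y∈ = Q⊆ (here refl)
    innerᵗ : ∀ {q c} → q ∈ y ∷ Q → c ∈ C → q ~ c → q ≡ t
    innerᵗ q∈ c∈ e with inner (there q∈) c∈ (from (Q⊆ q∈) (C⊆ c∈) e)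
    ... | inj₁ refl = contradiction (Q⊆ q∈) w∉
    ... | inj₂ q≡t  = q≡t
    w≢t : w ≢ t
    w≢t refl = w∉ (Q⊆ t∈)
    ¬A : ¬ Spread H (Nbr H w C)
    ¬A with ends
    ... | single w≡t _         = contradiction w≡t w≢t
    ... | double _ _ ¬a _ _ _ = ¬a
    ∃B : ∃ (Nbr G t C)
    ∃B with ends
    ... | single w≡t _ = contradiction w≡t w≢t
    ... | double _ _ _ (b , nbr b∈ e) _ _ = b , nbr b∈ (to (Q⊆ t∈) (C⊆ b∈) e)
    ¬B : ¬ Spread G (Nbr G t C)
    ¬B with ends
    ... | single w≡t _         = contradiction w≡t w≢t
    ... | double _ _ _ _ ¬b _ =
      ¬b ∘ spread⇐ split (C⊆ ∘ Nbr.∈C) λ (nbr x∈ e) → nbr x∈ (from (Q⊆ t∈) (C⊆ x∈) e)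
    A∪B : Spread H (λ x → Nbr H w C x ⊎ Nbr H t C x)
    A∪B with ends
    ... | single w≡t _         = contradiction w≡t w≢t
    ... | double _ _ _ _ _ sp = sp
    inA : ∀ {x} → Nbr G u C x → Nbr H w C x
    inA (nbr x∈ e) = nbr x∈ (u⇒ (C⊆ x∈) e)
    inA′ : ∀ {x} → Nbr G v C x → Nbr H w C x
    inA′ (nbr x∈ e) = nbr x∈ (v⇒ (C⊆ x∈) e)
    outA : ∀ {x} → Nbr H w C x → Nbr G u C x ⊎ Nbr G v C x
    outA (nbr x∈ e) = Sum.map (nbr x∈) (nbr x∈) (w⇒ (C⊆ x∈) e)
    outB : ∀ {x} → Nbr H t C x → Nbr G t C x
    outB (nbr x∈ e) = nbr x∈ (to (Q⊆ t∈) (C⊆ x∈) e)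
    locate : ∀ {x} → x ∈ xs → w ≈ x → x ≢ y → x ∈ C
    locate x∈ e x≢y with ∈-++⁻ C (↭.∈-resp-↭ (↭-sym perm′) x∈)
    ... | inj₁ x∈C = x∈C
    ... | inj₂ x∈Q = contradiction (proj₂ (proj₂ tail) x∈Q e) x≢y
    -- The neighbours of `w` on `C` lie within the edge `aa′`. Were those of `t` in it too, the
    -- union would not be spread.
    third : ∀ {a a′} → Nbr H w C a → Nbr H w C a′ → a ≢ a′ → ∃[ b ] Nbr G t C b × b ≢ a × b ≢ a′
    third {a} {a′} na na′ a≢a′
      with any? (λ b → nbr? G t C b ×-dec ¬? (b ≟ a) ×-dec ¬? (b ≟ a′))
    ... | yes found = found
    ... | no none = contradiction A∪B $ pair⇒¬spread H (¬spread⇒~ H ¬A na na′ a≢a′)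
      [ ¬spread⇒pair H ¬A na na′ a≢a′ , onlyB ]′
      where
      onlyB : ∀ {z} → Nbr H t C z → z ≡ a ⊎ z ≡ a′
      onlyB {z} nz with z ≟ a | z ≟ a′
      ... | yes z≡a | _        = inj₁ z≡a
      ... | no _    | yes z≡a′ = inj₂ z≡a′
      ... | no z≢a  | no z≢a′  = contradiction (z , outB nz , z≢a , z≢a′) none
    cycᴳ : Cyc C
    cycᴳ = cyc⇒ split C⊆ cyc
    pathᵘ : u ~ y → Path u t (u ∷ y ∷ Q)
    pathᵘ u~y = Path-∷ pathQ u~y (u∉ ∘ Q⊆) λ z∈ e → proj₂ (proj₂ tail) z∈ (u⇒ (Q⊆ z∈) e)
    apartᵘ : Apart (u ∷ y ∷ Q) C
    apartᵘ (here refl , c∈) = u∉ (C⊆ c∈)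
    apartᵘ (there q∈ , c∈)  = apart (there q∈ , c∈)

  flip-Head : ∀ {C y Q t} → Head w u v xs C y Q t → Head w v u xs C y Q t
  flip-Head A = record { split = flip-Splitting split ; ear = ear ; perm = perm }
    where open Head A

  -- `v` is dropped and `u` replaces `w`. Since `u` may have fewer neighbours than `w`, the spread
  -- of the union has to be assumed; its failure is what forces the rerouting in the next two
  -- lemmas.
  shrink : ∀ {C y Q t} → Head w u v xs C y Q t → u ~ y → ∃ (Nbr G u C) →
           Spread G (λ x → Nbr G u C x ⊎ Nbr G t C x) → Outcome G u v xs
  shrink {w} {u} {v} {xs} {C} {y} {Q} {t} A u~y a sp = inj₂ (inj₁ (C , u ∷ y ∷ Q , u , t , record
    { cyc = cycᴳ
    ; path = pathᵘ u~y
    ; apart = apartᵘ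
    ; inner = λ { (here refl) _ _ → inj₁ refl ; (there q∈) c∈ e → inj₂ (innerᵗ q∈ c∈ e) }
    ; ends = double (λ { refl → u∉ (Q⊆ t∈) }) a (¬A ∘ spread⇐ split (C⊆ ∘ Nbr.∈C) inA) ∃B ¬B sp
    } , replace-↭ C (u ∷ []) perm))
    where open Head A

  -- As `v` misses `y`, its private neighbour `a′` lies on the cycle. If `u` has no neighbour there,
  -- the path is prolonged by `v`. Otherwise, if dropping `v` fails, `u` has a single neighbour `a`
  -- on the cycle, and `a` lies between `a′` and a neighbour `b` of `t`. The cycle is rerouted from
  -- `a′` through `v`, `u` and the old path to `b`, with `a` as the hub.
  head-one : ∀ {C y Q t} → Head w u v xs C y Q t → u ~ y → ¬ v ~ y → Extra G u v xs →
             Outcome G u v xs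
  head-one {w} {u} {v} {xs} {C} {y} {Q} {t} A u~y v≁y (a′ , a′∈ , v~a′ , u≁a′) =
    case any? (nbr? G u C) of λ
      { (no none) → inj₁ (C , v ∷ u ∷ y ∷ Q , v , t , record
          { cyc = cycᴳ ; path = pathᵛ ; apart = apartᵛ
          ; inner = λ { (here refl) _ _ → inj₁ refl
                      ; (there (here refl)) c∈ e → contradiction (_ , nbr c∈ e) none
                      ; (there (there q∈)) c∈ e → inj₂ (innerᵗ q∈ c∈ e) }
          ; ends = double (λ { refl → v∉ (Q⊆ t∈) }) (a′ , na′)
              (¬A ∘ spread⇐ split (C⊆ ∘ Nbr.∈C) inA′) ∃B ¬B
              (spread⇒ split [ C⊆ ∘ Nbr.∈C , C⊆ ∘ Nbr.∈C ]′
                (Sum.map (λ n → [ (λ n′ → contradiction (_ , n′) none) , id ]′ (outA n)) outB) A∪B)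
          } , permᵛ)
      ; (yes (a , na)) →
          case spread? G (λ x → nbr? G u C x ⊎-dec nbr? G t C x) of λ
            { (yes sp) → shrink A u~y (a , na) sp
            ; (no ¬sp) → inj₁ (EarOn-↭ permᵛ (wheel na ¬sp)) }
      }
    where
    open Head A
    na′ : Nbr G v C a′
    na′ = nbr (locate a′∈ (v⇒ a′∈ v~a′) (λ { refl → v≁y v~a′ })) v~a′
    pathᵛ : Path v t (v ∷ u ∷ y ∷ Q)
    pathᵛ = Path-∷ (pathᵘ u~y) (~-sym u~v)
      (λ { (here refl) → ~-irrefl u~v ; (there v∈) → v∉ (Q⊆ v∈) })
      (λ { (here eq) _ → eq
         ; (there z∈) e → case proj₂ (proj₂ tail) z∈ (v⇒ (Q⊆ z∈) e) of λ { refl → contradiction e v≁y } })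
    apartᵛ : Apart (v ∷ u ∷ y ∷ Q) C
    apartᵛ (here refl , c∈) = v∉ (C⊆ c∈)
    apartᵛ (there q∈ , c∈)  = apartᵘ (q∈ , c∈)
    permᵛ : C ++ v ∷ u ∷ y ∷ Q ↭ u ∷ v ∷ xs
    permᵛ = ↭-trans (replace-↭ C (v ∷ u ∷ []) perm) (swap v u ↭-refl)
    wheel : ∀ {a} → Nbr G u C a → ¬ Spread G (λ x → Nbr G u C x ⊎ Nbr G t C x) →
            EarOn G (C ++ v ∷ u ∷ y ∷ Q)
    wheel {a} na@(nbr a∈C u~a) ¬sp =
      let a≢a′ = λ { refl → u≁a′ u~a }
          b , nb@(nbr b∈C t~b) , b≢a , b≢a′ = third (inA na) (inA′ na′) a≢a′
          a~a′ = to (C⊆ a∈C) (C⊆ (Nbr.∈C na′)) (¬spread⇒~ H ¬A (inA na) (inA′ na′) a≢a′)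
          a~b  = ¬spread⇒~ G ¬sp (inj₁ na) (inj₂ nb) (b≢a ∘ sym)
          onlyA : ∀ {z} → Nbr H w C z → z ≢ a → z ≡ a′
          onlyA n z≢a = [ (λ z≡a → contradiction z≡a z≢a) , id ]′
                          (¬spread⇒pair H ¬A (inA na) (inA′ na′) a≢a′ n)
      in (λ (C′ , E , p) → C′ , a ∷ [] , a , a , E , p) $
        bypass cycᴳ a∈C (Nbr.∈C na′) b∈C a~a′ a~b (b≢a′ ∘ sym) pathᵛ apartᵛ v~a′ t~b
        -- Apart from `a`, the cycle is met by `v` only in `a′`, by `t` only in `b`, and by `u` not
        -- at all.
        (λ { (here refl) z∈ z≢a e → inj₁ (refl , onlyA (inA′ (nbr z∈ e)) z≢a)
           ; (there (here refl)) z∈ z≢a e → case onlyA (inA (nbr z∈ e)) z≢a of λ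
               { refl → contradiction e u≁a′ }
           ; (there (there q∈)) z∈ z≢a e → case innerᵗ q∈ z∈ e of λ
               { refl → inj₂ (refl ,
                   [ (λ z≡a → contradiction z≡a z≢a) , id ]′
                     (¬spread⇒pair G ¬sp (inj₁ na) (inj₂ nb) (b≢a ∘ sym) (inj₂ (nbr z∈ e)))) } })
        (u , there (here refl) , ~-sym u~a)

  head-both : ∀ {C y Q t} → Head w u v xs C y Q t → u ~ y → v ~ y → Extra G u v xs →
              Extra G v u xs → Outcome G u v xs
  head-both {w} {u} {v} {xs} {C} {y} {Q} {t} A u~y v~y (a′ , a′∈ , v~a′ , u≁a′) (a , a∈ , u~a , v≁a) =
    case spread? G (λ x → nbr? G u C x ⊎-dec nbr? G t C x) ,′
         spread? G (λ x → nbr? G v C x ⊎-dec nbr? G t C x) of λ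
      { (yes sp , _) → shrink A u~y (a , na) sp
      ; (_ , yes sp) → flip-Outcome (shrink (flip-Head A) v~y (a′ , na′) sp)
      ; (no ¬spᵘ , no ¬spᵛ) →
          let b , nb , b≢a , b≢a′ = third (inA na) (inA′ na′) a≢a′ in
          inj₁ (prism ¬spᵘ ¬spᵛ nb b≢a b≢a′)
      }
    where
    open Head A
    na′ : Nbr G v C a′
    na′ = nbr (locate a′∈ (v⇒ a′∈ v~a′) (λ { refl → u≁a′ u~y })) v~a′
    na : Nbr G u C a
    na = nbr (locate a∈ (u⇒ a∈ u~a) (λ { refl → v≁a v~y })) u~a
    a≢a′ : a ≢ a′
    a≢a′ refl = u≁a′ u~a
    prism : ¬ Spread G (λ x → Nbr G u C x ⊎ Nbr G t C x) →
            ¬ Spread G (λ x → Nbr G v C x ⊎ Nbr G t C x) →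
            ∀ {b} → Nbr G t C b → b ≢ a → b ≢ a′ → EarOn G (u ∷ v ∷ xs)
    prism ¬spᵘ ¬spᵛ {b} nb@(nbr b∈C t~b) b≢a b≢a′ =
      let a∈C = Nbr.∈C na ; a′∈C = Nbr.∈C na′
          a~a′ = to (C⊆ a∈C) (C⊆ a′∈C) (¬spread⇒~ H ¬A (inA na) (inA′ na′) a≢a′)
          a~b  = ¬spread⇒~ G ¬spᵘ (inj₁ na) (inj₂ nb) (b≢a ∘ sym)
          a′~b = ¬spread⇒~ G ¬spᵛ (inj₁ na′) (inj₂ nb) (b≢a′ ∘ sym)
          b∉A : ¬ Nbr H w C b
          b∉A n = [ b≢a , b≢a′ ]′ (¬spread⇒pair H ¬A (inA na) (inA′ na′) a≢a′ n)
          Q≁a : ∀ {q} → q ∈ y ∷ Q → ¬ q ~ a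
          Q≁a q∈ e = case innerᵗ q∈ a∈C e of λ { refl →
            [ a≢a′ , b≢a ∘ sym ]′
              (¬spread⇒pair G ¬spᵛ (inj₁ na′) (inj₂ nb) (b≢a′ ∘ sym) (inj₂ (nbr a∈C e))) }
          Q≁a′ : ∀ {q} → q ∈ y ∷ Q → ¬ q ~ a′
          Q≁a′ q∈ e = case innerᵗ q∈ a′∈C e of λ { refl →
            [ a≢a′ ∘ sym , b≢a′ ∘ sym ]′
              (¬spread⇒pair G ¬spᵘ (inj₁ na) (inj₂ nb) (b≢a ∘ sym) (inj₂ (nbr a′∈C e))) }
          b∉Q : b ∉ y ∷ Q
          b∉Q b∈ = apart (there b∈ , b∈C)
          C↭ = triangle-↭ cycᴳ a∈C a′∈C b∈C a~a′ a~b a′~b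
      -- The prism is read as an ear from its other side: the quadrangle `u a a′ v` becomes the
      -- cycle, and the old path, prolonged by `b`, joins the edge `uv` to the edge `aa′`.
      in u ∷ a ∷ a′ ∷ v ∷ [] , (y ∷ Q) ∷ʳ b , y , b , record
        { cyc = hoop⇒cyc record
            { path = Path-∷ (Path-∷ Path-[] (~-sym v~a′)
                (λ { (here refl) → v∉ a′∈ }) (λ { (here eq) _ → eq }))
                a~a′
                (λ { (here eq) → a≢a′ eq ; (there (here refl)) → v∉ a∈ })
                (λ { (here eq) _ → eq ; (there (here refl)) e → contradiction (~-sym e) v≁a })
            ; w∉p = λ { (here refl) → u∉ a∈ ; (there (here refl)) → u∉ a′∈
                      ; (there (there (here refl))) → ~-irrefl u~v }
            ; l≢r = λ { refl → v∉ a∈ }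
            ; w~l = u~a
            ; w~r = u~v
            ; w~⇒ = λ { (here eq) _ → inj₁ eq ; (there (here refl)) e → contradiction e u≁a′
                      ; (there (there (here eq))) _ → inj₂ eq }
            }
        ; path = Path-∷ʳ pathQ t~b b∉Q (λ x∈ e → innerᵗ x∈ b∈C e)
        ; apart = λ (x∈ , y∈) → case ∈-++⁻ (y ∷ Q) x∈ , y∈ of λ
            { (inj₁ x∈ , here refl) → u∉ (Q⊆ x∈)
            ; (inj₁ x∈ , there (here refl)) → apart (there x∈ , a∈C)
            ; (inj₁ x∈ , there (there (here refl))) → apart (there x∈ , a′∈C)
            ; (inj₁ x∈ , there (there (there (here refl)))) → v∉ (Q⊆ x∈)
            ; (inj₂ (here refl) , here refl) → u∉ (C⊆ b∈C)
            ; (inj₂ (here refl) , there (here eq)) → b≢a eq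
            ; (inj₂ (here refl) , there (there (here eq))) → b≢a′ eq
            ; (inj₂ (here refl) , there (there (there (here refl)))) → v∉ (C⊆ b∈C) }
        ; inner = λ x∈ y∈ e → case ∈-++⁻ (y ∷ Q) x∈ , y∈ of λ
            { (inj₂ (here eq) , _) → inj₂ eq
            ; (inj₁ x∈ , here refl) → inj₁ (proj₂ (proj₂ tail) x∈ (u⇒ (Q⊆ x∈) (~-sym e)))
            ; (inj₁ x∈ , there (here refl)) → contradiction e (Q≁a x∈)
            ; (inj₁ x∈ , there (there (here refl))) → contradiction e (Q≁a′ x∈)
            ; (inj₁ x∈ , there (there (there (here refl)))) →
                inj₁ (proj₂ (proj₂ tail) x∈ (v⇒ (Q⊆ x∈) (~-sym e))) }
        ; ends = double (λ { refl → b∉Q (here refl) })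
            (u , nbr (here refl) (~-sym u~y))
            (pair⇒¬spread G u~v λ
              { (nbr (here eq) _) → inj₁ eq
              ; (nbr (there (here refl)) e) → contradiction e (Q≁a (here refl))
              ; (nbr (there (there (here refl))) e) → contradiction e (Q≁a′ (here refl))
              ; (nbr (there (there (there (here eq)))) _) → inj₂ eq })
            (a , nbr (there (here refl)) (~-sym a~b))
            (pair⇒¬spread G a~a′ λ
              { (nbr (here refl) e) → contradiction (inA (nbr b∈C (~-sym e))) b∉A
              ; (nbr (there (here eq)) _) → inj₁ eq
              ; (nbr (there (there (here eq))) _) → inj₂ eq
              ; (nbr (there (there (there (here refl)))) e) →
                  contradiction (inA′ (nbr b∈C (~-sym e))) b∉A })
            (three (inj₁ (nbr (here refl) (~-sym u~y)))
              (inj₁ (nbr (there (there (there (here refl)))) (~-sym v~y)))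
              (inj₂ (nbr (there (here refl)) (~-sym a~b)))
              (~⇒≢ u~v) (λ { refl → u∉ a∈ }) (λ { refl → v∉ a∈ }))
        } ,
        prep u (↭-trans (↭.shift v (a ∷ a′ ∷ []) ((y ∷ Q) ∷ʳ b))
          (prep v (↭-trans (prep a (prep a′ (↭-sym (↭.∷↭∷ʳ b (y ∷ Q)))))
            (↭-trans (↭.++⁺ʳ (y ∷ Q) (↭-sym C↭)) perm′))))

  head-case : ∀ {C y Q t} → Head w u v xs C y Q t → Extra G u v xs →
              Extra G v u xs → Outcome G u v xs
  head-case {w} {u} {v} {xs} {y = y} A extraᵛ extraᵘ = case (u ~? y) , (v ~? y) of λ
    { (yes u~y , yes v~y) → head-both A u~y v~y extraᵛ extraᵘ
    ; (yes u~y , no v≁y)  → head-one A u~y v≁y extraᵛ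
    ; (no u≁y , yes v~y)  → flip-Outcome (head-one (flip-Head A) v~y u≁y extraᵘ)
    ; (no u≁y , no v≁y)   → contradiction (w⇒ y∈ (proj₁ tail)) [ u≁y , v≁y ]′
    }
    where open Head A

  module _ (S : Splitting H G w u v xs) where
    open Splitting S

    -- Unless `u` or `v` alone has a spread neighbourhood, the hub opens up into the path `uv`.
    -- Neither end is then without neighbours on the cycle, for the other one would have all those
    -- of `w`, which are spread.
    centre-case : ∀ {C s t} → Ear H C (w ∷ []) s t → C ++ w ∷ [] ↭ w ∷ xs → Outcome G u v xs
    centre-case {C} {s} {t} E perm with Ear.path E
    ... | π with H.Path.start π | H.Path.end π
    ... | first | last = case spread? G (nbr? G u C) ,′ spread? G (nbr? G v C) of λ
        { (yes sp , _) → inj₂ (inj₁ (alone u u∉ sp))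
        ; (_ , yes sp) → inj₂ (inj₂ (alone v v∉ sp))
        ; (no ¬u , no ¬v) → inj₁ (C , u ∷ v ∷ [] , u , v , record
            { cyc = cycᴳ
            ; path = Path-∷ Path-[] u~v (λ { (here refl) → ~-irrefl u~v }) (λ { (here eq) _ → eq })
            ; apart = λ { (here refl , y∈) → u∉ (C⊆ y∈) ; (there (here refl) , y∈) → v∉ (C⊆ y∈) }
            ; inner = λ { (here eq) _ _ → inj₁ eq ; (there (here eq)) _ _ → inj₂ eq }
            ; ends = double (~⇒≢ u~v)
                (some (nbr? G u C) λ none →
                  ¬v ∘ via (λ { (inj₁ n) → contradiction (_ , n) none ; (inj₂ n) → n }))
                ¬u
                (some (nbr? G v C) λ none →
                  ¬u ∘ via (λ { (inj₂ n) → contradiction (_ , n) none ; (inj₁ n) → n }))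
                ¬v (via id spᴴ)
            } , replace-↭ C (u ∷ v ∷ []) perm)
        }
      where
      open Ear E
      perm′ : C ++ [] ↭ xs
      perm′ = ↭.drop-mid C [] perm
      C⊆ : ∀ {x} → x ∈ C → x ∈ xs
      C⊆ = ↭.∈-resp-↭ perm′ ∘ ∈-++⁺ˡ
      cycᴳ : Cyc C
      cycᴳ = cyc⇒ S C⊆ cyc
      spᴴ : Spread H (Nbr H w C)
      spᴴ with ends
      ... | single _ sp = sp
      ... | double w≢w _ _ _ _ _ = contradiction refl w≢w
      via : ∀ {P} → (∀ {x} → Nbr G u C x ⊎ Nbr G v C x → P x) → Spread H (Nbr H w C) → Spread G P
      via f = spread⇒ S (C⊆ ∘ Nbr.∈C)
        λ (nbr x∈ e) → f (Sum.map (nbr x∈) (nbr x∈) (w⇒ (C⊆ x∈) e))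
      some : ∀ {P : Fin N → Set} → Decidable P → (¬ ∃ P → ¬ Spread H (Nbr H w C)) → ∃ P
      some P? k with any? P?
      ... | yes p = p
      ... | no ¬p = contradiction spᴴ (k ¬p)
      alone : ∀ z → z ∉ xs → Spread G (Nbr G z C) → EarOn G (z ∷ xs)
      alone z z∉ sp = C , z ∷ [] , z , z , record
        { cyc = cycᴳ ; path = Path-[]
        ; apart = λ { (here refl , y∈) → z∉ (C⊆ y∈) }
        ; inner = λ { (here eq) _ _ → inj₁ eq }
        ; ends = single refl sp
        } , replace-↭ C (z ∷ []) perm

    ends⇒ : ∀ {C s t} → s ∈ xs → t ∈ xs → (∀ {x} → x ∈ C → x ∈ xs) →
            Ends H s t (Nbr H s C) (Nbr H t C) → Ends G s t (Nbr G s C) (Nbr G t C)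
    ends⇒ {C} {s} {t} s∈ t∈ C⊆ = λ
      { (single s≡t sp) → single s≡t (spread⇒ S (C⊆ ∘ Nbr.∈C) (up s∈) sp)
      ; (double s≢t (_ , a) ¬a (_ , b) ¬b sp) → double s≢t
          (_ , up s∈ a) (¬a ∘ spread⇐ S (C⊆ ∘ Nbr.∈C) (down s∈))
          (_ , up t∈ b) (¬b ∘ spread⇐ S (C⊆ ∘ Nbr.∈C) (down t∈))
          (spread⇒ S [ C⊆ ∘ Nbr.∈C , C⊆ ∘ Nbr.∈C ]′ (Sum.map (up s∈) (up t∈)) sp)
      }
      where
      up : ∀ {s x} → s ∈ xs → Nbr H s C x → Nbr G s C x
      up s∈ (nbr x∈ e) = nbr x∈ (to s∈ (C⊆ x∈) e)
      down : ∀ {s x} → s ∈ xs → Nbr G s C x → Nbr H s C x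
      down s∈ (nbr x∈ e) = nbr x∈ (from s∈ (C⊆ x∈) e)

  -- An interior vertex `w` of the path has only the neighbours `e` and `f`. If `u` and `v` inherit
  -- one each, splitting `w` merely lengthens the path and leaves its ends untouched.
  subdivide : ∀ {C Q₁ Q₂ s t e f} → Splitting H G w u v xs → H.Path s e Q₁ → H.Path f t Q₂ →
              Apart Q₁ Q₂ → (∀ {x y} → x ∈ Q₁ → y ∈ Q₂ → ¬ x ≈ y) →
              (∀ {x} → x ∈ Q₁ → w ≈ x → x ≡ e) → (∀ {x} → x ∈ Q₂ → w ≈ x → x ≡ f) →
              H.Cyc C → Apart (Q₁ ++ Q₂) C → (∀ {c} → c ∈ C → ¬ w ≈ c) →
              (∀ {q c} → q ∈ Q₁ ++ Q₂ → c ∈ C → q ≈ c → q ≡ s ⊎ q ≡ t) →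
              Ends H s t (Nbr H s C) (Nbr H t C) → C ++ Q₁ ++ w ∷ Q₂ ↭ w ∷ xs →
              u ~ e → ¬ v ~ e → v ~ f → ¬ u ~ f → EarOn G (u ∷ v ∷ xs)
  subdivide {w} {u} {v} {xs} {C} {Q₁} {Q₂} {s} {t} {e} {f}
    S π₁ π₂ apart₁₂ ≉ only₁ only₂ cyc apartC w≉ inner ends perm u~e v≁e v~f u≁f =
    C , Q₁ ++ u ∷ v ∷ Q₂ , s , t , record
      { cyc = cyc⇒ S C⊆ cyc
      ; path = Path-++ (path⇒ S Q₁⊆ π₁)
          (Path-∷ (Path-∷ (path⇒ S Q₂⊆ π₂) v~f (v∉ ∘ Q₂⊆) (λ y∈ e → only₂ y∈ (v⇒ (Q₂⊆ y∈) e)))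
            u~v (λ { (here refl) → ~-irrefl u~v ; (there u∈) → u∉ (Q₂⊆ u∈) })
            (λ { (here eq) _ → eq
               ; (there y∈) e → case only₂ y∈ (u⇒ (Q₂⊆ y∈) e) of λ { refl → contradiction e u≁f } }))
          (~-sym u~e)
          (λ { (x∈ , here refl) → u∉ (Q₁⊆ x∈) ; (x∈ , there (here refl)) → v∉ (Q₁⊆ x∈)
             ; (x∈ , there (there y∈)) → apart₁₂ (x∈ , y∈) })
          (λ { x∈ (here refl) e → only₁ x∈ (u⇒ (Q₁⊆ x∈) (~-sym e)) , refl
             ; x∈ (there (here refl)) e → case only₁ x∈ (v⇒ (Q₁⊆ x∈) (~-sym e)) of λ
                 { refl → contradiction (~-sym e) v≁e }
             ; x∈ (there (there y∈)) e → contradiction (from (Q₁⊆ x∈) (Q₂⊆ y∈) e) (≉ x∈ y∈) })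
      ; apart = λ (x∈ , y∈) → case which x∈ of λ
          { (inj₁ refl) → u∉ (C⊆ y∈) ; (inj₂ (inj₁ refl)) → v∉ (C⊆ y∈)
          ; (inj₂ (inj₂ x∈)) → apartC (x∈ , y∈) }
      ; inner = λ x∈ y∈ e → case which x∈ of λ
          { (inj₁ refl) → contradiction (u⇒ (C⊆ y∈) e) (w≉ y∈)
          ; (inj₂ (inj₁ refl)) → contradiction (v⇒ (C⊆ y∈) e) (w≉ y∈)
          ; (inj₂ (inj₂ x∈)) → inner x∈ y∈ (from (Q⊆ x∈) (C⊆ y∈) e) }
      ; ends = ends⇒ S (Q₁⊆ (First⇒∈ (H.Path.start π₁))) (Q₂⊆ (Last⇒∈ (H.Path.end π₂))) C⊆ ends
      } , replace-↭₂ C Q₁ (u ∷ v ∷ []) perm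
    where
    open Splitting S
    perm′ : C ++ Q₁ ++ Q₂ ↭ xs
    perm′ = replace-↭₂ C Q₁ [] perm
    C⊆ : ∀ {x} → x ∈ C → x ∈ xs
    C⊆ = ↭.∈-resp-↭ perm′ ∘ ∈-++⁺ˡ
    Q⊆ : ∀ {x} → x ∈ Q₁ ++ Q₂ → x ∈ xs
    Q⊆ = ↭.∈-resp-↭ perm′ ∘ ∈-++⁺ʳ C
    Q₁⊆ : ∀ {x} → x ∈ Q₁ → x ∈ xs
    Q₁⊆ = Q⊆ ∘ ∈-++⁺ˡ
    Q₂⊆ : ∀ {x} → x ∈ Q₂ → x ∈ xs
    Q₂⊆ = Q⊆ ∘ ∈-++⁺ʳ Q₁
    which : ∀ {x} → x ∈ Q₁ ++ u ∷ v ∷ Q₂ → x ≡ u ⊎ x ≡ v ⊎ x ∈ Q₁ ++ Q₂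
    which x∈ with ∈-++⁻ Q₁ x∈
    ... | inj₁ x∈₁                = inj₂ (inj₂ (∈-++⁺ˡ x∈₁))
    ... | inj₂ (here eq)          = inj₁ eq
    ... | inj₂ (there (here eq))  = inj₂ (inj₁ eq)
    ... | inj₂ (there (there x∈₂)) = inj₂ (inj₂ (∈-++⁺ʳ Q₁ x∈₂))

extra? : ∀ {N} (G : Graph N) u v xs → Dec (Extra G u v xs)
extra? G u v xs = any? λ a → (a ∈? xs) ×-dec (v ~? a) ×-dec ¬? (u ~? a)
  where open Graph G using (_~?_)

module _ {N : ℕ} {H G : Graph N} {w u v : Fin N} {xs : Walk N} where

  open Graph H using () renaming (_~_ to _≈_; ~-sym to ≈-sym; ~-irrefl to ≈-irrefl)
  open Graph G using (_~_; _~?_; ~-sym; ~-irrefl)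
  private
    module H = Induced H

  -- Without a private neighbour of `v`, the vertices `u` and `w` have the same neighbours in `xs`,
  -- so renaming `w` to `u` is an isomorphism.
  absorb : Splitting H G w u v xs → ¬ Extra G u v xs → EarOn H (w ∷ xs) → EarOn G (u ∷ xs)
  absorb S none E = subst (EarOn G) map-f (EarOn-map emb E)
    where
    open Splitting S
    f = rename w u
    f-∈ : ∀ {x} → x ∈ xs → f x ≡ x
    f-∈ x∈ = rename-≢ λ { refl → w∉ x∈ }
    map-f : map f (w ∷ xs) ≡ u ∷ xs
    map-f rewrite rename-same w u =
      cong (u ∷_) (trans (List.map-cong-local (All.tabulate f-∈)) (List.map-id xs))
    w⇒u : ∀ {x} → x ∈ xs → w ≈ x → u ~ x
    w⇒u {x} x∈ e with u ~? x | w⇒ x∈ e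
    ... | yes u~x | _        = u~x
    ... | no _    | inj₁ u~x = u~x
    ... | no u≁x  | inj₂ v~x = contradiction (_ , x∈ , v~x , u≁x) none
    emb : Embedding f (w ∷ xs)
    emb = record
      { inj = λ
        { (here refl) (here refl) _ → refl
        ; (here refl) (there y∈) eq → contradiction
            (subst (_∈ xs) (trans (sym (f-∈ y∈)) (trans (sym eq) (rename-same w u))) y∈) u∉
        ; (there x∈) (here refl) eq → contradiction
            (subst (_∈ xs) (trans (sym (f-∈ x∈)) (trans eq (rename-same w u))) x∈) u∉
        ; (there x∈) (there y∈) eq → trans (sym (f-∈ x∈)) (trans eq (f-∈ y∈)) }
      ; to = λ
        { (here refl) (here refl) e → contradiction e ≈-irrefl
        ; (here refl) (there y∈) e → subst₂ _~_ (sym (rename-same w u)) (sym (f-∈ y∈)) (w⇒u y∈ e)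
        ; (there x∈) (here refl) e →
            subst₂ _~_ (sym (f-∈ x∈)) (sym (rename-same w u)) (~-sym (w⇒u x∈ (≈-sym e)))
        ; (there x∈) (there y∈) e → subst₂ _~_ (sym (f-∈ x∈)) (sym (f-∈ y∈)) (to x∈ y∈ e) }
      ; from = λ
        { (here refl) (here refl) e → contradiction e ~-irrefl
        ; (here refl) (there y∈) e → u⇒ y∈ (subst₂ _~_ (rename-same w u) (f-∈ y∈) e)
        ; (there x∈) (here refl) e →
            ≈-sym (u⇒ x∈ (~-sym (subst₂ _~_ (f-∈ x∈) (rename-same w u) e)))
        ; (there x∈) (there y∈) e → from x∈ y∈ (subst₂ _~_ (f-∈ x∈) (f-∈ y∈) e) }
      }

-- The positions of `w` for which the splitting is carried out. A decomposition is chosen, and if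
-- necessary its path reversed, after `w` is given, so that one of these positions is attained.
Placed : ∀ {N} (H : Graph N) → Fin N → (C Q : Walk N) → (s t : Fin N) → Set
Placed H w C Q s t = w ∈ Q ⊎ w ∈ C × (s ≡ t ⊎ (∀ {c} → c ∈ C → Graph._~_ H s c → c ≡ w))

module _ {N : ℕ} {H G : Graph N} {w u v : Fin N} {xs : Walk N} (S : Splitting H G w u v xs) where

  open Graph H using () renaming (_~_ to _≈_; ~-sym to ≈-sym; ~-irrefl to ≈-irrefl)
  open Graph G using (_~_; _~?_; ~-sym; ~-irrefl)
  private
    module H = Induced H
  open Splitting S

  cycle-case : ∀ {C Q s t} → Ear H C Q s t → C ++ Q ↭ w ∷ xs → w ∈ C →
               (s ≡ t ⊎ (∀ {c} → c ∈ C → s ≈ c → c ≡ w)) → Extra G u v xs → Extra G v u xs →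
               Outcome G u v xs
  cycle-case {C} {Q} E perm w∈C only with H.hoopAt (Ear.cyc E) w∈C
  ... | J , l , r , C↭ , hoop = on-cycle record
    { split = S
    ; hoop = hoop
    ; ear = record
      { cyc = H.hoop⇒cyc hoop ; path = path
      ; apart = λ (x∈ , y∈) → apart (x∈ , ⊆C y∈)
      ; inner = λ x∈ y∈ → inner x∈ (⊆C y∈)
      ; ends = moved ends }
    ; perm = ↭.drop-∷ (↭-trans (↭.++⁺ʳ Q (↭-sym C↭)) perm)
    ; only = Sum.map₂ (λ k c∈ → k (⊆C c∈)) only
    }
    where
    open Ear E
    ⊆C : ∀ {x} → x ∈ w ∷ J → x ∈ C
    ⊆C = ↭.∈-resp-↭ (↭-sym C↭)
    up : ∀ {s x} → Nbr H s C x → Nbr H s (w ∷ J) x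
    up (nbr x∈ e) = nbr (↭.∈-resp-↭ C↭ x∈) e
    down : ∀ {s x} → Nbr H s (w ∷ J) x → Nbr H s C x
    down (nbr x∈ e) = nbr (⊆C x∈) e
    moved : ∀ {s t} → Ends H s t (Nbr H s C) (Nbr H t C) → Ends H s t (Nbr H s (w ∷ J)) (Nbr H t (w ∷ J))
    moved (single s≡t sp) = single s≡t (Spread-mono up sp)
    moved (double s≢t (_ , a) ¬a (_ , b) ¬b sp) = double s≢t (_ , up a) (¬a ∘ Spread-mono down)
      (_ , up b) (¬b ∘ Spread-mono down) (Spread-mono (Sum.map up up) sp)

  -- `w` is not an end of the path, hence has no neighbours on the cycle. The private neighbours of
  -- `u` and `v` must therefore be the two neighbours of `w` along the path, one each.
  interior-case : ∀ {C z Q₁ y Q₂ s t} → Ear H C ((z ∷ Q₁) ++ w ∷ y ∷ Q₂) s t →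
                  C ++ (z ∷ Q₁) ++ w ∷ y ∷ Q₂ ↭ w ∷ xs → Extra G u v xs → Extra G v u xs →
                  Outcome G u v xs
  interior-case {C} {z} {Q₁} {y} {Q₂} {s} {t} E perm (a , a∈ , v~a , u≁a) (b , b∈ , u~b , v≁b) =
    inj₁ (case near a∈ (v⇒ a∈ v~a) ,′ near b∈ (u⇒ b∈ u~b) of λ
      { (inj₁ refl , inj₁ refl) → contradiction u~b u≁a
      ; (inj₂ refl , inj₂ refl) → contradiction u~b u≁a
      ; (inj₁ refl , inj₂ refl) → EarOn-↭ (swap _ _ ↭-refl)
          (subdivide (flip-Splitting S) left right₂ apart₁₂ ≉ only₁ only₂ cyc apartC w≉
            inner′ ends perm v~a u≁a u~b v≁b)
      ; (inj₂ refl , inj₁ refl) →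
          subdivide S left right₂ apart₁₂ ≉ only₁ only₂ cyc apartC w≉
            inner′ ends perm u~b v≁b v~a u≁a
      })
    where
    open Ear E
    Q′ = y ∷ Q₂
    sp = H.Path-split {p = z ∷ Q₁} {q = w ∷ Q′} first first path
    open H.Split sp renaming (mid₁ to e; apart to apartˢ)
    tail = Path-tail right
    right₂ = proj₁ (proj₂ (proj₂ tail))
    mid₂≡w : H.Split.mid₂ sp ≡ w
    mid₂≡w = proj₁ tail
    only₂ : ∀ {x} → x ∈ Q′ → w ≈ x → x ≡ y
    only₂ x∈ e = proj₂ (proj₂ (proj₂ tail)) x∈ (subst (_≈ _) (sym mid₂≡w) e)
    only₁ : ∀ {x} → x ∈ z ∷ Q₁ → w ≈ x → x ≡ e
    only₁ x∈ w≈x = proj₁ (cross x∈ (here refl) (≈-sym w≈x))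
    w∉Q′ : w ∉ Q′
    w∉Q′ = Unique-head (H.Path.unique right)
    apart₁₂ : Apart (z ∷ Q₁) Q′
    apart₁₂ (x∈ , y∈) = apartˢ (x∈ , there y∈)
    ≉ : ∀ {x y} → x ∈ z ∷ Q₁ → y ∈ Q′ → ¬ x ≈ y
    ≉ x∈ y∈ e = w∉Q′ (subst (_∈ Q′) (trans (proj₂ (cross x∈ (there y∈) e)) mid₂≡w) y∈)
    incl : ∀ {x} → x ∈ (z ∷ Q₁) ++ Q′ → x ∈ (z ∷ Q₁) ++ w ∷ Q′
    incl x∈ = [ ∈-++⁺ˡ , (λ k → ∈-++⁺ʳ (z ∷ Q₁) (there k)) ]′ (∈-++⁻ (z ∷ Q₁) x∈)
    w∈Q : w ∈ (z ∷ Q₁) ++ w ∷ Q′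
    w∈Q = ∈-++⁺ʳ (z ∷ Q₁) (here refl)
    apartC : Apart ((z ∷ Q₁) ++ Q′) C
    apartC (x∈ , y∈) = apart (incl x∈ , y∈)
    inner′ : ∀ {q c} → q ∈ (z ∷ Q₁) ++ Q′ → c ∈ C → q ≈ c → q ≡ s ⊎ q ≡ t
    inner′ q∈ = inner (incl q∈)
    w≉ : ∀ {c} → c ∈ C → ¬ w ≈ c
    w≉ c∈ e with inner w∈Q c∈ e
    ... | inj₁ refl = apartˢ (First⇒∈ (H.Path.start left) , here refl)
    ... | inj₂ refl = w∉Q′ (Last⇒∈ (H.Path.end right₂))
    perm′ : C ++ (z ∷ Q₁) ++ Q′ ↭ xs
    perm′ = replace-↭₂ C (z ∷ Q₁) [] perm
    near : ∀ {x} → x ∈ xs → w ≈ x → x ≡ e ⊎ x ≡ y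
    near x∈ w≈x with ∈-++⁻ C (↭.∈-resp-↭ (↭-sym perm′) x∈)
    ... | inj₁ x∈C = contradiction w≈x (w≉ x∈C)
    ... | inj₂ x∈Q with ∈-++⁻ (z ∷ Q₁) x∈Q
    ...   | inj₁ x∈₁ = inj₁ (only₁ x∈₁ w≈x)
    ...   | inj₂ x∈₂ = inj₂ (only₂ x∈₂ w≈x)

  start-case : ∀ {C y Q s t} → Ear H C (w ∷ y ∷ Q) s t → C ++ w ∷ y ∷ Q ↭ w ∷ xs →
               Extra G u v xs → Extra G v u xs → Outcome G u v xs
  start-case E perm with H.Path.start (Ear.path E)
  ... | first = head-case record { split = S ; ear = E ; perm = perm }

  path-case : ∀ {C Q s t} → Ear H C Q s t → C ++ Q ↭ w ∷ xs → w ∈ Q →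
              Extra G u v xs → Extra G v u xs → Outcome G u v xs
  path-case {C} E perm w∈Q extraᵛ extraᵘ with ∈-∃++ w∈Q
  ... | []     , []     , refl = centre-case S E perm
  ... | []     , y ∷ Q₂ , refl = start-case E perm extraᵛ extraᵘ
  ... | z ∷ Q₁ , y ∷ Q₂ , refl = interior-case E perm extraᵛ extraᵘ
  ... | Q@(z ∷ Q₁) , [] , refl = reversed (reverse Q) (List.reverse-++ Q (w ∷ []))
    where
    E′ = Ear-reverse E
    perm′ = ↭-trans (↭.++⁺ˡ C (↭.↭-reverse (Q ++ w ∷ []))) perm
    reversed : ∀ R → reverse (Q ++ w ∷ []) ≡ w ∷ R → Outcome G u v xs
    reversed (y ∷ R) eq =
      start-case (subst (λ q → Ear H C q _ _) eq E′) (subst (λ q → C ++ q ↭ _) eq perm′) extraᵛ extraᵘ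
    reversed [] eq = centre-case S (subst (λ q → Ear H C q _ _) eq E′) (subst (λ q → C ++ q ↭ _) eq perm′)

  split-ear : ∀ {C Q s t} → Ear H C Q s t → C ++ Q ↭ w ∷ xs → Placed H w C Q s t → Outcome G u v xs
  split-ear {C} {Q} {s} {t} E perm placed =
    case extra? G u v xs ,′ extra? G v u xs of λ
      { (no none , _) → inj₂ (inj₁ (absorb S none (C , Q , s , t , E , perm)))
      ; (_ , no none) → inj₂ (inj₂ (absorb (flip-Splitting S) none (C , Q , s , t , E , perm)))
      ; (yes extraᵛ , yes extraᵘ) → case placed of λ
        { (inj₁ w∈Q) → path-case E perm w∈Q extraᵛ extraᵘ
        ; (inj₂ (w∈C , only)) → cycle-case E perm w∈C only extraᵛ extraᵘ }
      }

-- Vertex-deleted ears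

module _ {N : ℕ} where

  private
    variable
      p W : Walk N
      x y z : Fin N

  -- The first vertex of `p` that belongs to `W` has only its successor along `p` as a possible
  -- neighbour in `W`.
  no-core : Unique p → x ∈ W → (∀ {x} → x ∈ W → x ∈ p) →
            (∀ {x} → x ∈ W → ∃[ y ] ∃[ z ] y ∈ W × z ∈ W × y ≢ z × Adj p x y × Adj p x z) → ⊥
  no-core {p = []}    _ x∈W W⊆p _ = case W⊆p x∈W of λ ()
  no-core {p = h ∷ p} {W = W} u@(_ ∷ u′) x∈W W⊆p two with h ∈? W
  ... | yes h∈W = let _ , _ , _ , _ , y≢z , a , b = two h∈W in
    y≢z (First-unique (Adj-head⁻ (Unique-head u) a) (Adj-head⁻ (Unique-head u) b))
  ... | no h∉W = no-core u′ x∈W (λ x∈ → case W⊆p x∈ of λ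
      { (here refl) → contradiction x∈ h∉W ; (there x∈p) → x∈p })
    λ x∈ → let y , z , y∈ , z∈ , y≢z , a , b = two x∈ in
      y , z , y∈ , z∈ , y≢z , Adj-tail⁻ (≢h x∈) (≢h y∈) a , Adj-tail⁻ (≢h x∈) (≢h z∈) b
    where
    ≢h : ∀ {x} → x ∈ W → x ≢ h
    ≢h x∈ refl = h∉W x∈

  -- The head of the list is stripped until it is `c`, which then has at most one neighbour, or one
  -- of the three neighbours, after which `c` is next and leaves room for only one more.
  no-branch : Unique p → ∀ {c} → x ≢ y → x ≢ z → y ≢ z → Adj p c x → Adj p c y → Adj p c z → ⊥
  no-branch {p = []} _ _ _ _ ()
  no-branch {p = h ∷ p} {x} {y} {z} u@(_ ∷ u′) {c} x≢y x≢z y≢z ax ay az with c ≟ h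
  ... | yes refl = x≢y (First-unique (Adj-head⁻ (Unique-head u) ax) (Adj-head⁻ (Unique-head u) ay))
  ... | no c≢h with x ≟ h | y ≟ h | z ≟ h
  ...   | yes refl | _ | _ = at-start c≢h ax ay az (x≢y ∘ sym) (x≢z ∘ sym) y≢z
    where
    at-start : ∀ {y z} → c ≢ h → Adj (h ∷ p) c h → Adj (h ∷ p) c y → Adj (h ∷ p) c z →
               y ≢ h → z ≢ h → y ≢ z → ⊥
    at-start c≢h ah ay az y≢h z≢h y≢z with Adj-head⁻ (Unique-head u) (Adj-sym ah)
    ... | first = y≢z (First-unique (Adj-head⁻ (Unique-head u′) (Adj-tail⁻ c≢h y≢h ay))
                                    (Adj-head⁻ (Unique-head u′) (Adj-tail⁻ c≢h z≢h az)))
  ...   | no x≢h | yes refl | _ with Adj-head⁻ (Unique-head u) (Adj-sym ay)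
  ...     | first = x≢z (First-unique (Adj-head⁻ (Unique-head u′) (Adj-tail⁻ c≢h x≢h ax))
                                      (Adj-head⁻ (Unique-head u′) (Adj-tail⁻ c≢h (y≢z ∘ sym) az)))
  no-branch {p = h ∷ p} {x} {y} {z} u@(_ ∷ u′) {c} x≢y x≢z y≢z ax ay az
      | no c≢h | no x≢h | no y≢h | yes refl with Adj-head⁻ (Unique-head u) (Adj-sym az)
  ...     | first = x≢y (First-unique (Adj-head⁻ (Unique-head u′) (Adj-tail⁻ c≢h x≢h ax))
                                      (Adj-head⁻ (Unique-head u′) (Adj-tail⁻ c≢h y≢h ay)))
  no-branch {p = h ∷ p} u@(_ ∷ u′) x≢y x≢z y≢z ax ay az
      | no c≢h | no x≢h | no y≢h | no z≢h =
    no-branch u′ x≢y x≢z y≢z (Adj-tail⁻ c≢h x≢h ax) (Adj-tail⁻ c≢h y≢h ay) (Adj-tail⁻ c≢h z≢h az)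

module _ {N : ℕ} {G : Graph N} where

  open Graph G using (_~_; _~?_; ~-sym; ~-irrefl)
  open Induced G

  cycle-nbrs : ∀ {c x} → Cyc c → x ∈ c →
               ∃[ y ] ∃[ z ] y ∈ c × z ∈ c × y ≢ z × x ~ y × x ~ z
  cycle-nbrs cyc x∈ with hoopAt cyc x∈
  ... | J , l , r , c↭ , H = l , r , back (First⇒∈ (Path.start path)) , back (Last⇒∈ (Path.end path)) ,
                             l≢r , w~l , w~r
    where
    open Hoop H
    back : ∀ {x} → x ∈ J → x ∈ _
    back = ↭.∈-resp-↭ (↭-sym c↭) ∘ there

  no-third : ∀ {c x y z u} → Cyc c → x ∈ c → y ∈ c → z ∈ c → u ∈ c → y ≢ z → y ≢ u → z ≢ u →
             x ~ y → x ~ z → ¬ x ~ u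
  no-third cyc x∈ y∈ z∈ u∈ y≢z y≢u z≢u x~y x~z x~u with hoopAt cyc x∈
  ... | J , l , r , c↭ , H with end y∈ x~y | end z∈ x~z | end u∈ x~u
    where
    open Hoop H
    end : ∀ {y} → y ∈ _ → _ ~ y → y ≡ l ⊎ y ≡ r
    end y∈ e with ↭.∈-resp-↭ c↭ y∈
    ... | here refl = contradiction e ~-irrefl
    ... | there y∈J = w~⇒ y∈J e
  ... | inj₁ refl | inj₁ refl | _         = y≢z refl
  ... | inj₂ refl | inj₂ refl | _         = y≢z refl
  ... | inj₁ refl | inj₂ refl | inj₁ refl = y≢u refl
  ... | inj₁ refl | inj₂ refl | inj₂ refl = z≢u refl
  ... | inj₂ refl | inj₁ refl | inj₁ refl = z≢u refl
  ... | inj₂ refl | inj₁ refl | inj₂ refl = y≢u refl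

  acyclic-path : ∀ {s t p c} → Path s t p → Cyc c → (∀ {x} → x ∈ c → x ∈ p) → ⊥
  acyclic-path {c = []}    _ cyc _   = case Cyc.long cyc of λ ()
  acyclic-path {c = x ∷ _} π cyc c⊆p = no-core (Path.unique π) (here refl) c⊆p λ x∈ →
    let y , z , y∈ , z∈ , y≢z , x~y , x~z = cycle-nbrs cyc x∈ in
    y , z , y∈ , z∈ , y≢z ,
    Path.~⇒adj π (c⊆p x∈) (c⊆p y∈) x~y , Path.~⇒adj π (c⊆p x∈) (c⊆p z∈) x~z

  -- If `w` is on `Q`, the cycle `C` survives inside the path. If `w` is on `C`, every other vertex
  -- of `C` with a neighbour on `Q` must be adjacent to `w`, to avoid a branching; this leaves so
  -- few attachments that either a cycle survives or the ends were not spread.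
  ear-minus-vertex : ∀ {C Q s t w a b p} → Ear G C Q s t → Placed G w C Q s t →
                     Path a b p → (∀ {x} → x ∈ C ++ Q → x ≢ w → x ∈ p) → ⊥
  ear-minus-vertex {C} {Q} {s} {t} {w} {p = p} E (inj₁ w∈Q) π ⊆p =
    acyclic-path π cyc λ x∈ → ⊆p (∈-++⁺ˡ x∈) λ { refl → apart (w∈Q , x∈) }
    where open Ear E
  ear-minus-vertex {C} {Q} {s} {t} {w} {p = p} E (inj₂ (w∈C , only)) π ⊆p with hoopAt (Ear.cyc E) w∈C
  ... | J , l , r , C↭ , H = go only ends
    where
    open Ear E
    open Hoop H using (w~⇒; w~l; w~r; w∉p; l≢r) renaming (path to pathJ)
    s∈ = First⇒∈ (Path.start path)
    t∈ = Last⇒∈ (Path.end path)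
    C⊆ : ∀ {x} → x ∈ C → x ≢ w → x ∈ p
    C⊆ = ⊆p ∘ ∈-++⁺ˡ
    Q⊆ : ∀ {x} → x ∈ Q → x ∈ p
    Q⊆ x∈ = ⊆p (∈-++⁺ʳ C x∈) λ { refl → apart (x∈ , w∈C) }
    J⊆ : ∀ {x} → x ∈ J → x ∈ C × x ≢ w
    J⊆ x∈ = ↭.∈-resp-↭ (↭-sym C↭) (there x∈) , λ { refl → w∉p x∈ }
    inJ : ∀ {x} → x ∈ C → x ≢ w → x ∈ J
    inJ x∈ x≢w with ↭.∈-resp-↭ C↭ x∈
    ... | here eq  = contradiction eq x≢w
    ... | there x∈ = x∈
    -- If `b` were not adjacent to `w`, both its cycle neighbours would survive, and with `q` it
    -- would have three neighbours on the path.
    branch : ∀ {b q} → q ∈ Q → b ∈ C → q ~ b → b ≢ w → ¬ ¬ b ~ w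
    branch q∈ b∈ q~b b≢w b≁w =
      let y , z , y∈ , z∈ , y≢z , b~y , b~z = cycle-nbrs cyc b∈
          adj = λ {y} y∈ b~y → Path.~⇒adj π (C⊆ b∈ b≢w) (C⊆ {y} y∈ λ { refl → b≁w b~y }) b~y
      in no-branch (Path.unique π) y≢z (λ { refl → apart (q∈ , y∈) }) (λ { refl → apart (q∈ , z∈) })
        (adj y∈ b~y) (adj z∈ b~z) (Path.~⇒adj π (C⊆ b∈ b≢w) (Q⊆ q∈) (~-sym q~b))
    ~w : ∀ {b q} → q ∈ Q → b ∈ C → q ~ b → b ≢ w → b ~ w
    ~w {b} q∈ b∈ q~b b≢w = decidable-stable (b ~? w) (branch q∈ b∈ q~b b≢w)
    no-triangle : ∀ {b c q} → q ∈ Q → b ∈ C → c ∈ C → b ≢ w → c ≢ w → q ~ b → q ~ c → b ~ c → ⊥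
    no-triangle {b} {c} {q} q∈ b∈ c∈ b≢w c≢w q~b q~c b~c =
      no-core {W = q ∷ b ∷ c ∷ []} (Path.unique π) (here refl)
        (λ { (here refl) → Q⊆ q∈ ; (there (here refl)) → C⊆ b∈ b≢w ; (there (there (here refl))) → C⊆ c∈ c≢w })
        (λ { (here refl) → b , c , there (here refl) , there (there (here refl)) , ~⇒≢ b~c ,
               adj (Q⊆ q∈) (C⊆ b∈ b≢w) q~b , adj (Q⊆ q∈) (C⊆ c∈ c≢w) q~c
           ; (there (here refl)) → q , c , here refl , there (there (here refl)) , ~⇒≢ q~c ,
               adj (C⊆ b∈ b≢w) (Q⊆ q∈) (~-sym q~b) , adj (C⊆ b∈ b≢w) (C⊆ c∈ c≢w) b~c
           ; (there (there (here refl))) → q , b , here refl , there (here refl) , ~⇒≢ q~b ,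
               adj (C⊆ c∈ c≢w) (Q⊆ q∈) (~-sym q~c) , adj (C⊆ c∈ c≢w) (C⊆ b∈ b≢w) (~-sym b~c) })
      where adj = Path.~⇒adj π
    two-others : Spread G (Nbr G s C) → ∃[ x ] ∃[ y ] x ≢ y × x ≢ w × y ≢ w × Nbr G s C x × Nbr G s C y
    two-others (three {x} {y} {z} nx ny nz x≢y x≢z y≢z) with x ≟ w | y ≟ w
    ... | yes refl | _        = y , z , y≢z , x≢y ∘ sym , x≢z ∘ sym , ny , nz
    ... | no x≢w   | yes refl = x , z , x≢z , x≢w , y≢z ∘ sym , nx , nz
    ... | no x≢w   | no y≢w   = x , y , x≢y , x≢w , y≢w , nx , ny
    two-others (far {x} {y} nx@(nbr x∈ s~x) ny@(nbr y∈ s~y) x≢y x≁y) with x ≟ w | y ≟ w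
    ... | yes refl | _        = contradiction (~-sym (~w s∈ y∈ s~y (x≢y ∘ sym))) x≁y
    ... | no x≢w   | yes refl = contradiction (~w s∈ x∈ s~x x≢w) x≁y
    ... | no x≢w   | no y≢w   = x , y , x≢y , x≢w , y≢w , nx , ny
    go : (s ≡ t ⊎ (∀ {c} → c ∈ C → s ~ c → c ≡ w)) → Ends G s t (Nbr G s C) (Nbr G t C) → ⊥
    -- Two neighbours of `s` other than `w` are both adjacent to `w`, hence are `l` and `r`. So `s`
    -- can replace `w` and closes `J` to a cycle within the path.
    go _ (single refl sp) with two-others sp
    ... | x , y , x≢y , x≢w , y≢w , nbr x∈ s~x , nbr y∈ s~y =
      acyclic-path π (hoop⇒cyc record
        { path = pathJ ; w∉p = λ s∈J → apart (s∈ , proj₁ (J⊆ s∈J)) ; l≢r = l≢r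
        ; w~l = proj₁ both ; w~r = proj₂ both
        ; w~⇒ = λ z∈ e → w~⇒ z∈ (~-sym (~w s∈ (proj₁ (J⊆ z∈)) e (proj₂ (J⊆ z∈)))) })
        λ { (here refl) → Q⊆ s∈ ; (there x∈) → let x∈C , x≢w = J⊆ x∈ in C⊆ x∈C x≢w }
      where
      both : s ~ l × s ~ r
      both with w~⇒ (inJ x∈ x≢w) (~-sym (~w s∈ x∈ s~x x≢w)) | w~⇒ (inJ y∈ y≢w) (~-sym (~w s∈ y∈ s~y y≢w))
      ... | inj₁ refl | inj₁ refl = contradiction refl x≢y
      ... | inj₂ refl | inj₂ refl = contradiction refl x≢y
      ... | inj₁ refl | inj₂ refl = s~x , s~y
      ... | inj₂ refl | inj₁ refl = s~y , s~x
    go (inj₁ s≡t) (double s≢t _ _ _ _ _) = s≢t s≡t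
    go (inj₂ only′) (double s≢t _ _ _ ¬b sp) with spread⇒other G sp w
    ...   | b , inj₁ (nbr b∈ s~b) , b≢w = b≢w (only′ b∈ s~b)
    ...   | b , inj₂ nb@(nbr b∈ t~b) , b≢w
      with any? (λ c → nbr? G t C c ×-dec ¬? (c ≟ w) ×-dec ¬? (c ≟ b))
    ...     | yes (c , nc@(nbr c∈ t~c) , c≢w , c≢b) =
      no-triangle t∈ b∈ c∈ b≢w c≢w t~b t~c (¬spread⇒~ G ¬b nb nc (c≢b ∘ sym))
    -- Now `t` sees at most `b` and `w`, and `s` sees only `w`; as `b` and `w` are adjacent, the
    -- union is not spread.
    ...     | no none = pair⇒¬spread G (~w t∈ b∈ t~b b≢w) (λ
      { (inj₁ (nbr c∈ s~c)) → inj₂ (only′ c∈ s~c)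
      ; (inj₂ nc) → in-pair nc }) sp
      where
      in-pair : ∀ {c} → Nbr G t C c → c ≡ b ⊎ c ≡ w
      in-pair {c} nc with c ≟ b | c ≟ w
      ... | yes c≡b | _       = inj₁ c≡b
      ... | no _    | yes c≡w = inj₂ c≡w
      ... | no c≢b  | no c≢w  = contradiction (c , nc , c≢w , c≢b) none

-- From ears to solids

length-≤ : ∀ {A : Set} {xs ys : List A} → Unique xs → (∀ {x} → x ∈ xs → x ∈ ys) → length xs ℕ.≤ length ys
length-≤ {xs = []}     _       _  = z≤n
length-≤ {xs = x ∷ xs} u@(_ ∷ u′) ⊆ with ∈⇒↭ (⊆ (here refl))
... | ys′ , ys↭ = subst (suc (length xs) ℕ.≤_) (sym (↭.↭-length ys↭)) (s≤s (length-≤ u′ λ {z} z∈ →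
  case ↭.∈-resp-↭ ys↭ (⊆ (there z∈)) of λ
    { (here refl) → contradiction z∈ (Unique-head u) ; (there z∈′) → z∈′ }))

module _ {N : ℕ} where

  private
    variable
      p : Walk N
      x y : Fin N

  Adj⇒steps : Adj p x y → (x , y) ∈ steps p ⊎ (y , x) ∈ steps p
  Adj⇒steps here                        = inj₁ (here refl)
  Adj⇒steps ereh                        = inj₂ (here refl)
  Adj⇒steps {p = _ ∷ _ ∷ _} (there a)   = Sum.map there there (Adj⇒steps a)
  Adj⇒steps {p = _ ∷ []} (there ())

  steps⇒Adj : ∀ p → (x , y) ∈ steps p → Adj {A = Fin N} p x y
  steps⇒Adj (_ ∷ _ ∷ p)     (here refl) = here
  steps⇒Adj (_ ∷ p@(_ ∷ _)) (there m)   = there (steps⇒Adj p m)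

  steps⇒Adj± : (x , y) ∈ steps p ⊎ (y , x) ∈ steps p → Adj p x y
  steps⇒Adj± = [ steps⇒Adj _ , Adj-sym ∘ steps⇒Adj _ ]′

  Adj⇒Linked : ∀ {R : Fin N → Fin N → Set} p → (∀ {x y} → Adj p x y → R x y) → Linked R p
  Adj⇒Linked []          _ = []
  Adj⇒Linked (_ ∷ [])    _ = [-]
  Adj⇒Linked (_ ∷ _ ∷ p) r = r here ∷ Adj⇒Linked _ (r ∘ there)

  Linked⇒Adj : ∀ {R : Fin N → Fin N → Set} → (∀ {x y} → R x y → R y x) →
               Linked R p → Adj p x y → R x y
  Linked⇒Adj R-sym (r ∷ _)  here      = r
  Linked⇒Adj R-sym (r ∷ _)  ereh      = R-sym r
  Linked⇒Adj R-sym (_ ∷ rs) (there a) = Linked⇒Adj R-sym rs a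
  Linked⇒Adj R-sym [-]      (there ())

  First⇒head : First p x → List.head p ≡ just x
  First⇒head first = refl

  head⇒First : List.head p ≡ just x → First p x
  head⇒First {p = _ ∷ _} refl = first

  Last⇒last : Last p x → List.last p ≡ just x
  Last⇒last last                        = refl
  Last⇒last {p = _ ∷ _ ∷ _} (there l)   = Last⇒last l

  last⇒Last : ∀ p → List.last p ≡ just x → Last {A = Fin N} p x
  last⇒Last (_ ∷ [])        refl = last
  last⇒Last (_ ∷ p@(_ ∷ _)) eq   = there (last⇒Last p eq)

  Adj-++-mid⁻ : ∀ p {z q} → Adj (p ++ z ∷ q) x y → Adj (p ∷ʳ z) x y ⊎ Adj (z ∷ q) x y
  Adj-++-mid⁻ []          a         = inj₂ a
  Adj-++-mid⁻ (_ ∷ [])    here      = inj₁ here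
  Adj-++-mid⁻ (_ ∷ [])    ereh      = inj₁ ereh
  Adj-++-mid⁻ (_ ∷ _ ∷ _) here      = inj₁ here
  Adj-++-mid⁻ (_ ∷ _ ∷ _) ereh      = inj₁ ereh
  Adj-++-mid⁻ (_ ∷ p)     (there a) = Sum.map₁ there (Adj-++-mid⁻ p a)

all₃ : {P : Fin 3 → Set} → P zero → P (suc zero) → P (suc (suc zero)) → ∀ i → P i
all₃ p q r zero             = p
all₃ p q r (suc zero)       = q
all₃ p q r (suc (suc zero)) = r

pairwise₃ : {R : Fin 3 → Fin 3 → Set} → (∀ {i j} → R i j → R j i) →
            R zero (suc zero) → R zero (suc (suc zero)) → R (suc zero) (suc (suc zero)) →
            ∀ i j → i ≢ j → R i j
pairwise₃ R-sym p q r zero             zero             i≢i = contradiction refl i≢i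
pairwise₃ R-sym p q r zero             (suc zero)       _   = p
pairwise₃ R-sym p q r zero             (suc (suc zero)) _   = q
pairwise₃ R-sym p q r (suc zero)       zero             _   = R-sym p
pairwise₃ R-sym p q r (suc zero)       (suc zero)       i≢i = contradiction refl i≢i
pairwise₃ R-sym p q r (suc zero)       (suc (suc zero)) _   = r
pairwise₃ R-sym p q r (suc (suc zero)) zero             _   = R-sym q
pairwise₃ R-sym p q r (suc (suc zero)) (suc zero)       _   = R-sym r
pairwise₃ R-sym p q r (suc (suc zero)) (suc (suc zero)) i≢i = contradiction refl i≢i

module Recognise {N : ℕ} (K : Graph N) where

  open Graph K using (_~_; _~?_; ~-sym; ~-irrefl; ~⇒∈V) renaming (V to VK)
  open Induced K

  private
    variable
      a a′ b b′ l r s t w : Fin N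
      C J L R Q p : Walk N

  Spans : Walk N → Walk N → Set
  Spans C Q = (∀ {x} → x ∈ˢ VK → x ∈ C ++ Q) × (∀ {x} → x ∈ C ++ Q → x ∈ˢ VK)

  isPath : Path a b p → (∀ {x} → x ∈ p → x ∈ˢ VK) → IsPath K a b p
  isPath π ⊆V = First⇒head start , Last⇒last end , unique , All.tabulate ⊆V , Adj⇒Linked _ adj⇒~
    where open Path π

  isCycle : Cyc C → IsCycle K C
  isCycle cyc = long , unique , Adj⇒Linked _ adj⇒~
    where open Cyc cyc

  isUnion : ∀ ws → (∀ {x} → x ∈ˢ VK → Any (x ∈_) ws) → (∀ {x y} → x ~ y → Any (λ p → Adj p x y) ws) →
            IsUnionOf K ws
  isUnion _ vs es = (λ _ → vs) , λ _ _ e → Any.map Adj⇒steps (es e)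

  length₂ : Path a b p → a ≢ b → 1 ℕ.≤ walkLength p
  length₂ π a≢b with Path.start π | Path.end π
  ... | first | last            = contradiction refl a≢b
  ... | first | there last      = s≤s z≤n
  ... | first | there (there _) = s≤s z≤n

  length₃ : Path a b p → a ≢ b → ¬ a ~ b → 2 ℕ.≤ walkLength p
  length₃ π a≢b a≁b with Path.start π | Path.end π
  ... | first | last               = contradiction refl a≢b
  ... | first | there last         = contradiction (Path.adj⇒~ π here) a≁b
  ... | first | there (there last) = s≤s (s≤s z≤n)
  ... | first | there (there (there _)) = s≤s (s≤s z≤n)

  triangle-adj : ∀ {x y} → x ∈ a ∷ a′ ∷ b ∷ [] → y ∈ a ∷ a′ ∷ b ∷ [] → x ≢ y →
                 Adj (close (a ∷ a′ ∷ b ∷ [])) x y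
  triangle-adj (here refl) (here refl) x≢x = contradiction refl x≢x
  triangle-adj (here refl) (there (here refl)) _ = here
  triangle-adj (here refl) (there (there (here refl))) _ = there (there ereh)
  triangle-adj (there (here refl)) (here refl) _ = ereh
  triangle-adj (there (here refl)) (there (here refl)) x≢x = contradiction refl x≢x
  triangle-adj (there (here refl)) (there (there (here refl))) _ = there here
  triangle-adj (there (there (here refl))) (here refl) _ = there (there here)
  triangle-adj (there (there (here refl))) (there (here refl)) _ = there ereh
  triangle-adj (there (there (here refl))) (there (there (here refl))) x≢x = contradiction refl x≢x

  unordered : ∀ {R : Fin N → Fin N → Set} → (∀ {x y} → R x y → R y x) →
              (∀ {x y} → x ∈ C → y ∈ C → x ~ y → R x y) →
              (∀ {x y} → x ∈ Q → y ∈ Q → x ~ y → R x y) →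
              (∀ {x y} → x ∈ Q → y ∈ C → x ~ y → R x y) →
              Spans C Q → ∀ {x y} → x ~ y → R x y
  unordered {C = C} R-sym cc qq qc (V⊆ , _) e with ∈-++⁻ C (V⊆ (~⇒∈V e)) | ∈-++⁻ C (V⊆ (~⇒∈V (~-sym e)))
  ... | inj₁ x∈ | inj₁ y∈ = cc x∈ y∈ e
  ... | inj₂ x∈ | inj₂ y∈ = qq x∈ y∈ e
  ... | inj₂ x∈ | inj₁ y∈ = qc x∈ y∈ e
  ... | inj₁ x∈ | inj₂ y∈ = R-sym (qc y∈ x∈ (~-sym e))

  pyramid : ∀ {x y z} → Cyc C → w ∉ C → Spans C (w ∷ []) →
            Nbr K w C x → Nbr K w C y → Nbr K w C z → x ≢ y → x ≢ z → y ≢ z → Pyramid K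
  pyramid {C} {w} {x} {y} {z} cyc w∉C spans@(V⊆ , _) nx ny nz x≢y x≢z y≢z =
    C , w , isCycle cyc , w∉C ,
    length-≤ {xs = x ∷ y ∷ z ∷ []} ((x≢y ∷ x≢z ∷ []) ∷ (y≢z ∷ []) ∷ [] ∷ [])
      (λ { (here refl) → sel nx ; (there (here refl)) → sel ny ; (there (there (here refl))) → sel nz }) ,
    isUnion _
      (λ v∈ → case ∈-++⁻ C (V⊆ v∈) of λ
        { (inj₁ x∈) → here (∈-close x∈)
        ; (inj₂ (here refl)) → there (spoke nx λ { refl → here refl }) })
      (unordered (Any.map Adj-sym)
        (λ x∈ y∈ e → here (Cyc.~⇒adj cyc x∈ y∈ e))
        (λ { (here refl) (here refl) e → contradiction e ~-irrefl })
        (λ { (here refl) y∈ e → there (spoke (nbr y∈ e) λ { refl → here }) })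
        spans)
    where
    sel : ∀ {x} → Nbr K w C x → x ∈ nbrsIn K w C
    sel (nbr x∈ e) = ∈-filter⁺ (w ~?_) x∈ e
    ∈-close : ∀ {x c} → x ∈ c → x ∈ close c
    ∈-close {c = _ ∷ _} = ∈-++⁺ˡ
    spoke : ∀ {x} {P : Walk N → Set} → Nbr K w C x → (∀ {p} → p ≡ w ∷ x ∷ [] → P p) →
            Any P (map (λ x → w ∷ x ∷ []) (nbrsIn K w C))
    spoke n f = Any.map⁺ (lose (sel n) (f refl))

  private
    meet : ∀ {p q I J} zs → (∀ {x} → x ∈ p → x ∈ zs ⊎ x ∈ I) → (∀ {x} → x ∈ q → x ∈ zs ⊎ x ∈ J) →
           Apart I J → MeetOnlyIn {N} p q zs
    meet zs p⊆ q⊆ dis x x∈p x∈q with p⊆ x∈p | q⊆ x∈q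
    ... | inj₁ x∈zs | _         = x∈zs
    ... | inj₂ _    | inj₁ x∈zs = x∈zs
    ... | inj₂ x∈I  | inj₂ x∈J  = contradiction (x∈I , x∈J) dis

    meet-sym : ∀ {p q zs} → MeetOnlyIn {N} p q zs → MeetOnlyIn q p zs
    meet-sym m x x∈q x∈p = m x x∈p x∈q

  -- The three paths are the two arcs of the cycle between `a` and `b`, and `Q` with `a` and `b`
  -- attached. Each has at least two steps because `a` and `b` are distinct and not adjacent.
  trihedron : Cyc C → Path s t Q → Apart Q C → a ∈ C → b ∈ C → a ≢ b → ¬ a ~ b → s ~ a → t ~ b →
              (∀ {q c} → q ∈ Q → c ∈ C → q ~ c → q ≡ s × c ≡ a ⊎ q ≡ t × c ≡ b) →
              Spans C Q → Trihedron K
  trihedron {C} {s} {t} {Q} {a} {b} cyc π apart a∈ b∈ a≢b a≁b s~a t~b cross spans@(V⊆ , ⊆V)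
    with hoopAt cyc a∈
  ... | J , l , r , C↭ , H with ↭.∈-resp-↭ C↭ b∈
  ...   | here refl = contradiction refl a≢b
  ...   | there b∈J with ∈-∃++ b∈J
  ...     | [] , _ , refl with Path.start (Hoop.path H)
  ...       | first = contradiction (Hoop.w~l H) a≁b
  trihedron {C} {s} {t} {Q} {a} {b} cyc π apart a∈ b∈ a≢b a≁b s~a t~b cross spans@(V⊆ , ⊆V)
      | J , l , r , C↭ , H | there b∈J | J₁@(_ ∷ _) , J₂ , refl =
    (P₁ ∷ P₂ ∷ P₃ ∷ []) , a , b , a≢b ,
    all₃ (isPath π₁ (⊆V ∘ in₁) , length₃ π₁ a≢b a≁b)
         (isPath π₂ (⊆V ∘ in₂) , length₃ π₂ a≢b a≁b)
         (isPath π₃ (⊆V ∘ in₃) , length₃ π₃ a≢b a≁b) ,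
    pairwise₃ meet-sym
      (meet _ m₁ m₂ (λ (x∈ , y∈) → apartJ (x∈ , there y∈)))
      (meet _ m₁ m₃ (λ (x∈ , y∈) → apart (y∈ , J⊆ (∈-++⁺ˡ x∈))))
      (meet _ m₂ m₃ (λ (x∈ , y∈) → apart (y∈ , J⊆ (∈-++⁺ʳ J₁ (there x∈))))) ,
    isUnion _
      (λ v∈ → case ∈-++⁻ C (V⊆ v∈) of λ
        { (inj₁ x∈) → case ↭.∈-resp-↭ C↭ x∈ of λ
          { (here refl) → here (here refl)
          ; (there x∈) → case ∈-++⁻ J₁ x∈ of λ
            { (inj₁ x∈) → here (there (∈-++⁺ˡ x∈))
            ; (inj₂ x∈) → there (here (↭.∈-resp-↭ (↭-sym (↭.↭-reverse _)) (∈-++⁺ˡ x∈))) } }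
        ; (inj₂ x∈) → there (there (here (there (∈-++⁺ˡ x∈)))) })
      (unordered (Any.map Adj-sym)
        (λ x∈ y∈ e → case ↭.∈-resp-↭ C↭ x∈ ,′ ↭.∈-resp-↭ C↭ y∈ of λ
          { (here refl , here refl) → contradiction e ~-irrefl
          ; (here refl , there y∈) → rim y∈ e
          ; (there x∈ , here refl) → Any.map Adj-sym (rim x∈ (~-sym e))
          ; (there x∈ , there y∈) → case Adj-++-mid⁻ J₁ (Path.~⇒adj path x∈ y∈ e) of λ
            { (inj₁ adj) → here (there adj)
            ; (inj₂ adj) → there (here (Adj-reverse (Adj-++ˡ adj))) } })
        (λ x∈ y∈ e → there (there (here (there (Adj-++ˡ (Path.~⇒adj π x∈ y∈ e))))))
        (λ x∈ y∈ e → there (there (here (case cross x∈ y∈ e of λ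
          { (inj₁ (refl , refl)) → Adj-sym (Adj-head (Path.start π₃s))
          ; (inj₂ (refl , refl)) → there (Adj-link (Path.end π) first) }))))
        spans)
    where
    open Hoop H
    J₁b = J₁ ∷ʳ b
    bJ₂ = b ∷ J₂
    J⊆ : ∀ {x} → x ∈ J → x ∈ C
    J⊆ = ↭.∈-resp-↭ (↭-sym C↭) ∘ there
    sp = Path-split {p = J₁} {q = bJ₂} first first path
    apartJ : Apart J₁ bJ₂
    apartJ = Split.apart sp
    split-b : ∀ {x} → x ∈ J₁b → x ∈ J₁ ⊎ x ≡ b
    split-b x∈ with ∈-++⁻ J₁ x∈
    ... | inj₁ x∈       = inj₁ x∈
    ... | inj₂ (here e) = inj₂ e
    r∈ : r ∈ bJ₂
    r∈ = Last⇒∈ (Path.end (Split.right sp))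
    l∈ : l ∈ J₁
    l∈ = First⇒∈ (Path.start (Split.left sp))
    πJ₁b : Path l b J₁b
    πJ₁b = Path-∷ʳ (Split.left sp) mid~b
      (λ b∈ → apartJ (b∈ , here refl)) (λ x∈ e → proj₁ (Split.cross sp x∈ (here refl) e))
      where
      mid~b : Split.mid₁ sp ~ b
      mid~b with Path.start (Split.right sp) | Split.mid~ sp
      ... | first | e = e
    P₁ = a ∷ J₁b
    π₁ : Path a b P₁
    π₁ = Path-∷ πJ₁b w~l
      (λ a∈ → [ (λ k → w∉p (∈-++⁺ˡ k)) , a≢b ]′ (split-b a∈))
      (λ y∈ e → case split-b y∈ of λ
        { (inj₂ refl) → contradiction e a≁b
        ; (inj₁ y∈) → [ id , (λ { refl → contradiction (y∈ , r∈) apartJ }) ]′ (w~⇒ (∈-++⁺ˡ y∈) e) })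
    πbJ₂ : Path b r bJ₂
    πbJ₂ with Path.start (Split.right sp) | Split.right sp
    ... | first | π = π
    P₂ = reverse (bJ₂ ∷ʳ a)
    π₂ : Path a b P₂
    π₂ = Path-reverse (Path-∷ʳ πbJ₂ (~-sym w~r) (λ a∈ → w∉p (∈-++⁺ʳ J₁ a∈))
      (λ x∈ e → [ (λ { refl → contradiction (l∈ , x∈) apartJ }) , id ]′ (w~⇒ (∈-++⁺ʳ J₁ x∈) (~-sym e))))
    P₃ = a ∷ (Q ∷ʳ b)
    π₃s : Path s b (Q ∷ʳ b)
    π₃s = Path-∷ʳ π t~b (λ b∈Q → apart (b∈Q , b∈))
      (λ x∈ e → case cross x∈ b∈ e of λ
        { (inj₁ (_ , b≡a)) → contradiction (sym b≡a) a≢b ; (inj₂ (x≡t , _)) → x≡t })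
    π₃ : Path a b P₃
    π₃ = Path-∷ π₃s (~-sym s~a)
      (λ m → case ∈-++⁻ Q m of λ { (inj₁ k) → apart (k , a∈) ; (inj₂ (here eq)) → a≢b eq })
      (λ m e → case ∈-++⁻ Q m of λ
        { (inj₂ (here refl)) → contradiction e a≁b
        ; (inj₁ k) → case cross k a∈ (~-sym e) of λ
          { (inj₁ (y≡s , _)) → y≡s ; (inj₂ (_ , a≡b)) → contradiction a≡b a≢b } })
    Adj-head : ∀ {q y z} → First q y → Adj (z ∷ q) z y
    Adj-head first = here
    in-C : ∀ {x} → x ∈ C → x ∈ C ++ Q
    in-C = ∈-++⁺ˡ
    in₁ : ∀ {x} → x ∈ P₁ → x ∈ C ++ Q
    in₁ (here refl) = in-C a∈
    in₁ (there x∈) = [ in-C ∘ J⊆ ∘ ∈-++⁺ˡ , (λ { refl → in-C b∈ }) ]′ (split-b x∈)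
    in₂ : ∀ {x} → x ∈ P₂ → x ∈ C ++ Q
    in₂ x∈ with ∈-++⁻ bJ₂ (∈-reverse⁻ x∈)
    ... | inj₁ x∈          = in-C (J⊆ (∈-++⁺ʳ J₁ x∈))
    ... | inj₂ (here refl) = in-C a∈
    in₃ : ∀ {x} → x ∈ P₃ → x ∈ C ++ Q
    in₃ (here refl) = in-C a∈
    in₃ (there x∈) with ∈-++⁻ Q x∈
    ... | inj₁ x∈          = ∈-++⁺ʳ C x∈
    ... | inj₂ (here refl) = in-C b∈
    m₁ : ∀ {x} → x ∈ P₁ → x ∈ a ∷ b ∷ [] ⊎ x ∈ J₁
    m₁ (here eq)  = inj₁ (here eq)
    m₁ (there x∈) = [ inj₂ , (λ eq → inj₁ (there (here eq))) ]′ (split-b x∈)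
    m₂ : ∀ {x} → x ∈ P₂ → x ∈ a ∷ b ∷ [] ⊎ x ∈ J₂
    m₂ x∈ with ∈-++⁻ bJ₂ (∈-reverse⁻ x∈)
    ... | inj₁ (here eq)  = inj₁ (there (here eq))
    ... | inj₁ (there x∈) = inj₂ x∈
    ... | inj₂ (here eq)  = inj₁ (here eq)
    m₃ : ∀ {x} → x ∈ P₃ → x ∈ a ∷ b ∷ [] ⊎ x ∈ Q
    m₃ (here eq) = inj₁ (here eq)
    m₃ (there x∈) with ∈-++⁻ Q x∈
    ... | inj₁ x∈        = inj₂ x∈
    ... | inj₂ (here eq) = inj₁ (there (here eq))
    rim : ∀ {y} → y ∈ J → a ~ y → Any (λ p → Adj p a y) (P₁ ∷ P₂ ∷ P₃ ∷ [])
    rim y∈ e with w~⇒ y∈ e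
    ... | inj₁ refl = here (Path.~⇒adj π₁ (here refl) (there (First⇒∈ (Path.start πJ₁b))) e)
    ... | inj₂ refl = there (here (Path.~⇒adj π₂ (First⇒∈ (Path.start π₂))
            (↭.∈-resp-↭ (↭-sym (↭.↭-reverse _)) (∈-++⁺ˡ r∈)) e))

  private
    ∈-reverse⁺ : ∀ {x} → x ∈ p → x ∈ reverse p
    ∈-reverse⁺ = ↭.∈-resp-↭ (↭-sym (↭.↭-reverse _))

  -- An induced cycle with `w` taken out and the edge `xy` cut: `L` and `R` are the two remaining
  -- arcs. They yield two of the three paths of a stamp or a prism.
  record Halves (w l r : Fin N) (L R : Walk N) (x y : Fin N) : Set where
    field
      left  : Path l x L
      right : Path y r R
      x~y   : x ~ y
      apart : Apart L R
      cross : Cross L R x y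
      w∉    : w ∉ L ++ R
      w~l   : w ~ l
      w~r   : w ~ r
      L~w   : ∀ {z} → z ∈ L → z ~ w → z ≡ l
      R~w   : ∀ {z} → z ∈ R → z ~ w → z ≡ r

  halves : ∀ {x y} → Hoop w l r (L ++ R) → Last L x → First R y → Halves w l r L R x y
  halves {w} {l} {r} {L} {R} {x} {y} H lx fy = record
    { left = left′ ; right = right′
    ; x~y = subst₂ _~_ (Last-unique (Path.end left) lx) (First-unique (Path.start right) fy) mid~
    ; apart = apart
    ; cross = λ x∈ y∈ e → let p , q = cross x∈ y∈ e in
        trans p (Last-unique (Path.end left) lx) , trans q (First-unique (Path.start right) fy)
    ; w∉ = w∉p ; w~l = w~l ; w~r = w~r
    ; L~w = λ z∈ e → [ id , (λ { refl → contradiction (z∈ , Last⇒∈ (Path.end right)) apart }) ]′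
                       (w~⇒ (∈-++⁺ˡ z∈) (~-sym e))
    ; R~w = λ z∈ e → [ (λ { refl → contradiction (First⇒∈ (Path.start left) , z∈) apart }) , id ]′
                       (w~⇒ (∈-++⁺ʳ L z∈) (~-sym e))
    }
    where
    open Hoop H
    open Split (Path-split (proj₂ (∃First (Last⇒∈ lx))) fy path)
    left′ : Path l x L
    left′ = subst (λ z → Path l z L) (Last-unique (Path.end left) lx) left
    right′ : Path y r R
    right′ = subst (λ z → Path z r R) (First-unique (Path.start right) fy) right

  cut : ∀ {x y} → Hoop w l r J → x ∈ J → y ∈ J → x ~ y → ∃[ L ] ∃[ R ] L ++ R ≡ J ×
        (Halves w l r L R x y ⊎ Halves w l r L R y x)
  cut {w} {l} {r} {J} {x} {y} H x∈ y∈ e with Adj⇒split (Path.~⇒adj (Hoop.path H) x∈ y∈ e)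
  ... | J₁ , J₂ , inj₁ eq = J₁ ∷ʳ x , y ∷ J₂ , sym eq′ ,
        inj₁ (halves (subst (Hoop w l r) eq′ H) (Last-++ J₁ last) first)
    where eq′ = trans eq (sym (List.++-assoc J₁ (x ∷ []) (y ∷ J₂)))
  ... | J₁ , J₂ , inj₂ eq = J₁ ∷ʳ y , x ∷ J₂ , sym eq′ ,
        inj₂ (halves (subst (Hoop w l r) eq′ H) (Last-++ J₁ last) first)
    where eq′ = trans eq (sym (List.++-assoc J₁ (y ∷ []) (x ∷ J₂)))

  triangle : a ~ a′ → a ~ b → a′ ~ b → IsTriangle K (a ∷ a′ ∷ b ∷ [])
  triangle = pairwise₃ ~-sym

  private
    both : ∀ {p x y u v} → Path u v p → x ∈ p → y ∈ p → x ~ y → Adj p x y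
    both π = Path.~⇒adj π

    -- The triangle consists of `s` and the edge `aa′`; the arcs `L`, `R` and the path `Q` are each
    -- prolonged to the common endpoint `b`.
    stamp′ : C ↭ b ∷ L ++ R → Halves b l r L R a a′ → Path s t Q → Apart Q C →
             s ~ a → s ~ a′ → t ~ b →
             (∀ {q c} → q ∈ Q → c ∈ C → q ~ c → q ≡ s × (c ≡ a ⊎ c ≡ a′) ⊎ q ≡ t × c ≡ b) →
             Spans C Q → Stamp K
    stamp′ {C} {b} {L} {R} {l} {r} {a} {a′} {s} {t} {Q} C↭ H π apartQ s~a s~a′ t~b crossQ spans@(V⊆ , ⊆V) =
      (P₁ ∷ P₂ ∷ P₃ ∷ []) , (a ∷ a′ ∷ s ∷ []) , b ,
      triangle x~y (~-sym s~a) (~-sym s~a′) ,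
      (λ { (here eq) → b∉L (subst (_∈ L) (sym eq) a∈) ; (there (here eq)) → b∉R (subst (_∈ R) (sym eq) a′∈)
         ; (there (there (here eq))) → b∉Q (subst (_∈ Q) (sym eq) s∈) }) ,
      all₃ (isPath π₁ (⊆V ∘ in₁) , length₂ π₁ (λ { refl → b∉L a∈ }))
           (isPath π₂ (⊆V ∘ in₂) , length₂ π₂ (λ { refl → b∉R a′∈ }))
           (isPath π₃ (⊆V ∘ in₃) , length₂ π₃ (λ { refl → b∉Q s∈ })) ,
      pairwise₃ meet-sym (meet _ m₁ m₂ apart) (meet _ m₁ m₃ L#Q) (meet _ m₂ m₃ R#Q) ,
      all₃ (λ x x∈ x∈T → case m₁ x∈ ,′ x∈T of λ
             { (_ , here eq) → here eq
             ; (inj₁ (here refl) , there (here refl)) → contradiction a′∈ b∉R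
             ; (inj₂ x∈L , there (here refl)) → contradiction (x∈L , a′∈) apart
             ; (inj₁ (here refl) , there (there (here refl))) → contradiction s∈ b∉Q
             ; (inj₂ x∈L , there (there (here refl))) → contradiction (x∈L , s∈) L#Q })
           (λ x x∈ x∈T → case m₂ x∈ ,′ x∈T of λ
             { (_ , there (here eq)) → here eq
             ; (inj₁ (here refl) , here refl) → contradiction a∈ b∉L
             ; (inj₂ x∈R , here refl) → contradiction (a∈ , x∈R) apart
             ; (inj₁ (here refl) , there (there (here refl))) → contradiction s∈ b∉Q
             ; (inj₂ x∈R , there (there (here refl))) → contradiction (x∈R , s∈) R#Q })
           (λ x x∈ x∈T → case m₃ x∈ ,′ x∈T of λ
             { (_ , there (there (here eq))) → here eq
             ; (inj₁ (here refl) , here refl) → contradiction a∈ b∉L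
             ; (inj₂ x∈Q , here refl) → contradiction (a∈ , x∈Q) L#Q
             ; (inj₁ (here refl) , there (here refl)) → contradiction a′∈ b∉R
             ; (inj₂ x∈Q , there (here refl)) → contradiction (a′∈ , x∈Q) R#Q }) ,
      isUnion _
        (λ v∈ → case ∈-++⁻ C (V⊆ v∈) of λ
          { (inj₁ x∈) → case split x∈ of λ
            { (inj₁ refl) → there (here (∈-reverse⁺ {p = b ∷ L} (here refl)))
            ; (inj₂ (inj₁ x∈)) → there (here (∈-reverse⁺ (there x∈)))
            ; (inj₂ (inj₂ x∈)) → there (there (here (∈-++⁺ˡ x∈))) }
          ; (inj₂ x∈) → there (there (there (here (∈-++⁺ˡ x∈)))) })
        (unordered (Any.map Adj-sym)
          (λ x∈ y∈ e → case split x∈ ,′ split y∈ of λ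
            { (inj₁ refl , inj₁ refl) → contradiction e ~-irrefl
            ; (inj₁ refl , inj₂ (inj₁ y∈)) → on₁ (here refl) (there y∈) e
            ; (inj₁ refl , inj₂ (inj₂ y∈)) → on₂ (∈-++⁺ʳ R (here refl)) (∈-++⁺ˡ y∈) e
            ; (inj₂ (inj₁ x∈) , inj₁ refl) → on₁ (there x∈) (here refl) e
            ; (inj₂ (inj₂ x∈) , inj₁ refl) → on₂ (∈-++⁺ˡ x∈) (∈-++⁺ʳ R (here refl)) e
            ; (inj₂ (inj₁ x∈) , inj₂ (inj₁ y∈)) → on₁ (there x∈) (there y∈) e
            ; (inj₂ (inj₂ x∈) , inj₂ (inj₂ y∈)) → on₂ (∈-++⁺ˡ x∈) (∈-++⁺ˡ y∈) e
            ; (inj₂ (inj₁ x∈) , inj₂ (inj₂ y∈)) → case cross x∈ y∈ e of λ { (refl , refl) →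
                here (triangle-adj (here refl) (there (here refl)) (~⇒≢ e)) }
            ; (inj₂ (inj₂ x∈) , inj₂ (inj₁ y∈)) → case cross y∈ x∈ (~-sym e) of λ { (refl , refl) →
                here (triangle-adj (there (here refl)) (here refl) (~⇒≢ e)) } })
          (λ x∈ y∈ e → on₃ (∈-++⁺ˡ x∈) (∈-++⁺ˡ y∈) e)
          (λ x∈ y∈ e → case crossQ x∈ y∈ e of λ
            { (inj₁ (refl , inj₁ refl)) → here (triangle-adj (there (there (here refl))) (here refl) (~⇒≢ e))
            ; (inj₁ (refl , inj₂ refl)) →
                here (triangle-adj (there (there (here refl))) (there (here refl)) (~⇒≢ e))
            ; (inj₂ (refl , refl)) → on₃ (∈-++⁺ˡ x∈) (∈-++⁺ʳ Q (here refl)) e })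
          spans)
      where
      open Halves H
      a∈ = Last⇒∈ (Path.end left)
      a′∈ = First⇒∈ (Path.start right)
      s∈ = First⇒∈ (Path.start π)
      b∉L : b ∉ L
      b∉L = w∉ ∘ ∈-++⁺ˡ
      b∉R : b ∉ R
      b∉R = w∉ ∘ ∈-++⁺ʳ L
      ⊆C : ∀ {x} → x ∈ b ∷ L ++ R → x ∈ C
      ⊆C = ↭.∈-resp-↭ (↭-sym C↭)
      b∉Q : b ∉ Q
      b∉Q b∈ = apartQ (b∈ , ⊆C (here refl))
      L#Q : Apart L Q
      L#Q (x∈ , y∈) = apartQ (y∈ , ⊆C (there (∈-++⁺ˡ x∈)))
      R#Q : Apart R Q
      R#Q (x∈ , y∈) = apartQ (y∈ , ⊆C (there (∈-++⁺ʳ L x∈)))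
      split : ∀ {x} → x ∈ C → x ≡ b ⊎ x ∈ L ⊎ x ∈ R
      split x∈ with ↭.∈-resp-↭ C↭ x∈
      ... | here eq  = inj₁ eq
      ... | there x∈ = inj₂ (∈-++⁻ L x∈)
      P₁ = reverse (b ∷ L)
      P₂ = R ∷ʳ b
      P₃ = Q ∷ʳ b
      π₁ : Path a b P₁
      π₁ = Path-reverse (Path-∷ left w~l b∉L λ y∈ e → L~w y∈ (~-sym e))
      π₂ : Path a′ b P₂
      π₂ = Path-∷ʳ right (~-sym w~r) b∉R R~w
      π₃ : Path s b P₃
      π₃ = Path-∷ʳ π t~b b∉Q λ x∈ e → case crossQ x∈ (⊆C (here refl)) e of λ
        { (inj₁ (_ , inj₁ refl)) → contradiction a∈ b∉L
        ; (inj₁ (_ , inj₂ refl)) → contradiction a′∈ b∉R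
        ; (inj₂ (x≡t , _)) → x≡t }
      m₁ : ∀ {x} → x ∈ P₁ → x ∈ b ∷ [] ⊎ x ∈ L
      m₁ x∈ with ∈-reverse⁻ {p = b ∷ L} x∈
      ... | here eq  = inj₁ (here eq)
      ... | there x∈ = inj₂ x∈
      m₂ : ∀ {x} → x ∈ P₂ → x ∈ b ∷ [] ⊎ x ∈ R
      m₂ x∈ = Sum.swap (∈-++⁻ R x∈)
      m₃ : ∀ {x} → x ∈ P₃ → x ∈ b ∷ [] ⊎ x ∈ Q
      m₃ x∈ = Sum.swap (∈-++⁻ Q x∈)
      in₁ : ∀ {x} → x ∈ P₁ → x ∈ C ++ Q
      in₁ x∈ = [ (λ { (here refl) → ∈-++⁺ˡ (⊆C (here refl)) }) , ∈-++⁺ˡ ∘ ⊆C ∘ there ∘ ∈-++⁺ˡ ]′ (m₁ x∈)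
      in₂ : ∀ {x} → x ∈ P₂ → x ∈ C ++ Q
      in₂ x∈ = [ (λ { (here refl) → ∈-++⁺ˡ (⊆C (here refl)) }) , ∈-++⁺ˡ ∘ ⊆C ∘ there ∘ ∈-++⁺ʳ L ]′ (m₂ x∈)
      in₃ : ∀ {x} → x ∈ P₃ → x ∈ C ++ Q
      in₃ x∈ = [ (λ { (here refl) → ∈-++⁺ˡ (⊆C (here refl)) }) , ∈-++⁺ʳ C ]′ (m₃ x∈)
      Ws = close (a ∷ a′ ∷ s ∷ []) ∷ P₁ ∷ P₂ ∷ P₃ ∷ []
      on₁ : ∀ {x y} → x ∈ b ∷ L → y ∈ b ∷ L → x ~ y → Any (λ p → Adj p x y) Ws
      on₁ x∈ y∈ e = there (here (both π₁ (∈-reverse⁺ x∈) (∈-reverse⁺ y∈) e))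
      on₂ : ∀ {x y} → x ∈ P₂ → y ∈ P₂ → x ~ y → Any (λ p → Adj p x y) Ws
      on₂ x∈ y∈ e = there (there (here (both π₂ x∈ y∈ e)))
      on₃ : ∀ {x y} → x ∈ P₃ → y ∈ P₃ → x ~ y → Any (λ p → Adj p x y) Ws
      on₃ x∈ y∈ e = there (there (there (here (both π₃ x∈ y∈ e))))

    -- The triangles are `a′ a s` and `b b′ t`. The arc `L` runs from `a′` to `b`, the arc `R` with
    -- `a` attached joins `a` to `b′`, and `Q` joins `s` to `t`.
    prism′ : C ↭ a ∷ L ++ R → Halves a a′ r L R b b′ → Path s t Q → Apart Q C →
             s ~ a → s ~ a′ → t ~ b → t ~ b′ → a′ ≢ b → a ≢ b → a ≢ b′ → s ≢ t →
             (∀ {q c} → q ∈ Q → c ∈ C → q ~ c →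
               q ≡ s × (c ≡ a ⊎ c ≡ a′) ⊎ q ≡ t × (c ≡ b ⊎ c ≡ b′)) →
             Spans C Q → Prism K
    prism′ {C} {a} {L} {R} {a′} {r} {b} {b′} {s} {t} {Q} C↭ H π apartQ s~a s~a′ t~b t~b′
      a′≢b a≢b a≢b′ s≢t crossQ spans@(V⊆ , ⊆V) =
      (L ∷ P₂ ∷ Q ∷ []) , (a′ ∷ a ∷ s ∷ []) , (b ∷ b′ ∷ t ∷ []) ,
      triangle (~-sym w~l) (~-sym s~a′) (~-sym s~a) , triangle x~y (~-sym t~b) (~-sym t~b′) ,
      (λ { x (here refl) (here refl) → contradiction refl a′≢b
         ; x (here refl) (there (here refl)) → contradiction (a′∈ , b′∈) apart
         ; x (here refl) (there (there (here refl))) → contradiction (a′∈ , t∈) L#Q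
         ; x (there (here refl)) (here refl) → contradiction refl a≢b
         ; x (there (here refl)) (there (here refl)) → contradiction refl a≢b′
         ; x (there (here refl)) (there (there (here refl))) → contradiction t∈ a∉Q
         ; x (there (there (here refl))) (here refl) → contradiction (b∈ , s∈) L#Q
         ; x (there (there (here refl))) (there (here refl)) → contradiction (b′∈ , s∈) R#Q
         ; x (there (there (here refl))) (there (there (here refl))) → contradiction refl s≢t }) ,
      all₃ (isPath left (⊆V ∘ in₁)) (isPath π₂ (⊆V ∘ in₂)) (isPath π (⊆V ∘ ∈-++⁺ʳ C)) ,
      pairwise₃ meet-sym
        (λ x x∈L x∈P₂ → case m₂ x∈P₂ of λ
          { (inj₁ refl) → contradiction x∈L a∉L ; (inj₂ x∈R) → contradiction (x∈L , x∈R) apart })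
        (λ x x∈L x∈Q → contradiction (x∈L , x∈Q) L#Q)
        (λ x x∈P₂ x∈Q → case m₂ x∈P₂ of λ
          { (inj₁ refl) → contradiction x∈Q a∉Q ; (inj₂ x∈R) → contradiction (x∈R , x∈Q) R#Q }) ,
      isUnion _
        (λ v∈ → case ∈-++⁻ C (V⊆ v∈) of λ
          { (inj₁ x∈) → case split x∈ of λ
            { (inj₁ refl) → there (there (there (here (∈-reverse⁺ (∈-++⁺ʳ R (here refl))))))
            ; (inj₂ (inj₁ x∈)) → there (there (here x∈))
            ; (inj₂ (inj₂ x∈)) → there (there (there (here (∈-reverse⁺ (∈-++⁺ˡ x∈))))) }
          ; (inj₂ x∈) → there (there (there (there (here x∈)))) })
        (unordered (Any.map Adj-sym)
          (λ x∈ y∈ e → case split x∈ ,′ split y∈ of λ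
            { (inj₁ refl , inj₁ refl) → contradiction e ~-irrefl
            ; (inj₁ refl , inj₂ (inj₁ y∈)) → case L~w y∈ (~-sym e) of λ { refl →
                here (triangle-adj (there (here refl)) (here refl) (~⇒≢ e)) }
            ; (inj₁ refl , inj₂ (inj₂ y∈)) → on₂ (∈-++⁺ʳ R (here refl)) (∈-++⁺ˡ y∈) e
            ; (inj₂ (inj₁ x∈) , inj₁ refl) → case L~w x∈ e of λ { refl →
                here (triangle-adj (here refl) (there (here refl)) (~⇒≢ e)) }
            ; (inj₂ (inj₂ x∈) , inj₁ refl) → on₂ (∈-++⁺ˡ x∈) (∈-++⁺ʳ R (here refl)) e
            ; (inj₂ (inj₁ x∈) , inj₂ (inj₁ y∈)) → there (there (here (both left x∈ y∈ e)))
            ; (inj₂ (inj₂ x∈) , inj₂ (inj₂ y∈)) → on₂ (∈-++⁺ˡ x∈) (∈-++⁺ˡ y∈) e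
            ; (inj₂ (inj₁ x∈) , inj₂ (inj₂ y∈)) → case cross x∈ y∈ e of λ { (refl , refl) →
                there (here (triangle-adj (here refl) (there (here refl)) (~⇒≢ e))) }
            ; (inj₂ (inj₂ x∈) , inj₂ (inj₁ y∈)) → case cross y∈ x∈ (~-sym e) of λ { (refl , refl) →
                there (here (triangle-adj (there (here refl)) (here refl) (~⇒≢ e))) } })
          (λ x∈ y∈ e → there (there (there (there (here (both π x∈ y∈ e))))))
          (λ x∈ y∈ e → case crossQ x∈ y∈ e of λ
            { (inj₁ (refl , inj₁ refl)) →
                here (triangle-adj (there (there (here refl))) (there (here refl)) (~⇒≢ e))
            ; (inj₁ (refl , inj₂ refl)) → here (triangle-adj (there (there (here refl))) (here refl) (~⇒≢ e))
            ; (inj₂ (refl , inj₁ refl)) →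
                there (here (triangle-adj (there (there (here refl))) (here refl) (~⇒≢ e)))
            ; (inj₂ (refl , inj₂ refl)) →
                there (here (triangle-adj (there (there (here refl))) (there (here refl)) (~⇒≢ e))) })
          spans)
      where
      open Halves H
      b∈ = Last⇒∈ (Path.end left)
      b′∈ = First⇒∈ (Path.start right)
      a′∈ = First⇒∈ (Path.start left)
      s∈ = First⇒∈ (Path.start π)
      t∈ = Last⇒∈ (Path.end π)
      a∉L : a ∉ L
      a∉L = w∉ ∘ ∈-++⁺ˡ
      ⊆C : ∀ {x} → x ∈ a ∷ L ++ R → x ∈ C
      ⊆C = ↭.∈-resp-↭ (↭-sym C↭)
      a∉Q : a ∉ Q
      a∉Q a∈ = apartQ (a∈ , ⊆C (here refl))
      L#Q : Apart L Q
      L#Q (x∈ , y∈) = apartQ (y∈ , ⊆C (there (∈-++⁺ˡ x∈)))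
      R#Q : Apart R Q
      R#Q (x∈ , y∈) = apartQ (y∈ , ⊆C (there (∈-++⁺ʳ L x∈)))
      split : ∀ {x} → x ∈ C → x ≡ a ⊎ x ∈ L ⊎ x ∈ R
      split x∈ with ↭.∈-resp-↭ C↭ x∈
      ... | here eq  = inj₁ eq
      ... | there x∈ = inj₂ (∈-++⁻ L x∈)
      P₂ = reverse (R ∷ʳ a)
      π₂ : Path a b′ P₂
      π₂ = Path-reverse (Path-∷ʳ right (~-sym w~r) (w∉ ∘ ∈-++⁺ʳ L) R~w)
      m₂ : ∀ {x} → x ∈ P₂ → x ≡ a ⊎ x ∈ R
      m₂ x∈ with ∈-++⁻ R (∈-reverse⁻ x∈)
      ... | inj₁ x∈        = inj₂ x∈
      ... | inj₂ (here eq) = inj₁ eq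
      in₁ : ∀ {x} → x ∈ L → x ∈ C ++ Q
      in₁ = ∈-++⁺ˡ ∘ ⊆C ∘ there ∘ ∈-++⁺ˡ
      in₂ : ∀ {x} → x ∈ P₂ → x ∈ C ++ Q
      in₂ x∈ = [ (λ { refl → ∈-++⁺ˡ (⊆C (here refl)) }) , ∈-++⁺ˡ ∘ ⊆C ∘ there ∘ ∈-++⁺ʳ L ]′ (m₂ x∈)
      Ws = close (a′ ∷ a ∷ s ∷ []) ∷ close (b ∷ b′ ∷ t ∷ []) ∷ L ∷ P₂ ∷ Q ∷ []
      on₂ : ∀ {x y} → x ∈ R ∷ʳ a → y ∈ R ∷ʳ a → x ~ y → Any (λ p → Adj p x y) Ws
      on₂ x∈ y∈ e = there (there (there (here (both π₂ (∈-reverse⁺ x∈) (∈-reverse⁺ y∈) e))))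

  stamp : Cyc C → Path s t Q → Apart Q C → a ∈ C → a′ ∈ C → b ∈ C → a ~ a′ → b ≢ a → b ≢ a′ →
          s ~ a → s ~ a′ → t ~ b →
          (∀ {q c} → q ∈ Q → c ∈ C → q ~ c → q ≡ s × (c ≡ a ⊎ c ≡ a′) ⊎ q ≡ t × c ≡ b) →
          Spans C Q → Stamp K
  stamp cyc π apartQ a∈ a′∈ b∈ a~a′ b≢a b≢a′ s~a s~a′ t~b cross spans with hoopAt cyc b∈
  ... | J , l , r , C↭ , H with cut H (inJ a∈ b≢a) (inJ a′∈ b≢a′) a~a′
    where
    inJ : ∀ {x} → x ∈ _ → _ ≢ x → x ∈ J
    inJ x∈ b≢x with ↭.∈-resp-↭ C↭ x∈
    ... | here refl = contradiction refl b≢x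
    ... | there x∈J = x∈J
  ...   | L , R , refl , inj₁ h = stamp′ C↭ h π apartQ s~a s~a′ t~b cross spans
  ...   | L , R , refl , inj₂ h = stamp′ C↭ h π apartQ s~a′ s~a t~b
          (λ q∈ c∈ e → Sum.map₁ (λ (p , q) → p , Sum.swap q) (cross q∈ c∈ e)) spans

  prism : Cyc C → Path s t Q → Apart Q C → a ∈ C → a′ ∈ C → b ∈ C → b′ ∈ C → a ~ a′ → b ~ b′ →
          a ≢ b → a ≢ b′ → a′ ≢ b → a′ ≢ b′ → s ≢ t →
          s ~ a → s ~ a′ → t ~ b → t ~ b′ →
          (∀ {q c} → q ∈ Q → c ∈ C → q ~ c →
            q ≡ s × (c ≡ a ⊎ c ≡ a′) ⊎ q ≡ t × (c ≡ b ⊎ c ≡ b′)) →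
          Spans C Q → Prism K
  prism {C} {s} {t} {Q} {a} {a′} {b} {b′} cyc π apartQ a∈ a′∈ b∈ b′∈ a~a′ b~b′ a≢b a≢b′ a′≢b a′≢b′ s≢t
    s~a s~a′ t~b t~b′ cross spans with hoopAt cyc a∈
  -- The cycle is oriented so that `a′` comes right after `a`; the order of `b` and `b′` is then
  -- settled by `cut`.
  ... | J , l , r , C↭ , H = case Hoop.w~⇒ H (inJ a′∈ (~⇒≢ a~a′)) a~a′ of λ
    { (inj₁ refl) → go C↭ H (inJ b∈ a≢b) (inJ b′∈ a≢b′)
    ; (inj₂ refl) → go (↭-trans C↭ (prep a (↭-sym (↭.↭-reverse J)))) (hoop-reverse H)
        (∈-reverse⁺ (inJ b∈ a≢b)) (∈-reverse⁺ (inJ b′∈ a≢b′))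
    }
    where
    inJ : ∀ {x} → x ∈ C → a ≢ x → x ∈ J
    inJ x∈ a≢x with ↭.∈-resp-↭ C↭ x∈
    ... | here refl = contradiction refl a≢x
    ... | there x∈J = x∈J
    go : ∀ {r J} → C ↭ a ∷ J → Hoop a a′ r J → b ∈ J → b′ ∈ J → Prism K
    go C↭ H b∈ b′∈ with cut H b∈ b′∈ b~b′
    ... | L , R , refl , inj₁ h = prism′ C↭ h π apartQ s~a s~a′ t~b t~b′ a′≢b a≢b a≢b′ s≢t cross spans
    ... | L , R , refl , inj₂ h = prism′ C↭ h π apartQ s~a s~a′ t~b′ t~b a′≢b′ a≢b′ a≢b s≢t
          (λ q∈ c∈ e → Sum.map₂ (λ (p , q) → p , Sum.swap q) (cross q∈ c∈ e)) spans

  private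
    -- Three neighbours on the cycle give a pyramid. Exactly two, not adjacent, give a trihedron
    -- with `s` as the middle of its third path.
    alone : Ear K C Q s s → Spread K (Nbr K s C) → Spans C Q → SolidGraph K
    alone {C} {Q} {s} E sp spans = from-spread sp
      where
      open Ear E
      Q≡ : Q ≡ s ∷ []
      Q≡ with Path.start path | Path.end path
      ... | first | last    = refl
      ... | first | there m = contradiction (Last⇒∈ m) (Unique-head (Path.unique path))
      s∉C : s ∉ C
      s∉C s∈ = apart (First⇒∈ (Path.start path) , s∈)
      spans′ : Spans C (s ∷ [])
      spans′ = subst (Spans C) Q≡ spans
      inner′ : ∀ {q c} → q ∈ Q → c ∈ C → q ~ c → q ≡ s
      inner′ q∈ c∈ e = [ id , id ]′ (inner q∈ c∈ e)
      from-spread : Spread K (Nbr K s C) → SolidGraph K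
      from-spread (three nx ny nz x≢y x≢z y≢z) =
        inj₁ (pyramid cyc s∉C spans′ nx ny nz x≢y x≢z y≢z)
      from-spread (far {x} {y} nx ny x≢y x≁y)
        with any? (λ z → nbr? K s C z ×-dec ¬? (x ≟ z) ×-dec ¬? (y ≟ z))
      ... | yes (z , nz , x≢z , y≢z) = inj₁ (pyramid cyc s∉C spans′ nx ny nz x≢y x≢z y≢z)
      ... | no none = inj₂ (inj₁ (trihedron cyc path apart (Nbr.∈C nx) (Nbr.∈C ny) x≢y x≁y
              (Nbr.s~ nx) (Nbr.s~ ny) cross spans))
        where
        cross : ∀ {q c} → q ∈ Q → c ∈ C → q ~ c → q ≡ s × c ≡ x ⊎ q ≡ s × c ≡ y
        cross {c = c} q∈ c∈ e with inner′ q∈ c∈ e | x ≟ c | y ≟ c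
        ... | refl | yes refl | _        = inj₁ (refl , refl)
        ... | refl | no _     | yes refl = inj₂ (refl , refl)
        ... | refl | no x≢c   | no y≢c   = contradiction (c , nbr c∈ e , x≢c , y≢c) none

  -- When the ends differ, each sees one vertex or one edge of the cycle. Two vertices give a
  -- trihedron, a vertex and an edge a stamp, two disjoint edges a prism, and two edges that share a
  -- vertex a wheel around it. Further coincidences are ruled out by the spread of the union.
  ear⇒solid : Ear K C Q s t → Spans C Q → SolidGraph K
  ear⇒solid {C} {Q} {s} {t} E spans = go ends
    where
    open Ear E
    A = Nbr K s C
    B = Nbr K t C
    other : ∀ (P : Fin N → Set) → Decidable P → ∀ {a} → ¬ Spread K P → P a →
            (∃[ a′ ] P a′ × a ≢ a′ × a ~ a′ × (∀ {x} → P x → x ≡ a ⊎ x ≡ a′)) ⊎ (∀ {x} → P x → x ≡ a)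
    other P P? {a} ¬sp pa with any? (λ x → P? x ×-dec ¬? (a ≟ x))
    ... | yes (a′ , pa′ , a≢a′) =
      inj₁ (a′ , pa′ , a≢a′ , ¬spread⇒~ K ¬sp pa pa′ a≢a′ , ¬spread⇒pair K ¬sp pa pa′ a≢a′)
    ... | no none = inj₂ λ {x} px → case a ≟ x of λ
      { (yes a≡x) → sym a≡x ; (no a≢x) → contradiction (x , px , a≢x) none }
    cross : ∀ {q c} → q ∈ Q → c ∈ C → q ~ c → q ≡ s × A c ⊎ q ≡ t × B c
    cross q∈ c∈ e with inner q∈ c∈ e
    ... | inj₁ refl = inj₁ (refl , nbr c∈ e)
    ... | inj₂ refl = inj₂ (refl , nbr c∈ e)
    -- Here `m` is seen by both ends of the path, and its neighbours `a` and `b` on the cycle by one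
    -- end each; the path can thus replace `m`.
    wheel : ∀ {m a b} → A m → B m → A a → B b → m ~ a → m ~ b → a ≢ b →
            (∀ {x} → A x → x ≡ m ⊎ x ≡ a) → (∀ {x} → B x → x ≡ m ⊎ x ≡ b) → SolidGraph K
    wheel {m} {a} {b} Am Bm Aa Bb m~a m~b a≢b onlyA onlyB =
      let C′ , E′ , perm = bypass cyc (Nbr.∈C Am) (Nbr.∈C Aa) (Nbr.∈C Bb) m~a m~b a≢b path apart
            (Nbr.s~ Aa) (Nbr.s~ Bb)
            (λ q∈ y∈ y≢m e → Sum.map
              (λ (q≡s , n) → q≡s , [ (λ y≡m → contradiction y≡m y≢m) , id ]′ (onlyA n))
              (λ (q≡t , n) → q≡t , [ (λ y≡m → contradiction y≡m y≢m) , id ]′ (onlyB n)) (cross q∈ y∈ e))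
            (s , First⇒∈ (Path.start path) , ~-sym (Nbr.s~ Am))
      in alone-ends E′ (↭.∈-resp-↭ (↭-sym perm) ∘ proj₁ spans , proj₂ spans ∘ ↭.∈-resp-↭ perm) (Ear.ends E′)
      where
      alone-ends : ∀ {C′ m} → Ear K C′ (m ∷ []) m m → Spans C′ (m ∷ []) →
                   Ends K m m (Nbr K m C′) (Nbr K m C′) → SolidGraph K
      alone-ends E′ spans′ (single _ sp)              = alone E′ sp spans′
      alone-ends E′ spans′ (double m≢m _ _ _ _ _) = contradiction refl m≢m
    go : Ends K s t A B → SolidGraph K
    go (single refl sp) = alone E sp spans
    go (double s≢t (a , na) ¬a (b , nb) ¬b sp)
      with other A (nbr? K s C) ¬a na | other B (nbr? K t C) ¬b nb
    ... | inj₂ onlyA | inj₂ onlyB =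
      inj₂ (inj₁ (trihedron cyc path apart (Nbr.∈C na) (Nbr.∈C nb)
        (λ { refl → one⇒¬spread K [ onlyA , onlyB ]′ sp })
        (λ a~b → pair⇒¬spread K a~b [ inj₁ ∘ onlyA , inj₂ ∘ onlyB ]′ sp)
        (Nbr.s~ na) (Nbr.s~ nb)
        (λ q∈ c∈ e → Sum.map (λ (p , n) → p , onlyA n) (λ (p , n) → p , onlyB n) (cross q∈ c∈ e)) spans))
    ... | inj₁ (a′ , na′ , a≢a′ , a~a′ , onlyA) | inj₂ onlyB =
      inj₂ (inj₂ (inj₁ (stamp cyc path apart (Nbr.∈C na) (Nbr.∈C na′) (Nbr.∈C nb) a~a′
        (λ { refl → pair⇒¬spread K a~a′ [ onlyA , inj₁ ∘ onlyB ]′ sp })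
        (λ { refl → pair⇒¬spread K a~a′ [ onlyA , inj₂ ∘ onlyB ]′ sp })
        (Nbr.s~ na) (Nbr.s~ na′) (Nbr.s~ nb)
        (λ q∈ c∈ e → Sum.map (λ (p , n) → p , onlyA n) (λ (p , n) → p , onlyB n) (cross q∈ c∈ e)) spans)))
    ... | inj₂ onlyA | inj₁ (b′ , nb′ , b≢b′ , b~b′ , onlyB) =
      inj₂ (inj₂ (inj₁ (stamp cyc (Path-reverse path) (λ (x∈ , y∈) → apart (∈-reverse⁻ x∈ , y∈))
        (Nbr.∈C nb) (Nbr.∈C nb′) (Nbr.∈C na) b~b′
        (λ { refl → pair⇒¬spread K b~b′ [ inj₁ ∘ onlyA , onlyB ]′ sp })
        (λ { refl → pair⇒¬spread K b~b′ [ inj₂ ∘ onlyA , onlyB ]′ sp })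
        (Nbr.s~ nb) (Nbr.s~ nb′) (Nbr.s~ na)
        (λ q∈ c∈ e → Sum.swap (Sum.map (λ (p , n) → p , onlyA n) (λ (p , n) → p , onlyB n)
          (cross (∈-reverse⁻ q∈) c∈ e)))
        ((λ x∈ → ↭.∈-resp-↭ (↭.++⁺ˡ C (↭-sym (↭.↭-reverse Q))) (proj₁ spans x∈)) ,
         (λ x∈ → proj₂ spans (↭.∈-resp-↭ (↭.++⁺ˡ C (↭.↭-reverse Q)) x∈))))))
    ... | inj₁ (a′ , na′ , a≢a′ , a~a′ , onlyA) | inj₁ (b′ , nb′ , b≢b′ , b~b′ , onlyB)
      with a ≟ b | a ≟ b′ | a′ ≟ b | a′ ≟ b′
    ... | yes refl | _ | _ | _ = wheel na nb na′ nb′ a~a′ b~b′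
            (λ { refl → pair⇒¬spread K a~a′ [ onlyA , onlyB ]′ sp }) onlyA onlyB
    ... | no _ | yes refl | _ | _ = wheel na nb′ na′ nb a~a′ (~-sym b~b′)
            (λ { refl → pair⇒¬spread K a~a′ [ onlyA , Sum.swap ∘ onlyB ]′ sp }) onlyA (Sum.swap ∘ onlyB)
    ... | no a≢b | no _ | yes refl | _ = wheel na′ nb na nb′ (~-sym a~a′) b~b′
            (λ { refl → pair⇒¬spread K a~a′ [ onlyA , Sum.swap ∘ onlyB ]′ sp }) (Sum.swap ∘ onlyA) onlyB
    ... | no a≢b | no _ | no _ | yes refl = wheel na′ nb′ na nb (~-sym a~a′) (~-sym b~b′)
            a≢b (Sum.swap ∘ onlyA) (Sum.swap ∘ onlyB)
    ... | no a≢b | no a≢b′ | no a′≢b | no a′≢b′ =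
      inj₂ (inj₂ (inj₂ (prism cyc path apart (Nbr.∈C na) (Nbr.∈C na′) (Nbr.∈C nb) (Nbr.∈C nb′) a~a′ b~b′
        a≢b a≢b′ a′≢b a′≢b′ s≢t (Nbr.s~ na) (Nbr.s~ na′) (Nbr.s~ nb) (Nbr.s~ nb′)
        (λ q∈ c∈ e → Sum.map (λ (p , n) → p , onlyA n) (λ (p , n) → p , onlyB n) (cross q∈ c∈ e)) spans)))

-- From solids to ears

any-lookup : ∀ {A : Set} {P : A → Set} {n} (v : Vec A n) → Any P (toList v) → ∃[ i ] P (lookup v i)
any-lookup (_ ∷ _) (here p)  = zero , p
any-lookup (_ ∷ v) (there p) = let i , q = any-lookup v p in suc i , q

lookup∈ : ∀ {A : Set} {n} (v : Vec A n) i → lookup v i ∈ toList v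
lookup∈ (_ ∷ _) zero    = here refl
lookup∈ (_ ∷ v) (suc i) = there (lookup∈ v i)

others : (i : Fin 3) → ∃[ j ] ∃[ k ] i ≢ j × i ≢ k × j ≢ k × (∀ m → m ≡ i ⊎ m ≡ j ⊎ m ≡ k)
others zero = suc zero , suc (suc zero) , (λ ()) , (λ ()) , (λ ()) ,
  all₃ (inj₁ refl) (inj₂ (inj₁ refl)) (inj₂ (inj₂ refl))
others (suc zero) = zero , suc (suc zero) , (λ ()) , (λ ()) , (λ ()) ,
  all₃ (inj₂ (inj₁ refl)) (inj₁ refl) (inj₂ (inj₂ refl))
others (suc (suc zero)) = zero , suc zero , (λ ()) , (λ ()) , (λ ()) ,
  all₃ (inj₂ (inj₁ refl)) (inj₂ (inj₂ refl)) (inj₁ refl)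

module Decompose {N : ℕ} (K : Graph N) where

  open Graph K using (_~_; _~?_; ~-sym; ~-irrefl; ~⇒∈V) renaming (V to VK)
  open Induced K
  open Recognise K using (Spans)

  private
    variable
      a b s t w x y : Fin N
      C Q p : Walk N

  IsPath⇒Path : IsPath K a b p → (∀ {x y} → x ∈ p → y ∈ p → x ~ y → Adj p x y) → Path a b p
  IsPath⇒Path {p = p} (h , l , u , _ , lk) step = record
    { unique = u ; start = head⇒First h ; end = last⇒Last p l
    ; adj⇒~ = Linked⇒Adj ~-sym lk ; ~⇒adj = step }

  covered : ∀ {ws} → IsUnionOf K ws → x ~ y → Any (λ p → Adj p x y) ws
  covered (_ , es) e = Any.map steps⇒Adj± (es _ _ e)

  SolidEar : Fin N → Set
  SolidEar w = ∃[ C ] ∃[ Q ] ∃[ s ] ∃[ t ] Ear K C Q s t × Placed K w C Q s t × Spans C Q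

  Spans-reverse : Spans C Q → Spans C (reverse Q)
  Spans-reverse {C} {Q} (V⊆ , ⊆V) =
    (λ x∈ → ↭.∈-resp-↭ (↭.++⁺ˡ C (↭-sym (↭.↭-reverse Q))) (V⊆ x∈)) ,
    (λ x∈ → ⊆V (↭.∈-resp-↭ (↭.++⁺ˡ C (↭.↭-reverse Q)) x∈))

  pyramid⇒ear : Pyramid K → w ∈ˢ VK → SolidEar w
  pyramid⇒ear {w} (c , h , (long , u , lk) , h∉c , three≤ , U) w∈V =
    c , h ∷ [] , h , h , record
      { cyc = cyc ; path = Path-[] ; apart = λ { (here refl , x∈) → h∉c x∈ }
      ; inner = λ { (here eq) _ _ → inj₁ eq }
      ; ends = single refl (spread (nbrsIn K h c) (Unique.filter⁺ (h ~?_) u) three≤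
          λ x∈ → let x∈c , e = ∈-filter⁻ (h ~?_) x∈ in nbr x∈c e)
      } , placed (V⊆ w∈V) , V⊆ , ⊆V
    where
    not-spoke : ∀ {x y z} → x ∈ c → y ∈ c → ¬ Adj (h ∷ z ∷ []) x y
    not-spoke x∈ y∈ here               = h∉c x∈
    not-spoke x∈ y∈ ereh               = h∉c y∈
    not-spoke x∈ y∈ (there (there ()))
    cyc : Cyc c
    cyc = record
      { long = long ; unique = u ; adj⇒~ = Linked⇒Adj ~-sym lk
      ; ~⇒adj = λ x∈ y∈ e → case covered U e of λ
        { (here a) → a
        ; (there m) → let _ , _ , a = find (Any.map⁻ m) in contradiction a (not-spoke x∈ y∈) } }
    spread : ∀ L → Unique L → 3 ℕ.≤ length L → (∀ {x} → x ∈ L → Nbr K h c x) → Spread K (Nbr K h c)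
    spread (_ ∷ _ ∷ _ ∷ _) ((x≢y ∷ x≢z ∷ _) ∷ (y≢z ∷ _) ∷ _) _ f =
      three (f (here refl)) (f (there (here refl))) (f (there (there (here refl)))) x≢y x≢z y≢z
    spread []          _ () _
    spread (_ ∷ [])    _ (s≤s ()) _
    spread (_ ∷ _ ∷ []) _ (s≤s (s≤s ())) _
    V⊆ : ∀ {x} → x ∈ˢ VK → x ∈ c ++ h ∷ []
    V⊆ x∈ with proj₁ U _ x∈
    ... | here x∈c = ∈-++⁺ˡ (close-∈ c x∈c)
    ... | there m with find (Any.map⁻ m)
    ...   | _ , _  , here refl         = ∈-++⁺ʳ c (here refl)
    ...   | _ , z∈ , there (here refl) = ∈-++⁺ˡ (proj₁ (∈-filter⁻ (h ~?_) {xs = c} z∈))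
    ⊆V : ∀ {x} → x ∈ c ++ h ∷ [] → x ∈ˢ VK
    ⊆V x∈ with ∈-++⁻ c x∈
    ... | inj₁ x∈c = let _ , _ , _ , _ , _ , x~y , _ = cycle-nbrs cyc x∈c in ~⇒∈V x~y
    ... | inj₂ (here refl) = hub (nbrsIn K h c) three≤ λ x∈ → ~⇒∈V (proj₂ (∈-filter⁻ (h ~?_) {xs = c} x∈))
      where
      hub : ∀ L → 3 ℕ.≤ length L → (∀ {x} → x ∈ L → h ∈ˢ VK) → h ∈ˢ VK
      hub []      () _
      hub (_ ∷ _) _  f = f (here refl)
    placed : w ∈ c ++ h ∷ [] → Placed K w c (h ∷ []) h h
    placed w∈ with ∈-++⁻ c w∈
    ... | inj₁ w∈c = inj₂ (w∈c , inj₁ refl)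
    ... | inj₂ w∈h = inj₁ w∈h

  record Inner (b : Fin N) (p I : Walk N) (s t : Fin N) : Set where
    field
      p≡   : p ≡ I ∷ʳ b
      path : Path s t I
      t~b  : t ~ b
      b∉   : b ∉ I
      ~b   : ∀ {y} → y ∈ I → y ~ b → y ≡ t

  unsnoc : Last p b → ∃[ I ] p ≡ I ∷ʳ b
  unsnoc last      = [] , refl
  unsnoc (there l) = let I , eq = unsnoc l in _ ∷ I , cong (_ ∷_) eq

  drop-end : Path a b p → a ≢ b → ∃[ I ] ∃[ t ] Inner b p I a t
  drop-end {a} {b} π a≢b with unsnoc (Path.end π)
  ... | [] , refl with Path.start π
  ...   | first = contradiction refl a≢b
  drop-end {a} {b} π a≢b | I@(_ ∷ _) , refl = I , mid₁ , record
    { p≡ = refl ; path = left ; t~b = subst (mid₁ ~_) (sym b≡) mid~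
    ; b∉ = λ b∈ → apart (b∈ , here refl) ; ~b = λ y∈ e → proj₁ (cross y∈ (here refl) e) }
    where
    open Split (Path-split {p = I} {q = b ∷ []} first first π)
    b≡ : b ≡ mid₂
    b≡ with Path.start right
    ... | first = refl

  module _ {P : Vec (Walk N) 3} {a b : Fin N} (a≢b : a ≢ b)
    (isP : ∀ i → IsPath K a b (lookup P i) × 2 ℕ.≤ walkLength (lookup P i))
    (meet : ∀ i j → i ≢ j → MeetOnlyIn (lookup P i) (lookup P j) (a ∷ b ∷ []))
    (U : IsUnionOf K (toList P)) where

    private
      edge : x ~ y → ∃[ m ] Adj (lookup P m) x y
      edge e = any-lookup P (covered U e)

      not-adjacent : ∀ {m} → ¬ Adj (lookup P m) a b
      not-adjacent {m} adj with lookup P m | isP m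
      ... | p | (h , l , u , _) , long with head⇒First {p = p} h
      ...   | first with Adj-head⁻ (Unique-head u) adj
      ...     | first with last⇒Last p l | long
      ...       | there last      | s≤s ()
      not-adjacent {m} adj | _ | (_ , _ , _ ∷ u , _) , _ | first | first | there (there k) | _ =
        Unique-head u (Last⇒∈ k)

      a≁b : ¬ a ~ b
      a≁b e = let _ , adj = edge e in not-adjacent adj

      -- The paths are induced: an edge between two vertices of one path that belongs to another
      -- path would have both ends in common to the two, hence be `ab`, but no path has `ab` as a
      -- step.
      path₀ : ∀ i → Path a b (lookup P i)
      path₀ i = IsPath⇒Path (proj₁ (isP i)) λ x∈ y∈ e → case edge e of λ (m , adj) →
        case m ≟ i of λ
          { (yes refl) → adj
          ; (no m≢i) → case meet m i m≢i _ (Adj⇒∈ adj) x∈ ,′ meet m i m≢i _ (Adj⇒∈ʳ adj) y∈ of λ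
            { (here refl , here refl) → contradiction e ~-irrefl
            ; (there (here refl) , there (here refl)) → contradiction e ~-irrefl
            ; (here refl , there (here refl)) → contradiction e a≁b
            ; (there (here refl) , here refl) → contradiction (~-sym e) a≁b } }

      record Inside (p I : Walk N) (s t : Fin N) : Set where
        field
          p≡   : p ≡ a ∷ I ∷ʳ b
          path : Path s t I
          a~s  : a ~ s
          t~b  : t ~ b
          a∉   : a ∉ I
          b∉   : b ∉ I
          a~   : ∀ {y} → y ∈ I → a ~ y → y ≡ s
          ~b   : ∀ {y} → y ∈ I → y ~ b → y ≡ t

      strip : ∀ {p} → Path a b p → ∃[ I ] ∃[ s ] ∃[ t ] Inside p I s t
      strip π with drop-end π a≢b
      ... | I′ , t , record { p≡ = refl ; path = π′ ; t~b = t~b ; b∉ = b∉ ; ~b = ~b } =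
        cut-start I′ π′ t~b b∉ ~b
        where
        cut-start : ∀ I′ → Path a t I′ → t ~ b → b ∉ I′ → (∀ {y} → y ∈ I′ → y ~ b → y ≡ t) →
                    ∃[ I ] ∃[ s ] ∃[ t ] Inside (I′ ∷ʳ b) I s t
        cut-start I′ π′ t~b b∉ ~b with Path.start π′ | Path.end π′
        ... | first | last = contradiction t~b a≁b
        ... | first {p = s ∷ I} | there _ =
          let _ , a~s , π″ , a~ = Path-tail π′ in
          s ∷ I , s , t , record
            { p≡ = refl ; path = π″ ; a~s = a~s ; t~b = t~b
            ; a∉ = Unique-head (Path.unique π′) ; b∉ = b∉ ∘ there
            ; a~ = a~ ; ~b = ~b ∘ there }

      I : Fin 3 → Walk N
      I i = proj₁ (strip (path₀ i))
      s₀ t₀ : Fin 3 → Fin N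
      s₀ i = proj₁ (proj₂ (strip (path₀ i)))
      t₀ i = proj₁ (proj₂ (proj₂ (strip (path₀ i))))
      ins : ∀ i → Inside (lookup P i) (I i) (s₀ i) (t₀ i)
      ins i = proj₂ (proj₂ (proj₂ (strip (path₀ i))))
      I⊆ : ∀ {i x} → x ∈ I i → x ∈ lookup P i
      I⊆ {i} {x} x∈ = subst (x ∈_) (sym (Inside.p≡ (ins i))) (there (∈-++⁺ˡ x∈))
      P⊆ : ∀ {i x} → x ∈ lookup P i → x ≡ a ⊎ x ∈ I i ⊎ x ≡ b
      P⊆ {i} {x} x∈ with subst (x ∈_) (Inside.p≡ (ins i)) x∈
      ... | here eq = inj₁ eq
      ... | there m with ∈-++⁻ (I i) m
      ...   | inj₁ x∈I       = inj₂ (inj₁ x∈I)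
      ...   | inj₂ (here eq) = inj₂ (inj₂ eq)
      lone : ∀ {i j x} → i ≢ j → x ∈ I i → x ∉ lookup P j
      lone {i} {j} i≢j x∈I x∈P with meet i j i≢j _ (I⊆ x∈I) x∈P
      ... | here refl         = Inside.a∉ (ins i) x∈I
      ... | there (here refl) = Inside.b∉ (ins i) x∈I
      across : ∀ {i j x y} → i ≢ j → x ∈ lookup P j → y ∈ I i → y ~ x → y ≡ s₀ i × x ≡ a ⊎ y ≡ t₀ i × x ≡ b
      across {i} {j} i≢j x∈ y∈ e with edge e
      ... | m , adj with m ≟ i
      ...   | no m≢i = contradiction (Adj⇒∈ adj) (lone (m≢i ∘ sym) y∈)
      ...   | yes refl with meet m j i≢j _ (Adj⇒∈ʳ adj) x∈
      ...     | here refl         = inj₁ (Inside.a~ (ins i) y∈ (~-sym e) , refl)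
      ...     | there (here refl) = inj₂ (Inside.~b (ins i) y∈ e , refl)

    -- The path through `w` without its endpoints becomes `Q`, and the other two form the cycle. If
    -- `w` is itself an endpoint, it is on the cycle and is all that the nearer end of `Q` sees,
    -- unless `Q` is a single vertex.
    trihedron⇒ear : w ∈ˢ VK → SolidEar w
    trihedron⇒ear {w} w∈V with any-lookup P (proj₁ U _ w∈V)
    ... | i , w∈ with others i
    ...   | j , k , i≢j , i≢k , j≢k , exhaust = by-place (P⊆ w∈)
      where
      module Mᵢ = Inside (ins i)
      module Mₖ = Inside (ins k)
      C₀ = lookup P j ++ reverse (I k)
      ∈C⁻ : ∀ {x} → x ∈ C₀ → x ∈ lookup P j ⊎ x ∈ I k
      ∈C⁻ x∈ = Sum.map₂ ∈-reverse⁻ (∈-++⁻ (lookup P j) x∈)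
      ∈C : ∀ {x} → x ∈ I k → x ∈ C₀
      ∈C x∈ = ∈-++⁺ʳ (lookup P j) (↭.∈-resp-↭ (↭-sym (↭.↭-reverse _)) x∈)
      a∈ : a ∈ C₀
      a∈ = ∈-++⁺ˡ (First⇒∈ (Path.start (path₀ j)))
      b∈ : b ∈ C₀
      b∈ = ∈-++⁺ˡ (Last⇒∈ (Path.end (path₀ j)))
      long : ∀ {p} → 2 ℕ.≤ walkLength {N} p → 3 ℕ.≤ length (p ++ reverse (I k))
      long {_ ∷ p} 2≤ = s≤s (subst (2 ℕ.≤_) (sym (List.length-++ p)) (ℕ.≤-trans 2≤ (ℕ.m≤m+n _ _)))
      crossQ : ∀ {q c} → q ∈ I i → c ∈ C₀ → q ~ c → q ≡ s₀ i × c ≡ a ⊎ q ≡ t₀ i × c ≡ b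
      crossQ q∈ c∈ e with ∈C⁻ c∈
      ... | inj₁ c∈P = across i≢j c∈P q∈ e
      ... | inj₂ c∈I = across i≢k (I⊆ c∈I) q∈ e
      ends : Ends K (s₀ i) (t₀ i) (Nbr K (s₀ i) C₀) (Nbr K (t₀ i) C₀)
      ends with s₀ i ≟ t₀ i
      ... | yes s≡t = single s≡t
              (far (nbr a∈ (~-sym Mᵢ.a~s)) (nbr b∈ (subst (_~ b) (sym s≡t) Mᵢ.t~b)) a≢b a≁b)
      ... | no s≢t = double s≢t
              (a , nbr a∈ (~-sym Mᵢ.a~s)) (one⇒¬spread K onlyA)
              (b , nbr b∈ Mᵢ.t~b)
              (one⇒¬spread K λ (nbr c∈ e) → case crossQ (Last⇒∈ (Path.end Mᵢ.path)) c∈ e of λ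
                { (inj₁ (t≡s , _)) → contradiction (sym t≡s) s≢t ; (inj₂ (_ , c≡b)) → c≡b })
              (far (inj₁ (nbr a∈ (~-sym Mᵢ.a~s))) (inj₂ (nbr b∈ Mᵢ.t~b)) a≢b a≁b)
        where
        onlyA : ∀ {c} → Nbr K (s₀ i) C₀ c → c ≡ a
        onlyA (nbr c∈ e) = case crossQ (First⇒∈ (Path.start Mᵢ.path)) c∈ e of λ
          { (inj₁ (_ , c≡a)) → c≡a ; (inj₂ (s≡t , _)) → contradiction s≡t s≢t }
      E : Ear K C₀ (I i) (s₀ i) (t₀ i)
      E = record
        { cyc = ring (path₀ j) (Path-reverse Mₖ.path) (~-sym Mₖ.t~b) (~-sym Mₖ.a~s)
            (λ (x∈ , y∈) → lone (j≢k ∘ sym) (∈-reverse⁻ y∈) x∈)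
            (λ x∈ y∈ e → case across (j≢k ∘ sym) x∈ (∈-reverse⁻ y∈) (~-sym e) of λ
              { (inj₁ (y≡ , x≡)) → inj₂ (x≡ , y≡) ; (inj₂ (y≡ , x≡)) → inj₁ (x≡ , y≡) })
            (long {lookup P j} (proj₂ (isP j)))
        ; path = Mᵢ.path
        ; apart = λ (x∈ , y∈) → [ lone i≢j x∈ , (λ k∈ → lone i≢k x∈ (I⊆ k∈)) ]′ (∈C⁻ y∈)
        ; inner = λ q∈ c∈ e → Sum.map proj₁ proj₁ (crossQ q∈ c∈ e)
        ; ends = ends
        }
      in-C++Q : ∀ {x} → x ≡ a ⊎ (∃[ m ] x ∈ I m) ⊎ x ≡ b → x ∈ C₀ ++ I i
      in-C++Q (inj₁ refl) = ∈-++⁺ˡ a∈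
      in-C++Q (inj₂ (inj₂ refl)) = ∈-++⁺ˡ b∈
      in-C++Q (inj₂ (inj₁ (m , x∈))) with exhaust m
      ... | inj₁ refl        = ∈-++⁺ʳ C₀ x∈
      ... | inj₂ (inj₁ refl) = ∈-++⁺ˡ (∈-++⁺ˡ (I⊆ x∈))
      ... | inj₂ (inj₂ refl) = ∈-++⁺ˡ (∈C x∈)
      in-V : ∀ {m x} → x ∈ lookup P m → x ∈ˢ VK
      in-V {m} x∈ = let (_ , _ , _ , al , _) , _ = isP m in All.lookup al x∈
      spans : Spans C₀ (I i)
      spans = (λ x∈ → let m , x∈P = any-lookup P (proj₁ U _ x∈) in
                in-C++Q (Sum.map₂ (Sum.map₁ (m ,_)) (P⊆ x∈P))) ,
              (λ x∈ → [ (λ x∈C → [ in-V , in-V ∘ I⊆ ]′ (∈C⁻ x∈C)) , in-V ∘ I⊆ ]′ (∈-++⁻ C₀ x∈))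
      placed : ∀ {Q s t c} → c ∈ C₀ → (s ≢ t → ∀ {x} → x ∈ C₀ → s ~ x → x ≡ c) → Placed K c C₀ Q s t
      placed {s = s} {t} c∈ only with s ≟ t
      ... | yes s≡t = inj₂ (c∈ , inj₁ s≡t)
      ... | no s≢t  = inj₂ (c∈ , inj₂ (only s≢t))
      by-place : w ≡ a ⊎ w ∈ I i ⊎ w ≡ b → SolidEar w
      by-place (inj₁ refl) = C₀ , I i , s₀ i , t₀ i , E ,
        placed a∈ (λ s≢t x∈ e → case crossQ (First⇒∈ (Path.start Mᵢ.path)) x∈ e of λ
          { (inj₁ (_ , x≡a)) → x≡a ; (inj₂ (s≡t , _)) → contradiction s≡t s≢t }) , spans
      by-place (inj₂ (inj₁ w∈I)) = C₀ , I i , s₀ i , t₀ i , E , inj₁ w∈I , spans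
      by-place (inj₂ (inj₂ refl)) = C₀ , reverse (I i) , t₀ i , s₀ i , Ear-reverse E ,
        placed b∈ (λ t≢s x∈ e → case crossQ (Last⇒∈ (Path.end Mᵢ.path)) x∈ e of λ
          { (inj₁ (t≡s , _)) → contradiction t≡s t≢s ; (inj₂ (_ , x≡b)) → x≡b }) ,
        Spans-reverse {C₀} {I i} spans

  module _ {P : Vec (Walk N) 3} {T : Vec (Fin N) 3} {b : Fin N} (isT : IsTriangle K T)
    (b∉T : b ∉ toList T)
    (isP : ∀ i → IsPath K (lookup T i) b (lookup P i) × 1 ℕ.≤ walkLength (lookup P i))
    (meet : ∀ i j → i ≢ j → MeetOnlyIn (lookup P i) (lookup P j) (b ∷ []))
    (meetT : ∀ i → MeetOnlyIn (lookup P i) (toList T) (lookup T i ∷ []))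
    (U : IsUnionOf K (close (toList T) ∷ toList P)) where

    private
      τ : Fin 3 → Fin N
      τ = lookup T

      T≢b : ∀ i → τ i ≢ b
      T≢b i refl = b∉T (lookup∈ T i)

      edge : x ~ y → (∃[ m ] ∃[ n ] x ≡ τ m × y ≡ τ n) ⊎ ∃[ m ] Adj (lookup P m) x y
      edge e with covered U e
      ... | here adj = let m , p = any-lookup T (close-∈ _ (Adj⇒∈ adj))
                           n , q = any-lookup T (close-∈ _ (Adj⇒∈ʳ adj)) in inj₁ (m , n , p , q)
      ... | there k  = inj₂ (any-lookup P k)

      vertex : x ∈ˢ VK → ∃[ m ] x ∈ lookup P m
      vertex x∈ with proj₁ U _ x∈
      ... | there k = any-lookup P k
      ... | here k with any-lookup T (close-∈ _ k)
      ...   | m , refl = m , First⇒∈ (head⇒First (proj₁ (proj₁ (isP m))))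

      T∈P : ∀ {m i} → τ m ∈ lookup P i → τ m ≡ τ i
      T∈P {m} {i} m∈ with meetT i _ m∈ (lookup∈ T m)
      ... | here eq = eq

      path : ∀ i → Path (τ i) b (lookup P i)
      path i = IsPath⇒Path (proj₁ (isP i)) λ x∈ y∈ e → case edge e of λ
        { (inj₁ (_ , _ , refl , refl)) → contradiction (subst₂ _~_ (T∈P x∈) (T∈P y∈) e) ~-irrefl
        ; (inj₂ (m , adj)) → case m ≟ i of λ
          { (yes refl) → adj
          ; (no m≢i) → case meet m i m≢i _ (Adj⇒∈ adj) x∈ ,′ meet m i m≢i _ (Adj⇒∈ʳ adj) y∈ of λ
            { (here refl , here refl) → contradiction e ~-irrefl } } }

      I : Fin 3 → Walk N
      I i = proj₁ (drop-end (path i) (T≢b i))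
      t₀ : Fin 3 → Fin N
      t₀ i = proj₁ (proj₂ (drop-end (path i) (T≢b i)))
      ins : ∀ i → Inner b (lookup P i) (I i) (τ i) (t₀ i)
      ins i = proj₂ (proj₂ (drop-end (path i) (T≢b i)))
      I⊆ : ∀ {i x} → x ∈ I i → x ∈ lookup P i
      I⊆ {i} {x} x∈ = subst (x ∈_) (sym (Inner.p≡ (ins i))) (∈-++⁺ˡ x∈)
      P⊆ : ∀ {i x} → x ∈ lookup P i → x ∈ I i ⊎ x ≡ b
      P⊆ {i} {x} x∈ with ∈-++⁻ (I i) (subst (x ∈_) (Inner.p≡ (ins i)) x∈)
      ... | inj₁ x∈I       = inj₁ x∈I
      ... | inj₂ (here eq) = inj₂ eq
      lone : ∀ {i j x} → i ≢ j → x ∈ I i → x ∉ lookup P j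
      lone {i} {j} i≢j x∈I x∈P with meet i j i≢j _ (I⊆ x∈I) x∈P
      ... | here refl = Inner.b∉ (ins i) x∈I
      T∈I : ∀ i → τ i ∈ I i
      T∈I i = First⇒∈ (Path.start (Inner.path (ins i)))
      across : ∀ {i j x y} → i ≢ j → x ∈ lookup P j → y ∈ I i → y ~ x → y ≡ τ i × x ≡ τ j ⊎ y ≡ t₀ i × x ≡ b
      across {i} {j} i≢j x∈ y∈ e with edge e
      ... | inj₁ (_ , _ , refl , refl) = inj₁ (T∈P (I⊆ y∈) , T∈P x∈)
      ... | inj₂ (m , adj) with m ≟ i
      ...   | no m≢i = contradiction (Adj⇒∈ adj) (lone (m≢i ∘ sym) y∈)
      ...   | yes refl with meet m j i≢j _ (Adj⇒∈ʳ adj) x∈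
      ...     | here refl = inj₂ (Inner.~b (ins i) y∈ e , refl)

    -- The path of `w`, without `b`, becomes `Q`. So a triangle vertex `w` is never on the cycle,
    -- where the end of `Q` would see an edge; only `w = b` is, and the end of `Q` attached to it
    -- sees nothing else unless `Q` is a single vertex.
    stamp⇒ear : w ∈ˢ VK → SolidEar w
    stamp⇒ear {w} w∈V with vertex w∈V
    ... | i , w∈ with others i
    ...   | j , k , i≢j , i≢k , j≢k , exhaust = by-place (P⊆ w∈)
      where
      module Mᵢ = Inner (ins i)
      module Mₖ = Inner (ins k)
      C₀ = lookup P j ++ reverse (I k)
      ∈C⁻ : ∀ {x} → x ∈ C₀ → x ∈ lookup P j ⊎ x ∈ I k
      ∈C⁻ x∈ = Sum.map₂ ∈-reverse⁻ (∈-++⁻ (lookup P j) x∈)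
      ∈C : ∀ {x} → x ∈ I k → x ∈ C₀
      ∈C x∈ = ∈-++⁺ʳ (lookup P j) (↭.∈-resp-↭ (↭-sym (↭.↭-reverse _)) x∈)
      b∈ : b ∈ C₀
      b∈ = ∈-++⁺ˡ (Last⇒∈ (Path.end (path j)))
      j∈ : τ j ∈ C₀
      j∈ = ∈-++⁺ˡ (I⊆ (T∈I j))
      k∈ : τ k ∈ C₀
      k∈ = ∈C (T∈I k)
      i~j = isT i j i≢j
      i~k = isT i k i≢k
      j~k = isT j k j≢k
      long : ∀ {p q} → 1 ℕ.≤ walkLength {N} p → τ k ∈ q → 3 ℕ.≤ length (p ++ reverse q)
      long {_ ∷ p} {q@(_ ∷ _)} 1≤ _ = s≤s (subst (2 ℕ.≤_) (sym (List.length-++ p))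
        (ℕ.+-mono-≤ 1≤ (subst (1 ℕ.≤_) (sym (List.length-reverse q)) (s≤s z≤n))))
      crossQ : ∀ {q c} → q ∈ I i → c ∈ C₀ → q ~ c →
               q ≡ τ i × (c ≡ τ j ⊎ c ≡ τ k) ⊎ q ≡ t₀ i × c ≡ b
      crossQ q∈ c∈ e with ∈C⁻ c∈
      ... | inj₁ c∈P = Sum.map₁ (λ (p , q) → p , inj₁ q) (across i≢j c∈P q∈ e)
      ... | inj₂ c∈I = Sum.map₁ (λ (p , q) → p , inj₂ q) (across i≢k (I⊆ c∈I) q∈ e)
      ends : Ends K (τ i) (t₀ i) (Nbr K (τ i) C₀) (Nbr K (t₀ i) C₀)
      ends with τ i ≟ t₀ i
      ... | yes s≡t = single s≡t (three (nbr j∈ i~j) (nbr k∈ i~k) (nbr b∈ (subst (_~ b) (sym s≡t) Mᵢ.t~b))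
              (~⇒≢ j~k) (T≢b j) (T≢b k))
      ... | no s≢t = double s≢t
              (τ j , nbr j∈ i~j) (pair⇒¬spread K j~k onlyA)
              (b , nbr b∈ Mᵢ.t~b)
              (one⇒¬spread K λ (nbr c∈ e) → case crossQ (Last⇒∈ (Path.end Mᵢ.path)) c∈ e of λ
                { (inj₁ (t≡s , _)) → contradiction (sym t≡s) s≢t ; (inj₂ (_ , c≡b)) → c≡b })
              (three (inj₁ (nbr j∈ i~j)) (inj₁ (nbr k∈ i~k)) (inj₂ (nbr b∈ Mᵢ.t~b))
                (~⇒≢ j~k) (T≢b j) (T≢b k))
        where
        onlyA : ∀ {c} → Nbr K (τ i) C₀ c → c ≡ τ j ⊎ c ≡ τ k
        onlyA (nbr c∈ e) = case crossQ (T∈I i) c∈ e of λ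
          { (inj₁ (_ , c∈)) → c∈ ; (inj₂ (s≡t , _)) → contradiction s≡t s≢t }
      E : Ear K C₀ (I i) (τ i) (t₀ i)
      E = record
        { cyc = ring (path j) (Path-reverse Mₖ.path) (~-sym Mₖ.t~b) (~-sym j~k)
            (λ (x∈ , y∈) → lone (j≢k ∘ sym) (∈-reverse⁻ y∈) x∈)
            (λ x∈ y∈ e → case across (j≢k ∘ sym) x∈ (∈-reverse⁻ y∈) (~-sym e) of λ
              { (inj₁ (y≡ , x≡)) → inj₂ (x≡ , y≡) ; (inj₂ (y≡ , x≡)) → inj₁ (x≡ , y≡) })
            (long {lookup P j} (proj₂ (isP j)) (T∈I k))
        ; path = Mᵢ.path
        ; apart = λ (x∈ , y∈) → [ lone i≢j x∈ , (λ k∈ → lone i≢k x∈ (I⊆ k∈)) ]′ (∈C⁻ y∈)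
        ; inner = λ q∈ c∈ e → Sum.map proj₁ proj₁ (crossQ q∈ c∈ e)
        ; ends = ends
        }
      in-C++Q : ∀ {x} → (∃[ m ] x ∈ I m) ⊎ x ≡ b → x ∈ C₀ ++ I i
      in-C++Q (inj₂ refl) = ∈-++⁺ˡ b∈
      in-C++Q (inj₁ (m , x∈)) with exhaust m
      ... | inj₁ refl        = ∈-++⁺ʳ C₀ x∈
      ... | inj₂ (inj₁ refl) = ∈-++⁺ˡ (∈-++⁺ˡ (I⊆ x∈))
      ... | inj₂ (inj₂ refl) = ∈-++⁺ˡ (∈C x∈)
      in-V : ∀ {m x} → x ∈ lookup P m → x ∈ˢ VK
      in-V {m} x∈ = let (_ , _ , _ , al , _) , _ = isP m in All.lookup al x∈
      spans : Spans C₀ (I i)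
      spans = (λ x∈ → let m , x∈P = vertex x∈ in in-C++Q (Sum.map₁ (m ,_) (P⊆ x∈P))) ,
              (λ x∈ → [ (λ x∈C → [ in-V , in-V ∘ I⊆ ]′ (∈C⁻ x∈C)) , in-V ∘ I⊆ ]′ (∈-++⁻ C₀ x∈))
      by-place : w ∈ I i ⊎ w ≡ b → SolidEar w
      by-place (inj₁ w∈I) = C₀ , I i , τ i , t₀ i , E , inj₁ w∈I , spans
      by-place (inj₂ refl) = C₀ , reverse (I i) , t₀ i , τ i , Ear-reverse E ,
        inj₂ (b∈ , only) , Spans-reverse {C₀} {I i} spans
        where
        only : t₀ i ≡ τ i ⊎ (∀ {c} → c ∈ C₀ → t₀ i ~ c → c ≡ b)
        only with t₀ i ≟ τ i
        ... | yes t≡s = inj₁ t≡s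
        ... | no t≢s  = inj₂ λ c∈ e → case crossQ (Last⇒∈ (Path.end Mᵢ.path)) c∈ e of λ
          { (inj₁ (t≡s , _)) → contradiction t≡s t≢s ; (inj₂ (_ , c≡b)) → c≡b }

  module _ {P : Vec (Walk N) 3} {T T′ : Vec (Fin N) 3} (isT : IsTriangle K T) (isT′ : IsTriangle K T′)
    (T#T′ : Disjoint (toList T) (toList T′))
    (isP : ∀ i → IsPath K (lookup T i) (lookup T′ i) (lookup P i))
    (disjoint : ∀ i j → i ≢ j → Disjoint (lookup P i) (lookup P j))
    (U : IsUnionOf K (close (toList T) ∷ close (toList T′) ∷ toList P)) where

    private
      τ τ′ : Fin 3 → Fin N
      τ = lookup T
      τ′ = lookup T′

      T≢T′ : ∀ i j → τ i ≢ τ′ j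
      T≢T′ i j eq with T#T′ _ (lookup∈ T i) (subst (_∈ toList T′) (sym eq) (lookup∈ T′ j))
      ... | ()

      lone : ∀ {i j x} → x ∈ lookup P i → x ∈ lookup P j → i ≡ j
      lone {i} {j} x∈ x∈′ with i ≟ j
      ... | yes i≡j = i≡j
      ... | no i≢j with disjoint i j i≢j _ x∈ x∈′
      ...   | ()

      T∈ : ∀ i → τ i ∈ lookup P i
      T∈ i = First⇒∈ (head⇒First (proj₁ (isP i)))
      T′∈ : ∀ i → τ′ i ∈ lookup P i
      T′∈ i = Last⇒∈ (last⇒Last (lookup P i) (proj₁ (proj₂ (isP i))))

      edge : x ~ y → (∃[ m ] ∃[ n ] x ≡ τ m × y ≡ τ n) ⊎ (∃[ m ] ∃[ n ] x ≡ τ′ m × y ≡ τ′ n) ⊎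
                     ∃[ m ] Adj (lookup P m) x y
      edge e with covered U e
      ... | here adj = let m , p = any-lookup T (close-∈ _ (Adj⇒∈ adj))
                           n , q = any-lookup T (close-∈ _ (Adj⇒∈ʳ adj)) in inj₁ (m , n , p , q)
      ... | there (here adj) = let m , p = any-lookup T′ (close-∈ _ (Adj⇒∈ adj))
                                   n , q = any-lookup T′ (close-∈ _ (Adj⇒∈ʳ adj)) in
                               inj₂ (inj₁ (m , n , p , q))
      ... | there (there k)  = inj₂ (inj₂ (any-lookup P k))

      vertex : x ∈ˢ VK → ∃[ m ] x ∈ lookup P m
      vertex x∈ with proj₁ U _ x∈
      ... | there (there k) = any-lookup P k
      ... | here k with any-lookup T (close-∈ _ k)
      ...   | m , refl = m , T∈ m
      vertex x∈ | there (here k) with any-lookup T′ (close-∈ _ k)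
      ...   | m , refl = m , T′∈ m

      path : ∀ i → Path (τ i) (τ′ i) (lookup P i)
      path i = IsPath⇒Path (isP i) λ x∈ y∈ e → case edge e of λ
        { (inj₁ (_ , _ , refl , refl)) → case lone (T∈ _) x∈ ,′ lone (T∈ _) y∈ of λ
          { (refl , refl) → contradiction e ~-irrefl }
        ; (inj₂ (inj₁ (_ , _ , refl , refl))) → case lone (T′∈ _) x∈ ,′ lone (T′∈ _) y∈ of λ
          { (refl , refl) → contradiction e ~-irrefl }
        ; (inj₂ (inj₂ (m , adj))) → case lone (Adj⇒∈ adj) x∈ of λ { refl → adj } }

      across : ∀ {i j x y} → i ≢ j → x ∈ lookup P j → y ∈ lookup P i → y ~ x →
               y ≡ τ i × x ≡ τ j ⊎ y ≡ τ′ i × x ≡ τ′ j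
      across i≢j x∈ y∈ e with edge e
      ... | inj₁ (_ , _ , refl , refl) with lone (T∈ _) y∈ | lone (T∈ _) x∈
      ...   | refl | refl = inj₁ (refl , refl)
      across i≢j x∈ y∈ e | inj₂ (inj₁ (_ , _ , refl , refl)) with lone (T′∈ _) y∈ | lone (T′∈ _) x∈
      ...   | refl | refl = inj₂ (refl , refl)
      across i≢j x∈ y∈ e | inj₂ (inj₂ (m , adj)) with lone (Adj⇒∈ adj) y∈ | lone (Adj⇒∈ʳ adj) x∈
      ...   | refl | refl = contradiction refl i≢j

    -- Every vertex is on one of the three paths. That path serves as `Q`, and the other two, with
    -- one edge from each triangle, make the cycle.
    prism⇒ear : w ∈ˢ VK → SolidEar w
    prism⇒ear {w} w∈V with vertex w∈V
    ... | i , w∈ with others i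
    ...   | j , k , i≢j , i≢k , j≢k , exhaust =
      C₀ , lookup P i , τ i , τ′ i , E , inj₁ w∈ , spans
      where
      C₀ = lookup P j ++ reverse (lookup P k)
      ∈C⁻ : ∀ {x} → x ∈ C₀ → x ∈ lookup P j ⊎ x ∈ lookup P k
      ∈C⁻ x∈ = Sum.map₂ ∈-reverse⁻ (∈-++⁻ (lookup P j) x∈)
      ∈C : ∀ {x} → x ∈ lookup P k → x ∈ C₀
      ∈C x∈ = ∈-++⁺ʳ (lookup P j) (↭.∈-resp-↭ (↭-sym (↭.↭-reverse _)) x∈)
      long : ∀ {p q} → 1 ℕ.≤ walkLength {N} p → τ k ∈ q → 3 ℕ.≤ length (p ++ reverse q)
      long {_ ∷ p} {q@(_ ∷ _)} 1≤ _ = s≤s (subst (2 ℕ.≤_) (sym (List.length-++ p))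
        (ℕ.+-mono-≤ 1≤ (subst (1 ℕ.≤_) (sym (List.length-reverse q)) (s≤s z≤n))))
      crossQ : ∀ {q c} → q ∈ lookup P i → c ∈ C₀ → q ~ c →
               q ≡ τ i × (c ≡ τ j ⊎ c ≡ τ k) ⊎ q ≡ τ′ i × (c ≡ τ′ j ⊎ c ≡ τ′ k)
      crossQ q∈ c∈ e with ∈C⁻ c∈
      ... | inj₁ c∈P = Sum.map (λ (p , q) → p , inj₁ q) (λ (p , q) → p , inj₁ q) (across i≢j c∈P q∈ e)
      ... | inj₂ c∈P = Sum.map (λ (p , q) → p , inj₂ q) (λ (p , q) → p , inj₂ q) (across i≢k c∈P q∈ e)
      E : Ear K C₀ (lookup P i) (τ i) (τ′ i)
      E = record
        { cyc = ring (path j) (Path-reverse (path k)) (isT′ j k j≢k) (isT k j (j≢k ∘ sym))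
            (λ (x∈ , y∈) → j≢k (lone x∈ (∈-reverse⁻ y∈)))
            (λ x∈ y∈ e → Sum.swap (across j≢k (∈-reverse⁻ y∈) x∈ e))
            (long {lookup P j} (Recognise.length₂ K (path j) (T≢T′ j j)) (T∈ k))
        ; path = path i
        ; apart = λ (x∈ , y∈) → [ (λ m → i≢j (lone x∈ m)) , (λ m → i≢k (lone x∈ m)) ]′ (∈C⁻ y∈)
        ; inner = λ q∈ c∈ e → Sum.map proj₁ proj₁ (crossQ q∈ c∈ e)
        ; ends = double (T≢T′ i i)
            (τ j , nbr (∈-++⁺ˡ (T∈ j)) (isT i j i≢j))
            (pair⇒¬spread K (isT j k j≢k) λ (nbr c∈ e) → case crossQ (T∈ i) c∈ e of λ
              { (inj₁ (_ , c≡)) → c≡ ; (inj₂ (s≡t , _)) → contradiction s≡t (T≢T′ i i) })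
            (τ′ j , nbr (∈-++⁺ˡ (T′∈ j)) (isT′ i j i≢j))
            (pair⇒¬spread K (isT′ j k j≢k) λ (nbr c∈ e) → case crossQ (T′∈ i) c∈ e of λ
              { (inj₁ (t≡s , _)) → contradiction (sym t≡s) (T≢T′ i i) ; (inj₂ (_ , c≡)) → c≡ })
            (three (inj₁ (nbr (∈-++⁺ˡ (T∈ j)) (isT i j i≢j))) (inj₁ (nbr (∈C (T∈ k)) (isT i k i≢k)))
              (inj₂ (nbr (∈-++⁺ˡ (T′∈ j)) (isT′ i j i≢j))) (~⇒≢ (isT j k j≢k)) (T≢T′ j j) (T≢T′ k j))
        }
      in-V : ∀ {m x} → x ∈ lookup P m → x ∈ˢ VK
      in-V {m} x∈ = let _ , _ , _ , al , _ = isP m in All.lookup al x∈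
      in-C++Q : ∀ {x m} → x ∈ lookup P m → x ∈ C₀ ++ lookup P i
      in-C++Q {m = m} x∈ with exhaust m
      ... | inj₁ refl        = ∈-++⁺ʳ C₀ x∈
      ... | inj₂ (inj₁ refl) = ∈-++⁺ˡ (∈-++⁺ˡ x∈)
      ... | inj₂ (inj₂ refl) = ∈-++⁺ˡ (∈C x∈)
      spans : Spans C₀ (lookup P i)
      spans = (λ x∈ → in-C++Q (proj₂ (vertex x∈))) ,
              (λ x∈ → [ (λ x∈C → [ in-V , in-V ]′ (∈C⁻ x∈C)) , in-V ]′ (∈-++⁻ C₀ x∈))

  solid⇒ear : SolidGraph K → w ∈ˢ VK → SolidEar w
  solid⇒ear (inj₁ pyr) w∈ = pyramid⇒ear pyr w∈
  solid⇒ear (inj₂ (inj₁ (P , a , b , a≢b , isP , meet , U))) w∈ =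
    trihedron⇒ear {P = P} a≢b isP meet U w∈
  solid⇒ear (inj₂ (inj₂ (inj₁ (P , T , b , isT , b∉T , isP , meet , meetT , U)))) w∈ =
    stamp⇒ear {P = P} {T = T} isT b∉T isP meet meetT U w∈
  solid⇒ear (inj₂ (inj₂ (inj₂ (P , T , T′ , isT , isT′ , T#T′ , isP , disj , U)))) w∈ =
    prism⇒ear {P = P} {T = T} {T′ = T′} isT isT′ T#T′ isP disj U w∈

-- Induced subgraphs

infix 4 _≐_

record _≐_ {N} (S : Subset N) (L : Walk N) : Set where
  field
    ⊆ : ∀ {x} → x ∈ˢ S → x ∈ L
    ⊇ : ∀ {x} → x ∈ L → x ∈ˢ S

≐-↭ : ∀ {N} {S : Subset N} {L M} → S ≐ L → L ↭ M → S ≐ M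
≐-↭ S≐L L↭M = record { ⊆ = ↭.∈-resp-↭ L↭M ∘ ⊆ ; ⊇ = ⊇ ∘ ↭.∈-resp-↭ (↭-sym L↭M) }
  where open _≐_ S≐L

module OnSubset {N : ℕ} (K : Graph N) (S : Subset N) where

  open Graph K using (_~_; _~?_; ~-sym; ~-irrefl; ~⇒∈V) renaming (V to VK)

  CycleOn SolidOn : Set
  CycleOn = S ⊆ˢ VK × CycleGraph (K [ S ])
  SolidOn = S ⊆ˢ VK × SolidGraph (K [ S ])

  private
    module K = Induced K
    module KS = Induced (K [ S ])

  cycleOn⇒cyc : CycleOn → ∃[ C ] K.Cyc C × S ≐ C
  cycleOn⇒cyc (S⊆V , c , (long , u , lk) , U) = c , cyc , record { ⊆ = ⊆c ; ⊇ = c⊆ }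
    where
    step : ∀ {x y} → Adj (close c) x y → x ∈ˢ S × y ∈ˢ S × x ~ y
    step = Linked⇒Adj (λ (x∈ , y∈ , e) → y∈ , x∈ , ~-sym e) lk
    ⊆c : ∀ {x} → x ∈ˢ S → x ∈ c
    ⊆c x∈ with proj₁ U _ (x∈p∩q⁺ (S⊆V x∈ , x∈))
    ... | here m = close-∈ c m
    covered : ∀ {x y} → x ∈ˢ S → y ∈ˢ S → x ~ y → Adj (close c) x y
    covered x∈ y∈ e with proj₂ U _ _ (x∈ , y∈ , e)
    ... | here m = steps⇒Adj± m
    cycˢ : KS.Cyc c
    cycˢ = record { long = long ; unique = u ; adj⇒~ = step
                  ; ~⇒adj = λ { _ _ (x∈ , y∈ , e) → covered x∈ y∈ e } }
    c⊆ : ∀ {x} → x ∈ c → x ∈ˢ S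
    c⊆ x∈ = let _ , _ , _ , _ , _ , (x∈S , _) , _ = cycle-nbrs cycˢ x∈ in x∈S
    cyc : K.Cyc c
    cyc = Cyc-resp (λ { _ _ (_ , _ , e) → e }) (λ x∈ y∈ e → c⊆ x∈ , c⊆ y∈ , e) cycˢ

  cyc⇒cycleOn : ∀ {C} → K.Cyc C → S ≐ C → CycleOn
  cyc⇒cycleOn {C} cyc S≐C =
    (λ x∈ → let _ , _ , _ , _ , _ , e , _ = cycle-nbrs cyc (⊆ x∈) in ~⇒∈V e) ,
    C , Recognise.isCycle (K [ S ]) cycˢ ,
    Recognise.isUnion (K [ S ]) (close C ∷ [])
      (λ x∈ → here (∈-close (⊆ (proj₂ (x∈p∩q⁻ VK S x∈)))))
      (λ { (x∈ , y∈ , e) → here (K.Cyc.~⇒adj cyc (⊆ x∈) (⊆ y∈) e) })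
    where
    open _≐_ S≐C
    ∈-close : ∀ {x c} → x ∈ c → x ∈ close {N} c
    ∈-close {c = _ ∷ _} = ∈-++⁺ˡ
    cycˢ : KS.Cyc C
    cycˢ = Cyc-resp (λ x∈ y∈ e → ⊇ x∈ , ⊇ y∈ , e) (λ { _ _ (_ , _ , e) → e }) cyc

  private
    module _ {C Q s t} (E : Ear K C Q s t) where
      open Ear E
      C∈V : ∀ {x} → x ∈ C → x ∈ˢ VK
      C∈V x∈ = let _ , _ , _ , _ , _ , e , _ = cycle-nbrs cyc x∈ in ~⇒∈V e
      s∈V : s ∈ˢ VK
      s∈V with ends
      ... | double _ (_ , nbr _ e) _ _ _ _ = ~⇒∈V e
      ... | single _ (three (nbr _ e) _ _ _ _ _) = ~⇒∈V e
      ... | single _ (far (nbr _ e) _ _ _) = ~⇒∈V e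
      has-adj : ∀ {p x} → x ∈ p → (∃[ y ] Adj {A = Fin N} p x y) ⊎ p ≡ x ∷ []
      has-adj {_ ∷ []}    (here refl)         = inj₂ refl
      has-adj {_ ∷ _ ∷ _} (here refl)         = inj₁ (_ , here)
      has-adj {_ ∷ _ ∷ _} (there (here refl)) = inj₁ (_ , ereh)
      has-adj {_ ∷ _ ∷ _ ∷ _} (there x∈@(there _)) with has-adj x∈
      ... | inj₁ (y , a) = inj₁ (y , there a)
      ... | inj₂ ()
      Q∈V : ∀ {x} → x ∈ Q → x ∈ˢ VK
      Q∈V x∈ with has-adj x∈
      ... | inj₁ (_ , a) = ~⇒∈V (K.Path.adj⇒~ path a)
      -- A path with a single vertex has no edge of its own; the vertex is known to belong to the
      -- graph through its neighbour on the cycle.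
      ... | inj₂ Q≡ with K.Path.start path
      ...   | first with refl ← Q≡ = s∈V

  ear⇒solidOn : ∀ {C Q s t} → Ear K C Q s t → S ≐ C ++ Q → SolidOn
  ear⇒solidOn {C} {Q} E S≐ = S⊆V ,
    (case EarOn-resp {H = K} {G = K [ S ]} (λ x∈ y∈ e → ⊇ x∈ , ⊇ y∈ , e) (λ { _ _ (_ , _ , e) → e })
            (C , Q , _ , _ , E , ↭-refl) of λ
      (_ , _ , _ , _ , E′ , perm) → Recognise.ear⇒solid (K [ S ]) E′
        ( (λ x∈ → ↭.∈-resp-↭ (↭-sym perm) (⊆ (proj₂ (x∈p∩q⁻ VK S x∈))))
        , (λ x∈ → let x∈S = ⊇ (↭.∈-resp-↭ perm x∈) in x∈p∩q⁺ (S⊆V x∈S , x∈S)) ))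
    where
    open _≐_ S≐
    S⊆V : S ⊆ˢ VK
    S⊆V x∈ = [ C∈V E , Q∈V E ]′ (∈-++⁻ C (⊆ x∈))

  earOn⇒solidOn : ∀ {L} → EarOn K L → S ≐ L → SolidOn
  earOn⇒solidOn (_ , _ , _ , _ , E , perm) S≐L = ear⇒solidOn E (≐-↭ S≐L (↭-sym perm))

  solidOn⇒ear : ∀ {w} → SolidOn → w ∈ˢ S →
                ∃[ C ] ∃[ Q ] ∃[ s ] ∃[ t ] Ear K C Q s t × Placed K w C Q s t × S ≐ C ++ Q
  solidOn⇒ear {w} (S⊆V , solid) w∈ with Decompose.solid⇒ear (K [ S ]) solid (x∈p∩q⁺ (S⊆V w∈ , w∈))
  ... | C , Q , s , t , E , placed , V⊆ , ⊆V = C , Q , s , t ,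
    subst₂ (λ C Q → Ear K C Q s t) (List.map-id C) (List.map-id Q) (Ear-map {f = id} record
      { inj = λ _ _ → id ; to = λ { _ _ (_ , _ , e) → e }
      ; from = λ x∈ y∈ e → ∈S x∈ , ∈S y∈ , e } E) ,
    Sum.map₂ (λ (w∈C , only) → w∈C , Sum.map₂
      (λ k c∈ e → k c∈ (∈S (∈-++⁺ʳ C (First⇒∈ (KS.Path.start (Ear.path E)))) , ∈S (∈-++⁺ˡ c∈) , e))
      only) placed ,
    record { ⊆ = λ x∈ → V⊆ (x∈p∩q⁺ (S⊆V x∈ , x∈)) ; ⊇ = ∈S }
    where
    ∈S : ∀ {x} → x ∈ C ++ Q → x ∈ˢ S
    ∈S x∈ = proj₂ (x∈p∩q⁻ VK S (⊆V x∈))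

  solidOn-nonempty : SolidOn → ∃[ w ] w ∈ˢ S
  solidOn-nonempty (_ , solid) = case vertex solid of λ (w , w∈) → w , proj₂ (x∈p∩q⁻ VK S w∈)
    where
    vertex : SolidGraph (K [ S ]) → ∃[ w ] w ∈ˢ VK ∩ˢ S
    vertex (inj₁ ([] , _ , (() , _) , _))
    vertex (inj₁ (x ∷ _ , _ , (_ , _ , lk) , _)) = x , first-∈ lk
      where
      first-∈ : ∀ {x c} → Linked (Graph._~_ (K [ S ])) ((x ∷ c) ∷ʳ x) → x ∈ˢ VK ∩ˢ S
      first-∈ {c = []}    (e ∷ _) = Graph.~⇒∈V (K [ S ]) e
      first-∈ {c = _ ∷ _} (e ∷ _) = Graph.~⇒∈V (K [ S ]) e
    vertex (inj₂ (inj₁ (P , a , _ , _ , isP , _))) =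
      let (h , _ , _ , al , _) , _ = isP zero in a , All.lookup al (First⇒∈ (head⇒First h))
    vertex (inj₂ (inj₂ (inj₁ (P , T , _ , isT , _)))) =
      lookup T zero , Graph.~⇒∈V (K [ S ]) (isT zero (suc zero) λ ())
    vertex (inj₂ (inj₂ (inj₂ (P , T , _ , isT , _)))) =
      lookup T zero , Graph.~⇒∈V (K [ S ]) (isT zero (suc zero) λ ())

open OnSubset using (CycleOn; SolidOn; cycleOn⇒cyc; cyc⇒cycleOn; ear⇒solidOn; earOn⇒solidOn;
                     solidOn⇒ear; solidOn-nonempty)

-- Contraction

module _ {N : ℕ} where

  infixl 6 _+ˢ_

  _+ˢ_ : Subset N → Fin N → Subset N
  S +ˢ i = S [ i ]≔ inside

  ∈+⁻ : ∀ {S : Subset N} {i x} → x ∈ˢ S +ˢ i → x ≡ i ⊎ x ∈ˢ S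
  ∈+⁻ {S} {i} {x} x∈ with x ≟ i
  ... | yes x≡i = inj₁ x≡i
  ... | no x≢i  = inj₂ (lookup⇒[]= x S (trans (sym (lookup∘update′ x≢i S inside)) ([]=⇒lookup x∈)))

  ∈+⁺ : ∀ {S : Subset N} {i x} → x ≡ i ⊎ x ∈ˢ S → x ∈ˢ S +ˢ i
  ∈+⁺ {S} {i} {x} h with x ≟ i
  ... | yes refl = lookup⇒[]= x (S +ˢ x) (lookup∘update x S inside)
  ... | no x≢i   = case h of λ
    { (inj₁ x≡i) → contradiction x≡i x≢i
    ; (inj₂ x∈)  → lookup⇒[]= x (S +ˢ i) (trans (lookup∘update′ x≢i S inside) ([]=⇒lookup x∈)) }

  ≐-+ : ∀ {S : Subset N} {i L} → S ≐ L → S +ˢ i ≐ i ∷ L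
  ≐-+ S≐L = record
    { ⊆ = λ x∈ → [ here , there ∘ ⊆ ]′ (∈+⁻ x∈)
    ; ⊇ = λ { (here eq) → ∈+⁺ (inj₁ eq) ; (there x∈) → ∈+⁺ (inj₂ (⊇ x∈)) } }
    where open _≐_ S≐L

  ≐-+⁻ : ∀ {S : Subset N} {i L} → i ∉ˢ S → i ∉ L → S +ˢ i ≐ i ∷ L → S ≐ L
  ≐-+⁻ i∉S i∉L S≐L = record
    { ⊆ = λ x∈ → case ⊆ (∈+⁺ (inj₂ x∈)) of λ
      { (here refl) → contradiction x∈ i∉S ; (there x∈) → x∈ }
    ; ⊇ = λ x∈ → case ∈+⁻ (⊇ (there x∈)) of λ
      { (inj₁ refl) → contradiction x∈ i∉L ; (inj₂ x∈) → x∈ } }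
    where open _≐_ S≐L

hoopOn : ∀ {N} {K : Graph N} {S w} → CycleOn K S → w ∈ˢ S →
         ∃[ J ] ∃[ l ] ∃[ r ] Induced.Hoop K w l r J × S ≐ w ∷ J
hoopOn {K = K} {S} cycle w∈ with cycleOn⇒cyc K S cycle
... | C , cyc , S≐C with Induced.hoopAt K cyc (_≐_.⊆ S≐C w∈)
...   | J , l , r , C↭ , H = J , l , r , H , ≐-↭ S≐C C↭

module Contraction {N : ℕ} (G : Graph N) {u v : Fin N} (e : Graph._~_ G u v) where

  open Graph G using (_~_; _~?_; ~-sym; ~-irrefl)
  private
    H = contract G e
    module G = Induced G
    module H = Induced H
  open Graph H using () renaming (_~_ to _≈_)

  -- The contracted vertex keeps the name `u`, which therefore occurs here in two roles.
  splitting : ∀ {xs} → u ∉ xs → v ∉ xs → Splitting H G u u v xs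
  splitting {xs} u∉ v∉ = record
    { u~v = e ; w∉ = u∉ ; u∉ = u∉ ; v∉ = v∉
    ; to = λ
      { x∈ y∈ (_ , _ , _ , inj₁ x~y) → x~y
      ; x∈ y∈ (_ , _ , _ , inj₂ (inj₁ (refl , _))) → contradiction x∈ u∉
      ; x∈ y∈ (_ , _ , _ , inj₂ (inj₂ (refl , _))) → contradiction y∈ u∉ }
    ; from = λ x∈ y∈ x~y → ≢v x∈ , ≢v y∈ , G.~⇒≢ x~y , inj₁ x~y
    ; w⇒ = λ
      { x∈ (_ , _ , _ , inj₁ u~x) → inj₁ u~x
      ; x∈ (_ , _ , _ , inj₂ (inj₁ (_ , v~x))) → inj₂ v~x
      ; x∈ (_ , _ , _ , inj₂ (inj₂ (refl , _))) → contradiction x∈ u∉ }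
    ; u⇒ = λ x∈ u~x → G.~⇒≢ e , ≢v x∈ , G.~⇒≢ u~x , inj₁ u~x
    ; v⇒ = λ x∈ v~x → G.~⇒≢ e , ≢v x∈ , (λ { refl → u∉ x∈ }) , inj₂ (inj₁ (refl , v~x))
    }
    where
    ≢v : ∀ {x} → x ∈ xs → x ≢ v
    ≢v x∈ refl = v∉ x∈

  module _ {X : Subset N} (u∉X : u ∉ˢ X) (v∉X : v ∉ˢ X) where

    private
      splitting′ : ∀ {xs} → X ≐ xs → Splitting H G u u v xs
      splitting′ X≐ = splitting (u∉X ∘ _≐_.⊇ X≐) (v∉X ∘ _≐_.⊇ X≐)

      u≢v : u ≢ v
      u≢v = G.~⇒≢ e

      u∉+v : u ∉ˢ X +ˢ v
      u∉+v u∈ = [ u≢v , u∉X ]′ (∈+⁻ u∈)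

    Xu Xv Xuv : Subset N
    Xu  = X +ˢ u
    Xv  = X +ˢ v
    Xuv = X +ˢ v +ˢ u

    hoopᵘ : CycleOn G Xu → ∃[ J ] ∃[ l ] ∃[ r ] G.Hoop u l r J × X ≐ J
    hoopᵘ c = let J , l , r , H , T≐ = hoopOn c (∈+⁺ (inj₁ refl)) in
      J , l , r , H , ≐-+⁻ u∉X (G.Hoop.w∉p H) T≐

    hoopᵛ : CycleOn G Xv → ∃[ J ] ∃[ l ] ∃[ r ] G.Hoop v l r J × X ≐ J
    hoopᵛ c = let J , l , r , H , T≐ = hoopOn c (∈+⁺ (inj₁ refl)) in
      J , l , r , H , ≐-+⁻ v∉X (G.Hoop.w∉p H) T≐

    solid-splits : SolidOn H Xu → SolidOn G Xuv ⊎ SolidOn G Xu ⊎ SolidOn G Xv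
    solid-splits solid with solidOn⇒ear H Xu solid (∈+⁺ (inj₁ refl))
    ... | C , Q , s , t , E , placed , Xu≐ with ∈⇒↭ (_≐_.⊆ Xu≐ (∈+⁺ (inj₁ refl)))
    ...   | xs , perm = Sum.map (λ E → earOn⇒solidOn G Xuv E (≐-+ (≐-+ X≐)))
              (Sum.map (λ E → earOn⇒solidOn G Xu E (≐-+ X≐)) (λ E → earOn⇒solidOn G Xv E (≐-+ X≐)))
              (split-ear (splitting′ X≐) E perm placed)
      where
      unique : Unique (C ++ Q)
      unique = Unique.++⁺ (H.Cyc.unique (Ear.cyc E)) (H.Path.unique (Ear.path E))
        λ (x∈ , y∈) → Ear.apart E (y∈ , x∈)
      X≐ : X ≐ xs
      X≐ = ≐-+⁻ u∉X (Unique-head (Unique-resp-↭ perm unique)) (≐-↭ Xu≐ perm)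

    -- An ear on the larger set, deprived of the contracted vertex, would fit into an induced path.
    path⇒¬solid : ∀ {l r J} → X ≐ J → H.Path l r J → ¬ SolidOn H Xu
    path⇒¬solid X≐ π solid with solidOn⇒ear H Xu solid (∈+⁺ (inj₁ refl))
    ... | C , Q , s , t , E , placed , Xu≐ = ear-minus-vertex E placed π λ x∈ x≢u →
      [ (λ x≡u → contradiction x≡u x≢u) , _≐_.⊆ X≐ ]′ (∈+⁻ (_≐_.⊇ Xu≐ x∈))

    private
      pathᴴ : ∀ {l r J} → X ≐ J → G.Path l r J → H.Path l r J
      pathᴴ X≐ = Path-resp (Splitting.from S) (Splitting.to S)
        where S = splitting′ X≐

    cycleᴴ⇒¬solid : CycleOn H Xu → ¬ SolidOn H Xu
    cycleᴴ⇒¬solid c = let J , l , r , h , T≐ = hoopOn c (∈+⁺ (inj₁ refl)) in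
      path⇒¬solid (≐-+⁻ u∉X (H.Hoop.w∉p h) T≐) (H.Hoop.path h)

    cycleᵘ⇒¬solid : CycleOn G Xu → ¬ SolidOn H Xu
    cycleᵘ⇒¬solid c = let J , l , r , h , X≐ = hoopᵘ c in path⇒¬solid X≐ (pathᴴ X≐ (G.Hoop.path h))

    cycleᵛ⇒¬solid : CycleOn G Xv → ¬ SolidOn H Xu
    cycleᵛ⇒¬solid c = let J , l , r , h , X≐ = hoopᵛ c in path⇒¬solid X≐ (pathᴴ X≐ (G.Hoop.path h))

    private
      contracted : ∀ {a b l r J} → X ≐ J → Splitting H G u a b J → ¬ Extra G a b J → G.Hoop a l r J →
                   CycleOn H Xu
      contracted {a} {b} {l} {r} {J} X≐ S none h = cyc⇒cycleOn H Xu (H.hoop⇒cyc record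
        { path = Path-resp from to path
        ; w∉p = w∉ ; l≢r = l≢r
        ; w~l = u⇒ (First⇒∈ (G.Path.start path)) w~l
        ; w~r = u⇒ (Last⇒∈ (G.Path.end path)) w~r
        ; w~⇒ = λ {x} x∈ e → w~⇒ x∈ (case w⇒ x∈ e of λ
          { (inj₁ a~x) → a~x
          ; (inj₂ b~x) → decidable-stable (a ~? x) λ a≁x → none (x , x∈ , b~x , a≁x) })
        }) (≐-+ X≐)
        where
        open G.Hoop h
        open Splitting S

      -- A neighbour `y` of `b` that `a` lacks gives `b` two nonadjacent neighbours, `a` and `y`, on
      -- the cycle through `a`. If there is none, `b` adds nothing to the neighbours of `a` and the
      -- contraction preserves the cycle.
      cycle-alternative : ∀ {a b l r J} → X ≐ J → Splitting H G u a b J → G.Hoop a l r J →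
                          CycleOn H Xu ⊎ EarOn G (b ∷ a ∷ J)
      cycle-alternative {a} {b} {J = J} X≐ S h with extra? G a b J
      ... | no none = inj₁ (contracted X≐ S none h)
      ... | yes (y , y∈ , b~y , a≁y) =
        inj₂ (EarOn-↭ (↭-sym (↭.∷↭∷ʳ b (a ∷ J))) (a ∷ J , b ∷ [] , b , b , record
              { cyc = G.hoop⇒cyc h
              ; path = G.Path-[]
              ; apart = λ { (here refl , here refl) → ~-irrefl u~v ; (here refl , there b∈) → v∉ b∈ }
              ; inner = λ { (here refl) _ _ → inj₁ refl }
              ; ends = single refl (far (nbr (here refl) (~-sym u~v)) (nbr (there y∈) b~y)
                  (λ { refl → u∉ y∈ }) a≁y)
              } , ↭-refl))
        where open Splitting S

    cycleᵘ-alternative : CycleOn G Xu → CycleOn H Xu ⊎ SolidOn G Xuv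
    cycleᵘ-alternative c = let J , l , r , h , X≐ = hoopᵘ c in
      Sum.map₂ (λ E → earOn⇒solidOn G Xuv (EarOn-↭ (swap _ _ ↭-refl) E) (≐-+ (≐-+ X≐)))
        (cycle-alternative X≐ (splitting′ X≐) h)

    cycleᵛ-alternative : CycleOn G Xv → CycleOn H Xu ⊎ SolidOn G Xuv
    cycleᵛ-alternative c = let J , l , r , h , X≐ = hoopᵛ c in
      Sum.map₂ (λ E → earOn⇒solidOn G Xuv E (≐-+ (≐-+ X≐)))
        (cycle-alternative X≐ (flip-Splitting (splitting′ X≐)) h)

    private
      -- If `x` were adjacent to `a` but not to `b`, then both neighbours of `x` on the cycle
      -- through `b` would lie in the common part, and with `a` they would be three neighbours of
      -- `x` on the cycle through `a`.
      twin : ∀ {a b l r l′ r′ J J′} → G.Hoop a l r J → G.Hoop b l′ r′ J′ →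
             (∀ {x} → x ∈ J → x ∈ J′) → (∀ {x} → x ∈ J′ → x ∈ J) → ∀ {x} → x ∈ J → a ~ x → b ~ x
      twin {a} {b} {J = J} {J′} h h′ ⊆ ⊇ {x} x∈ a~x = decidable-stable (b ~? x) λ b≁x →
        let y , z , y∈ , z∈ , y≢z , x~y , x~z = cycle-nbrs (G.hoop⇒cyc h′) (there (⊆ x∈))
            inJ = λ {y} (y∈ : y ∈ b ∷ J′) (x~y : x ~ y) → case y∈ of λ
              { (here refl) → contradiction (~-sym x~y) b≁x ; (there y∈) → ⊇ y∈ }
            y∈J = inJ y∈ x~y
            z∈J = inJ z∈ x~z
        in no-third (G.hoop⇒cyc h) (there x∈) (there y∈J) (there z∈J) (here refl) y≢z
          (λ { refl → G.Hoop.w∉p h y∈J }) (λ { refl → G.Hoop.w∉p h z∈J }) x~y x~z (~-sym a~x)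

    -- By `twin` both vertices have the same neighbours `l` and `r` in `X`, so the contraction keeps
    -- the cycle, and `v` sees the three vertices `u`, `l` and `r` of the cycle through `u`.
    two-cycles : CycleOn G Xu → CycleOn G Xv → CycleOn H Xu × SolidOn G Xuv
    two-cycles cᵘ cᵛ with hoopᵘ cᵘ | hoopᵛ cᵛ
    ... | J , l , r , h , X≐ | J′ , l′ , r′ , h′ , X≐′ =
      contracted X≐ (splitting′ X≐)
        (λ (x , x∈ , v~x , u≁x) → u≁x (twin h′ h (λ k → ⊆ (⊇′ k)) (λ k → ⊆′ (⊇ k)) (⊆′ (⊇ x∈)) v~x)) h ,
      earOn⇒solidOn G Xuv (EarOn-↭ (↭-sym (↭.∷↭∷ʳ v (u ∷ J))) (u ∷ J , v ∷ [] , v , v , record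
        { cyc = G.hoop⇒cyc h
        ; path = G.Path-[]
        ; apart = λ { (here refl , here refl) → ~-irrefl e ; (here refl , there v∈) → v∉X (⊇ v∈) }
        ; inner = λ { (here refl) _ _ → inj₁ refl }
        ; ends = single refl (three (nbr (here refl) (~-sym e))
            (nbr (there l∈) (v~ l∈ (G.Hoop.w~l h))) (nbr (there r∈) (v~ r∈ (G.Hoop.w~r h)))
            (λ { refl → u∉X (⊇ l∈) }) (λ { refl → u∉X (⊇ r∈) }) (G.Hoop.l≢r h))
        } , ↭-refl)) (≐-↭ (≐-+ (≐-+ X≐)) (swap _ _ ↭-refl))
      where
      open _≐_ X≐
      open _≐_ X≐′ using () renaming (⊆ to ⊆′; ⊇ to ⊇′)
      l∈ = First⇒∈ (G.Path.start (G.Hoop.path h))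
      r∈ = Last⇒∈ (G.Path.end (G.Hoop.path h))
      v~ : ∀ {x} → x ∈ J → u ~ x → v ~ x
      v~ = twin h h′ (λ k → ⊆′ (⊇ k)) (λ k → ⊆ (⊇′ k))

    -- An induced cycle without one of its vertices is an induced path, and a path contains no
    -- cycle.
    whole⇒¬cycleᵛ : CycleOn G Xuv → ¬ CycleOn G Xv
    whole⇒¬cycleᵛ c c′ with hoopOn c (∈+⁺ (inj₁ refl)) | cycleOn⇒cyc G Xv c′
    ... | J , l , r , h , T≐ | C , cyc , ≐C = acyclic-path (G.Hoop.path h) cyc λ x∈ →
      case _≐_.⊆ T≐ (∈+⁺ (inj₂ (_≐_.⊇ ≐C x∈))) of λ
        { (here refl) → contradiction (_≐_.⊇ ≐C x∈) u∉+v ; (there x∈) → x∈ }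

    whole⇒¬cycleᵘ : CycleOn G Xuv → ¬ CycleOn G Xu
    whole⇒¬cycleᵘ c c′ with hoopOn {w = v} c (∈+⁺ (inj₂ (∈+⁺ (inj₁ refl)))) | cycleOn⇒cyc G Xu c′
    ... | J , l , r , h , T≐ | C , cyc , ≐C = acyclic-path (G.Hoop.path h) cyc λ x∈ →
      case _≐_.⊆ T≐ (∈+⁺ (Sum.map₂ (∈+⁺ ∘ inj₂) (∈+⁻ (_≐_.⊇ ≐C x∈)))) of λ
        { (here refl) → contradiction (∈+⁻ (_≐_.⊇ ≐C x∈)) [ u≢v ∘ sym , v∉X ]′ ; (there x∈) → x∈ }

    Apex : Set
    Apex = ∃[ x ] u ~ x × v ~ x × X ≐ x ∷ []

    -- The contraction shortens the cycle by one, which only a triangle does not survive. Removing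
    -- `u` and then its neighbour `v` leaves a path from `y` to `r`, and `y` equals `r` exactly for
    -- a triangle.
    whole-contracts : CycleOn G Xuv → CycleOn H Xu ⊎ Apex
    whole-contracts c with hoopOn c (∈+⁺ (inj₁ refl))
    ... | J , l , r , h , T≐ = case G.Hoop.w~⇒ h v∈ e of λ
      { (inj₁ refl) → go h ≐′
      ; (inj₂ refl) → go (G.hoop-reverse h) (≐-↭ ≐′ (↭-sym (↭.↭-reverse J))) }
      where
      ≐′ : X +ˢ v ≐ J
      ≐′ = ≐-+⁻ u∉+v (G.Hoop.w∉p h) T≐
      v∈ : v ∈ J
      v∈ = _≐_.⊆ ≐′ (∈+⁺ (inj₁ refl))
      go : ∀ {r J} → G.Hoop u v r J → X +ˢ v ≐ J → CycleOn H Xu ⊎ Apex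
      go {r} h ≐J with G.Path.start (G.Hoop.path h) | G.Path.end (G.Hoop.path h)
      ... | first | last = contradiction refl (G.Hoop.l≢r h)
      ... | first {p = y ∷ p} | there end = by-end (y ≟ r) end
        where
        open G.Hoop h
        tail = Path-tail path
        v~y : v ~ y
        v~y = proj₁ (proj₂ tail)
        π : G.Path y r (y ∷ p)
        π = proj₁ (proj₂ (proj₂ tail))
        X≐ : X ≐ y ∷ p
        X≐ = ≐-+⁻ v∉X (Unique-head (G.Path.unique path)) ≐J
        open Splitting (splitting′ X≐) hiding (u~v)
        by-end : Dec (y ≡ r) → Last (y ∷ p) r → CycleOn H Xu ⊎ Apex
        by-end (no y≢r) _ = inj₁ (cyc⇒cycleOn H Xu (H.hoop⇒cyc record
          { path = pathᴴ X≐ π ; w∉p = w∉ ; l≢r = y≢r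
          ; w~l = v⇒ (here refl) v~y ; w~r = u⇒ (Last⇒∈ end) w~r
          ; w~⇒ = λ x∈ e → case w⇒ x∈ e of λ
            { (inj₁ u~x) → [ (λ { refl → contradiction x∈ v∉ }) , inj₂ ]′ (w~⇒ (there x∈) u~x)
            ; (inj₂ v~x) → inj₁ (proj₂ (proj₂ (proj₂ tail)) x∈ v~x) }
          }) (≐-+ X≐))
        by-end (yes refl) last = inj₂ (y , w~r , v~y , X≐)
        by-end (yes refl) (there m) = contradiction (Last⇒∈ m) (Unique-head (G.Path.unique π))

    solid-lifts : SolidOn H X → SolidOn G X
    solid-lifts solid with solidOn⇒ear H X solid (proj₂ (solidOn-nonempty H X solid))
    ... | C , Q , s , t , E , _ , X≐ = earOn⇒solidOn G X (EarOn-resp to from (C , Q , s , t , E , ↭-refl)) X≐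
      where open Splitting (splitting′ X≐)

    cycle-descends : CycleOn G X → CycleOn H X
    cycle-descends c with cycleOn⇒cyc G X c
    ... | C , cyc , X≐ = cyc⇒cycleOn H X (Cyc-resp from to cyc) X≐
      where open Splitting (splitting′ X≐)

-- Counting

𝟙 : {P : Set} → Dec P → ℕ
𝟙 (yes _) = 1
𝟙 (no _)  = 0

𝟙-mono : {P Q : Set} {p : Dec P} {q : Dec Q} → (P → Q) → 𝟙 p ℕ.≤ 𝟙 q
𝟙-mono {p = no _}              _ = z≤n
𝟙-mono {p = yes p} {q = yes _} _ = s≤s z≤n
𝟙-mono {p = yes p} {q = no ¬q} f = contradiction (f p) ¬q

𝟙-yes : {P : Set} (d : Dec P) → P → 1 ℕ.≤ 𝟙 d
𝟙-yes d p = 𝟙-mono {p = yes p} {q = d} λ p → p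

𝟙-no : {P : Set} (d : Dec P) → ¬ P → 𝟙 d ≡ 0
𝟙-no (yes p) ¬p = contradiction p ¬p
𝟙-no (no _)  _  = refl

-- The recursion follows that of `subsets`, which makes filtered lengths into sums of indicators.
∑ : ∀ {n} → (Subset n → ℕ) → ℕ
∑ {zero}  f = f []
∑ {suc n} f = ∑ (f ∘ (outside ∷_)) ℕ.+ ∑ (f ∘ (inside ∷_))

∑-cong : ∀ {n} {f g : Subset n → ℕ} → (∀ S → f S ≡ g S) → ∑ f ≡ ∑ g
∑-cong {zero}  eq = eq []
∑-cong {suc n} eq = cong₂ ℕ._+_ (∑-cong (eq ∘ (outside ∷_))) (∑-cong (eq ∘ (inside ∷_)))

∑-mono : ∀ {n} {f g : Subset n → ℕ} → (∀ S → f S ℕ.≤ g S) → ∑ f ℕ.≤ ∑ g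
∑-mono {zero}  le = le []
∑-mono {suc n} le = ℕ.+-mono-≤ (∑-mono (le ∘ (outside ∷_))) (∑-mono (le ∘ (inside ∷_)))

∑-+ : ∀ {n} (f g : Subset n → ℕ) → ∑ (λ S → f S ℕ.+ g S) ≡ ∑ f ℕ.+ ∑ g
∑-+ {zero}  f g = refl
∑-+ {suc n} f g rewrite ∑-+ (f ∘ (outside ∷_)) (g ∘ (outside ∷_)) | ∑-+ (f ∘ (inside ∷_)) (g ∘ (inside ∷_)) =
  interchange (∑ (f ∘ (outside ∷_))) (∑ (g ∘ (outside ∷_))) (∑ (f ∘ (inside ∷_))) (∑ (g ∘ (inside ∷_)))
  where
  interchange : ∀ a b c d → (a ℕ.+ b) ℕ.+ (c ℕ.+ d) ≡ (a ℕ.+ c) ℕ.+ (b ℕ.+ d)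
  interchange = solve-∀

∑-0 : ∀ n → ∑ {n} (λ _ → 0) ≡ 0
∑-0 zero    = refl
∑-0 (suc n) rewrite ∑-0 n = refl

-- Sets containing i are counted at the set without i.
fold : ∀ {n} → Fin n → (Subset n → ℕ) → Subset n → ℕ
fold i f S = if lookup S i then 0 else f S ℕ.+ f (S +ˢ i)

∑-fold : ∀ {n} i (f : Subset n → ℕ) → ∑ f ≡ ∑ (fold i f)
∑-fold {suc n} zero f
  rewrite ∑-+ (f ∘ (outside ∷_)) (f ∘ (inside ∷_)) | ∑-0 n = sym (ℕ.+-identityʳ _)
∑-fold (suc i) f = cong₂ ℕ._+_ (∑-fold i (f ∘ (outside ∷_))) (∑-fold i (f ∘ (inside ∷_)))

-- Folding at `u` and then at `v` groups the subsets into fours with the same trace outside `u` and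
-- `v`, so an inequality may be checked for each trace.
∑-fold₂-mono : ∀ {n} {u v : Fin n} (f g : Subset n → ℕ) → u ≢ v →
  (∀ S → u ∉ˢ S → v ∉ˢ S →
    f S ℕ.+ f (S +ˢ u) ℕ.+ (f (S +ˢ v) ℕ.+ f (S +ˢ v +ˢ u)) ℕ.≤
    g S ℕ.+ g (S +ˢ u) ℕ.+ (g (S +ˢ v) ℕ.+ g (S +ˢ v +ˢ u))) → ∑ f ℕ.≤ ∑ g
∑-fold₂-mono {u = u} {v} f g u≢v le = begin
  ∑ f                   ≡⟨ ∑-fold u f ⟩
  ∑ (fold u f)          ≡⟨ ∑-fold v (fold u f) ⟩
  ∑ (fold v (fold u f)) ≤⟨ ∑-mono pointwise ⟩
  ∑ (fold v (fold u g)) ≡⟨ ∑-fold v (fold u g) ⟨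
  ∑ (fold u g)          ≡⟨ ∑-fold u g ⟨
  ∑ g                   ∎
  where
  open ℕ.≤-Reasoning
  ∉ : ∀ {S : Subset _} {i} → lookup S i ≡ outside → i ∉ˢ S
  ∉ out i∈ = case trans (sym out) ([]=⇒lookup i∈) of λ ()
  pointwise : ∀ S → fold v (fold u f) S ℕ.≤ fold v (fold u g) S
  pointwise S with lookup S v in v-eq
  ... | inside  = z≤n
  ... | outside rewrite lookup∘update′ u≢v S inside with lookup S u in u-eq
  ...   | inside  = z≤n
  ...   | outside = le S (∉ u-eq) (∉ v-eq)

length-filter-map : ∀ {A B : Set} {P : B → Set} (P? : Decidable P) (f : A → B) xs →
                    length (filter P? (map f xs)) ≡ length (filter (P? ∘ f) xs)
length-filter-map P? f [] = refl
length-filter-map P? f (x ∷ xs) with does (P? (f x))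
... | true  = cong suc (length-filter-map P? f xs)
... | false = length-filter-map P? f xs

length-filter-subsets : ∀ n {P : Subset n → Set} (P? : Decidable P) →
                        length (filter P? (subsets n)) ≡ ∑ (𝟙 ∘ P?)
length-filter-subsets zero P? with P? []
... | yes _ = refl
... | no _  = refl
length-filter-subsets (suc n) P?
  rewrite List.filter-++ P? (map (outside ∷_) (subsets n)) (map (inside ∷_) (subsets n))
        | List.length-++ (filter P? (map (outside ∷_) (subsets n))) {filter P? (map (inside ∷_) (subsets n))}
        | length-filter-map P? (outside ∷_) (subsets n) | length-filter-map P? (inside ∷_) (subsets n) =
  cong₂ ℕ._+_ (length-filter-subsets n (P? ∘ (outside ∷_))) (length-filter-subsets n (P? ∘ (inside ∷_)))

Unique-subsets : ∀ n → Unique (subsets n)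
Unique-subsets zero    = [] ∷ []
Unique-subsets (suc n) = Unique.++⁺
  (Unique.map⁺ ∷-injectiveʳ (Unique-subsets n)) (Unique.map⁺ ∷-injectiveʳ (Unique-subsets n))
  λ (x∈ , y∈) → case ∈-map⁻ (outside ∷_) x∈ ,′ ∈-map⁻ (inside ∷_) y∈ of λ
    { ((_ , _ , refl) , (_ , _ , ())) }

∣p+x∣≤1+∣p∣ : ∀ {n} (p : Subset n) x → ∣ p +ˢ x ∣ ℕ.≤ suc ∣ p ∣
∣p+x∣≤1+∣p∣ (outside ∷ p) zero    = ℕ.≤-refl
∣p+x∣≤1+∣p∣ (inside  ∷ p) zero    = ℕ.n≤1+n _
∣p+x∣≤1+∣p∣ (outside ∷ p) (suc x) = ∣p+x∣≤1+∣p∣ p x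
∣p+x∣≤1+∣p∣ (inside  ∷ p) (suc x) = s≤s (∣p+x∣≤1+∣p∣ p x)

∣p∣≤1+∣p-x∣ : ∀ {n} (p : Subset n) x → ∣ p ∣ ℕ.≤ suc ∣ p -ˢ x ∣
∣p∣≤1+∣p-x∣ p x = ℕ.≤-trans (p⊆q⇒∣p∣≤∣q∣ p⊆) (∣p+x∣≤1+∣p∣ (p -ˢ x) x)
  where
  p⊆ : p ⊆ˢ (p -ˢ x) +ˢ x
  p⊆ {y} y∈ with y ≟ x
  ... | yes y≡x = ∈+⁺ (inj₁ y≡x)
  ... | no y≢x  = ∈+⁺ (inj₂ (x∈p∧x≢y⇒x∈p-y y∈ y≢x))

x∉p-x : ∀ {n} (p : Subset n) x → x ∉ˢ p -ˢ x
x∉p-x p x x∈ = case trans (sym ([]=⇒lookup x∈)) (removed _ λ _ → refl) of λ ()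
  where
  -- Removal of `x` is a pointwise operation with the singleton of `x`; all that counts is that it
  -- yields `outside` wherever the singleton is `inside`.
  removed : ∀ f → (∀ b → f b inside ≡ outside) → lookup (Vec.zipWith f p ⁅ x ⁆) x ≡ outside
  removed f out = trans (lookup-zipWith f x p ⁅ x ⁆)
    (trans (cong (f _) ([]=⇒lookup (x∈⁅x⁆ x))) (out _))

-- The count for one trace X. `A` says that X+w is a solid and `E` that it is an induced cycle, both
-- after the contraction; `B`, `C`, `D` say that X+u, X+v, X+u+v are induced cycles before it; `T`
-- is the case of a triangle on e, and `n` is the number of solids on the three sets. Of `A` to `D`
-- at most two hold at once, namely `A` with `D` or `B` with `C`; one of these two is then paid for
-- by `n` and the other by `E` or `T`.
local-count : {A B C D E T : Set} (s′ : Dec A) (cᵘ : Dec B) (cᵛ : Dec C) (cᵘᵛ : Dec D) (c′ : Dec E)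
  (τ : Dec T) (n : ℕ) →
  (A → 1 ℕ.≤ n) → (B → E ⊎ 1 ℕ.≤ n) → (C → E ⊎ 1 ℕ.≤ n) → (B → C → E × 1 ℕ.≤ n) → (D → E ⊎ T) →
  (D → ¬ B) → (D → ¬ C) → (E → ¬ A) → (B → ¬ A) → (C → ¬ A) →
  𝟙 s′ ℕ.+ 𝟙 cᵘ ℕ.+ 𝟙 cᵛ ℕ.+ 𝟙 cᵘᵛ ℕ.≤ n ℕ.+ (𝟙 c′ ℕ.+ 𝟙 τ)
local-count {E = E} {T} s′ cᵘ cᵛ cᵘᵛ c′ τ n A⇒ B⇒ C⇒ BC⇒ D⇒ D¬B D¬C E¬A B¬A C¬A = go s′ cᵘ cᵛ cᵘᵛ
  where
  from-n : 1 ℕ.≤ n → 1 ℕ.≤ n ℕ.+ (𝟙 c′ ℕ.+ 𝟙 τ)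
  from-n 1≤n = ℕ.≤-trans 1≤n (ℕ.m≤m+n n _)
  from-E : E → 1 ℕ.≤ 𝟙 c′ ℕ.+ 𝟙 τ
  from-E e = ℕ.≤-trans (𝟙-yes c′ e) (ℕ.m≤m+n _ _)
  from-T : T → 1 ℕ.≤ 𝟙 c′ ℕ.+ 𝟙 τ
  from-T t = ℕ.≤-trans (𝟙-yes τ t) (ℕ.m≤n+m _ _)
  alternative : E ⊎ 1 ℕ.≤ n → 1 ℕ.≤ n ℕ.+ (𝟙 c′ ℕ.+ 𝟙 τ)
  alternative (inj₁ e)   = ℕ.≤-trans (from-E e) (ℕ.m≤n+m _ n)
  alternative (inj₂ 1≤n) = from-n 1≤n
  go : ∀ s′ cᵘ cᵛ cᵘᵛ → 𝟙 s′ ℕ.+ 𝟙 cᵘ ℕ.+ 𝟙 cᵛ ℕ.+ 𝟙 cᵘᵛ ℕ.≤ n ℕ.+ (𝟙 c′ ℕ.+ 𝟙 τ)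
  go _       (yes b) _       (yes d) = contradiction b (D¬B d)
  go _       _       (yes c) (yes d) = contradiction c (D¬C d)
  go (yes a) (yes b) _       _       = contradiction a (B¬A b)
  go (yes a) _       (yes c) _       = contradiction a (C¬A c)
  go (yes a) (no _)  (no _)  (yes d) = ℕ.+-mono-≤ (A⇒ a) ([ from-E , from-T ]′ (D⇒ d))
  go (yes a) (no _)  (no _)  (no _)  = from-n (A⇒ a)
  go (no _)  (no _)  (no _)  (no _)  = z≤n
  go (no _)  (no _)  (no _)  (yes d) = ℕ.≤-trans ([ from-E , from-T ]′ (D⇒ d)) (ℕ.m≤n+m _ n)
  go (no _)  (yes b) (yes c) (no _)  = let e , 1≤n = BC⇒ b c in ℕ.+-mono-≤ 1≤n (from-E e)
  go (no _)  (yes b) (no _)  (no _)  = alternative (B⇒ b)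
  go (no _)  (no _)  (yes c) (no _)  = alternative (C⇒ c)

-- Edges lost in the contraction

module _ {N : ℕ} where

  norm : Fin N → Fin N → Fin N × Fin N
  norm x y with x <? y
  ... | yes _ = x , y
  ... | no _  = y , x

  norm-view : ∀ {x y} → x ≢ y → norm x y ≡ (x , y) × x < y ⊎ norm x y ≡ (y , x) × y < x
  norm-view {x} {y} x≢y with x <? y
  ... | yes x<y = inj₁ (refl , x<y)
  ... | no x≮y with <-cmp x y
  ...   | tri< x<y _ _   = contradiction x<y x≮y
  ...   | tri≈ _ x≡y _   = contradiction x≡y x≢y
  ...   | tri> _ _ y<x   = inj₂ (refl , y<x)

  norm-< : ∀ {x y} → x < y → norm x y ≡ (x , y)
  norm-< {x} {y} x<y with x <? y
  ... | yes _  = refl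
  ... | no x≮y = contradiction x<y x≮y

  norm-comm : ∀ {x y} → x ≢ y → norm x y ≡ norm y x
  norm-comm x≢y with norm-view x≢y
  ... | inj₁ (eq , x<y) = trans eq (sym (trans (norm-comm′ x<y) refl))
    where
    norm-comm′ : ∀ {x y} → x < y → norm y x ≡ (x , y)
    norm-comm′ {x} {y} x<y with norm-view {y} {x} (λ { refl → <-irrefl refl x<y })
    ... | inj₁ (_ , y<x) = contradiction (<-trans x<y y<x) (<-irrefl refl)
    ... | inj₂ (eq , _)  = eq
  ... | inj₂ (eq , y<x) = trans eq (sym (norm-< y<x))

  norm-cancelˡ : ∀ {a x y} → a ≢ x → a ≢ y → norm a x ≡ norm a y → x ≡ y
  norm-cancelˡ a≢x a≢y eq with norm-view a≢x | norm-view a≢y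
  ... | inj₁ (p , _) | inj₁ (q , _) = cong proj₂ (trans (sym p) (trans eq q))
  ... | inj₂ (p , _) | inj₂ (q , _) = cong proj₁ (trans (sym p) (trans eq q))
  ... | inj₁ (p , _) | inj₂ (q , _) = contradiction (cong proj₁ (trans (sym p) (trans eq q))) a≢y
  ... | inj₂ (p , _) | inj₁ (q , _) = contradiction (cong proj₁ (trans (sym q) (trans (sym eq) p))) a≢x

  ∈-norm : ∀ a b → (proj₁ (norm a b) ≡ a ⊎ proj₂ (norm a b) ≡ a)
  ∈-norm a b with a <? b
  ... | yes _ = inj₁ refl
  ... | no _  = inj₂ refl

  norm-diagonal : ∀ x → norm x x ≡ (x , x)
  norm-diagonal x with x <? x
  ... | yes _ = refl
  ... | no _  = refl

∈-edges⁺ : ∀ {N} {G : Graph N} {x y} → x < y → Graph._~_ G x y → (x , y) ∈ edges G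
∈-edges⁺ {G = G} x<y e =
  ∈-filter⁺ (λ (x , y) → (x <? y) ×-dec Graph._~?_ G x y)
    (∈-cartesianProduct⁺ (∈-allFin _) (∈-allFin _)) (x<y , e)

∈-edges⁻ : ∀ {N} (G : Graph N) {p} → p ∈ edges G → proj₁ p < proj₂ p × Graph._~_ G (proj₁ p) (proj₂ p)
∈-edges⁻ {N} G p∈ =
  proj₂ (∈-filter⁻ (λ (x , y) → (x <? y) ×-dec Graph._~?_ G x y)
    {xs = cartesianProduct (allFin N) (allFin N)} p∈)

Unique-edges : ∀ {N} (G : Graph N) → Unique (edges G)
Unique-edges {N} G = Unique.filter⁺ (λ (x , y) → (x <? y) ×-dec Graph._~?_ G x y)
  (Unique.cartesianProduct⁺ (Unique.allFin⁺ N) (Unique.allFin⁺ N))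

module Edges {N : ℕ} (G : Graph N) {u v : Fin N} (e : Graph._~_ G u v) where

  open Graph G using (_~_; _~?_; ~-sym; ~-irrefl)
  open Induced G using (~⇒≢)
  private
    H = contract G e
  open Graph H using () renaming (_~_ to _≈_)

  common? : Decidable (λ x → u ~ x × v ~ x)
  common? x = (u ~? x) ×-dec (v ~? x)

  commons : List (Fin N)
  commons = filter common? (allFin N)

  -- An edge of the contraction is sent to an edge of `G` that contracts to it: to itself if
  -- possible, otherwise with `v` in place of its end `u`. In the last branch that end is `y`.
  lift : Fin N × Fin N → Fin N × Fin N
  lift (x , y) = if does (x ~? y) then (x , y) else (if does (x ≟ u) then norm v y else norm x v)

  project : Fin N × Fin N → Fin N × Fin N
  project (a , b) = norm (rename v u a) (rename v u b)

  project-norm : ∀ {a b} → a ≢ b → rename v u a ≢ rename v u b →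
                 project (norm a b) ≡ norm (rename v u a) (rename v u b)
  project-norm a≢b ρa≢ρb with norm-view a≢b
  ... | inj₁ (eq , _) rewrite eq = refl
  ... | inj₂ (eq , _) rewrite eq = norm-comm (ρa≢ρb ∘ sym)

  data Lift (x y : Fin N) : Set where
    direct : x ~ y → lift (x , y) ≡ (x , y) → Lift x y
    left   : ¬ x ~ y → x ≡ u → v ~ y → lift (x , y) ≡ norm v y → Lift x y
    right  : ¬ x ~ y → y ≡ u → v ~ x → lift (x , y) ≡ norm v x → Lift x y

  lift-view : ∀ {x y} → x ≈ y → Lift x y
  lift-view {x} {y} (x≢v , y≢v , x≢y , adj) with x ~? y in eq | x ≟ u in eq′ | adj
  ... | yes x~y | _        | _ = direct x~y (lemma x~y)
    where
    lemma : x ~ y → lift (x , y) ≡ (x , y)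
    lemma _ rewrite eq = refl
  ... | no x≁y  | _        | inj₁ x~y = contradiction x~y x≁y
  ... | no x≁y  | no x≢u   | inj₂ (inj₁ (x≡u , _)) = contradiction x≡u x≢u
  ... | no x≁y  | yes refl | inj₂ (inj₁ (_ , v~y)) = left x≁y refl v~y lemma
    where
    lemma : lift (x , y) ≡ norm v y
    lemma rewrite eq | eq′ = refl
  ... | no x≁y  | yes refl | inj₂ (inj₂ (y≡u , _)) = contradiction (sym y≡u) x≢y
  ... | no x≁y  | no x≢u   | inj₂ (inj₂ (y≡u , x~v)) = right x≁y y≡u (~-sym x~v) (trans lemma (norm-comm x≢v))
    where
    lemma : lift (x , y) ≡ norm x v
    lemma rewrite eq | eq′ = refl

  project-v : ∀ {z} → z ≢ v → z ≢ u → project (norm v z) ≡ norm u z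
  project-v {z} z≢v z≢u = trans
    (project-norm (z≢v ∘ sym) λ eq → z≢u (trans (sym (rename-≢ z≢v)) (trans (sym eq) (rename-same v u))))
    (cong₂ norm (rename-same v u) (rename-≢ z≢v))

  project-lift : ∀ {x y} → x < y → x ≈ y → project (lift (x , y)) ≡ (x , y)
  project-lift {x} {y} x<y x≈y@(x≢v , y≢v , x≢y , _) with lift-view x≈y
  ... | direct _ eq rewrite eq | rename-≢ {w = v} {z = u} x≢v | rename-≢ {w = v} {z = u} y≢v = norm-< x<y
  ... | left _ refl _ eq rewrite eq = trans (project-v y≢v (x≢y ∘ sym)) (norm-< x<y)
  ... | right _ refl _ eq rewrite eq =
    trans (project-v x≢v x≢y) (trans (norm-comm (x≢y ∘ sym)) (norm-< x<y))

  norm-edge : ∀ {a b} → a ~ b → norm a b ∈ edges G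
  norm-edge a~b with norm-view (~⇒≢ a~b)
  ... | inj₁ (eq , a<b) rewrite eq = ∈-edges⁺ {G = G} a<b a~b
  ... | inj₂ (eq , b<a) rewrite eq = ∈-edges⁺ {G = G} b<a (~-sym a~b)

  lift-edge : ∀ {p} → p ∈ edges H → lift p ∈ edges G
  lift-edge p∈ with ∈-edges⁻ H p∈
  ... | x<y , x≈y with lift-view x≈y
  ...   | direct x~y eq   rewrite eq = ∈-edges⁺ {G = G} x<y x~y
  ...   | left _ _ v~y eq rewrite eq = norm-edge v~y
  ...   | right _ _ v~x eq rewrite eq = norm-edge v~x

  -- Lifting is injective because projecting undoes it. Its image misses the edge `uv`, and also
  -- each edge from `v` to a common neighbour `z`, since the edge `uz` is preferred as a lift.
  edge-count : length (edges H) ℕ.+ suc (length commons) ℕ.≤ length (edges G)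
  edge-count = subst (ℕ._≤ length (edges G))
    (trans (List.length-++ (map lift (edges H)))
      (cong₂ (λ a b → a ℕ.+ suc b) (List.length-map lift (edges H)) (List.length-map (norm v) commons)))
    (length-≤ unique ⊆edges)
    where
    common⁻ : ∀ {x} → x ∈ commons → u ~ x × v ~ x
    common⁻ x∈ = proj₂ (∈-filter⁻ common? {xs = allFin N} x∈)
    project-e : project (norm u v) ≡ (u , u)
    project-e with norm-view (~⇒≢ e)
    ... | inj₁ (eq , _) rewrite eq | rename-same v u | rename-≢ {w = v} {z = u} (~⇒≢ e) = norm-diagonal u
    ... | inj₂ (eq , _) rewrite eq | rename-same v u | rename-≢ {w = v} {z = u} (~⇒≢ e) = norm-diagonal u
    lift≢e : ∀ {p} → p ∈ edges H → lift p ≢ norm u v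
    lift≢e p∈ eq with ∈-edges⁻ H p∈
    -- Projected, the edge `uv` becomes a loop at `u`, which is not an edge of the contraction.
    ... | x<y , x≈y with trans (sym (project-lift x<y x≈y)) (trans (cong project eq) project-e)
    ...   | refl = <-irrefl refl x<y
    lift≢common : ∀ {p z} → p ∈ edges H → z ∈ commons → lift p ≢ norm v z
    lift≢common {x , y} {z} p∈ z∈ eq with ∈-edges⁻ H p∈ | common⁻ z∈
    ... | x<y , x≈y@(x≢v , y≢v , _) | u~z , v~z = direct-only (lift-view x≈y)
      where
      u≢z = ~⇒≢ u~z
      -- An edge lifted to `vz` would have to be `uz`. That is an edge of `G`, hence its own lift,
      -- and does not contain `v`.
      p≡ : (x , y) ≡ norm u z
      p≡ = trans (sym (project-lift x<y x≈y)) (trans (cong project eq)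
             (project-v (~⇒≢ v~z ∘ sym) (u≢z ∘ sym)))
      x~y : x ~ y
      x~y with norm-view u≢z
      ... | inj₁ (eq , _) with refl ← trans p≡ eq = u~z
      ... | inj₂ (eq , _) with refl ← trans p≡ eq = ~-sym u~z
      direct-only : Lift x y → ⊥
      direct-only (left x≁y _ _ _)  = x≁y x~y
      direct-only (right x≁y _ _ _) = x≁y x~y
      direct-only (direct _ eq′) =
        [ (λ k → x≢v (trans (cong proj₁ q) k)) , (λ k → y≢v (trans (cong proj₂ q) k)) ]′ (∈-norm v z)
        where
        q : (x , y) ≡ norm v z
        q = trans (sym eq′) eq
    common≢e : ∀ {z} → z ∈ commons → norm u v ≢ norm v z
    common≢e z∈ eq = let u~z , v~z = common⁻ z∈ in
      ~⇒≢ u~z (norm-cancelˡ (~⇒≢ (~-sym e)) (~⇒≢ v~z) (trans (norm-comm (~⇒≢ (~-sym e))) eq))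
    unique : Unique (map lift (edges H) ++ norm u v ∷ map (norm v) commons)
    unique = Unique.++⁺
      (Unique-map lift
        (λ p∈ q∈ eq → let p< , p≈ = ∈-edges⁻ H p∈ ; q< , q≈ = ∈-edges⁻ H q∈ in
          trans (sym (project-lift p< p≈)) (trans (cong project eq) (project-lift q< q≈)))
        (Unique-edges H))
      (All.tabulate (λ m eq → let _ , z∈ , eq′ = ∈-map⁻ (norm v) m in common≢e z∈ (trans eq eq′))
        ∷ Unique-map (norm v)
            (λ x∈ y∈ → norm-cancelˡ (~⇒≢ (proj₂ (common⁻ x∈))) (~⇒≢ (proj₂ (common⁻ y∈))))
            (Unique.filter⁺ common? (Unique.allFin⁺ N)))
      λ (a , b) → case ∈-map⁻ lift a ,′ b of λ
        { ((_ , p∈ , refl) , here eq) → lift≢e p∈ eq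
        ; ((_ , p∈ , refl) , there m) → let _ , z∈ , eq = ∈-map⁻ (norm v) m in lift≢common p∈ z∈ eq }
    ⊆edges : ∀ {p} → p ∈ map lift (edges H) ++ norm u v ∷ map (norm v) commons → p ∈ edges G
    ⊆edges p∈ with ∈-++⁻ (map lift (edges H)) p∈
    ... | inj₁ m with ∈-map⁻ lift m
    ...   | _ , q∈ , refl = lift-edge q∈
    ⊆edges p∈ | inj₂ (here refl) = norm-edge e
    ⊆edges p∈ | inj₂ (there m) with ∈-map⁻ (norm v) m
    ...   | _ , z∈ , refl = norm-edge (proj₂ (common⁻ z∈))

-- Abstract because conversion checking would otherwise unfold these searches.
abstract

  cycle? : ∀ {N} (K : Graph N) S → Dec (CycleOn K S)
  cycle? K S = (S ⊆ˢ? Graph.V K) ×-dec cycleGraph? (K [ S ])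

  solid? : ∀ {N} (K : Graph N) S → Dec (SolidOn K S)
  solid? K S = (S ⊆ˢ? Graph.V K) ×-dec solidGraph? (K [ S ])

  length-inducedCycles : ∀ {N} (K : Graph N) → length (inducedCycles K) ≡ ∑ (λ S → 𝟙 (cycle? K S))
  length-inducedCycles {N} K = length-filter-subsets N (cycle? K)

  length-solids : ∀ {N} (K : Graph N) → length (solids K) ≡ ∑ (λ S → 𝟙 (solid? K S))
  length-solids {N} K = length-filter-subsets N (solid? K)

-- The balance of solids, induced cycles, edges and vertices

module Count {N : ℕ} (G : Graph N) {u v : Fin N} (e : Graph._~_ G u v) where

  open Graph G using (_~_; _~?_) renaming (V to VG)
  open Contraction G e
  open Edges G e using (common?; commons; edge-count)
  private
    H = contract G e

  -- A triangle on e is recorded at its trace, the singleton of its third vertex. The triangles thus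
  -- enter the same sum over subsets as the solids and cycles.
  apex? : ∀ S → Dec (∃[ x ] (u ~ x × v ~ x) × S ≡ ⁅ x ⁆)
  apex? S = any? λ x → common? x ×-dec ≡-dec Bool._≟_ S ⁅ x ⁆

  χˢ χᶜ : Graph N → Subset N → ℕ
  χˢ K S = 𝟙 (solid? K S)
  χᶜ K S = 𝟙 (cycle? K S)

  χᵃ : Subset N → ℕ
  χᵃ S = 𝟙 (apex? S)

  module _ {X : Subset N} (u∉X : u ∉ˢ X) (v∉X : v ∉ˢ X) where

    private
      Xᵘ  = X +ˢ u
      Xᵛ  = X +ˢ v
      Xᵘᵛ = X +ˢ v +ˢ u
      n = χˢ G Xᵘ ℕ.+ χˢ G Xᵛ ℕ.+ χˢ G Xᵘᵛ

      whole : SolidOn G Xᵘᵛ → 1 ℕ.≤ n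
      whole s = ℕ.≤-trans (𝟙-yes (solid? G Xᵘᵛ) s) (ℕ.m≤n+m _ (χˢ G Xᵘ ℕ.+ χˢ G Xᵛ))

      some-solid : SolidOn G Xᵘᵛ ⊎ SolidOn G Xᵘ ⊎ SolidOn G Xᵛ → 1 ℕ.≤ n
      some-solid (inj₁ s) = whole s
      some-solid (inj₂ (inj₁ s)) = ℕ.≤-trans (𝟙-yes (solid? G Xᵘ) s)
        (ℕ.≤-trans (ℕ.m≤m+n _ (χˢ G Xᵛ)) (ℕ.m≤m+n _ (χˢ G Xᵘᵛ)))
      some-solid (inj₂ (inj₂ s)) = ℕ.≤-trans (𝟙-yes (solid? G Xᵛ) s)
        (ℕ.≤-trans (ℕ.m≤n+m _ (χˢ G Xᵘ)) (ℕ.m≤m+n _ (χˢ G Xᵘᵛ)))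

      apex : Apex u∉X v∉X → ∃[ x ] (u ~ x × v ~ x) × X ≡ ⁅ x ⁆
      apex (x , u~x , v~x , X≐) = x , (u~x , v~x) , ⊆-antisym
        (λ y∈ → case ⊆ y∈ of λ { (here refl) → x∈⁅x⁆ x })
        (λ y∈ → ⊇ (here (x∈⁅y⁆⇒x≡y x y∈)))
        where open _≐_ X≐

      core : χˢ H Xᵘ ℕ.+ χᶜ G Xᵘ ℕ.+ χᶜ G Xᵛ ℕ.+ χᶜ G Xᵘᵛ ℕ.≤ n ℕ.+ (χᶜ H Xᵘ ℕ.+ χᵃ X)
      core = local-count (solid? H Xᵘ) (cycle? G Xᵘ) (cycle? G Xᵛ) (cycle? G Xᵘᵛ) (cycle? H Xᵘ) (apex? X) n
        (some-solid ∘ solid-splits u∉X v∉X)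
        (Sum.map₂ whole ∘ cycleᵘ-alternative u∉X v∉X)
        (Sum.map₂ whole ∘ cycleᵛ-alternative u∉X v∉X)
        (λ cᵘ cᵛ → let c , s = two-cycles u∉X v∉X cᵘ cᵛ in c , whole s)
        (Sum.map₂ apex ∘ whole-contracts u∉X v∉X)
        (whole⇒¬cycleᵘ u∉X v∉X) (whole⇒¬cycleᵛ u∉X v∉X)
        (cycleᴴ⇒¬solid u∉X v∉X) (cycleᵘ⇒¬solid u∉X v∉X) (cycleᵛ⇒¬solid u∉X v∉X)

      -- The name `v` is no longer a vertex after the contraction.
      v-absent : ∀ S → v ∈ˢ S → χˢ H S ≡ 0
      v-absent S v∈ = 𝟙-no (solid? H S) λ (S⊆ , _) → x∉p-x VG v (S⊆ v∈)

    four-sets : (χˢ H X ℕ.+ χᶜ G X) ℕ.+ (χˢ H Xᵘ ℕ.+ χᶜ G Xᵘ) ℕ.+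
                  ((χˢ H Xᵛ ℕ.+ χᶜ G Xᵛ) ℕ.+ (χˢ H Xᵘᵛ ℕ.+ χᶜ G Xᵘᵛ)) ℕ.≤
                (χˢ G X ℕ.+ (χᶜ H X ℕ.+ χᵃ X)) ℕ.+ (χˢ G Xᵘ ℕ.+ (χᶜ H Xᵘ ℕ.+ χᵃ Xᵘ)) ℕ.+
                  ((χˢ G Xᵛ ℕ.+ (χᶜ H Xᵛ ℕ.+ χᵃ Xᵛ)) ℕ.+ (χˢ G Xᵘᵛ ℕ.+ (χᶜ H Xᵘᵛ ℕ.+ χᵃ Xᵘᵛ)))
    four-sets rewrite v-absent Xᵛ (∈+⁺ (inj₁ refl)) | v-absent Xᵘᵛ (∈+⁺ (inj₂ (∈+⁺ (inj₁ refl)))) = begin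
      (χˢ H X ℕ.+ χᶜ G X) ℕ.+ (χˢ H Xᵘ ℕ.+ χᶜ G Xᵘ) ℕ.+ (χᶜ G Xᵛ ℕ.+ χᶜ G Xᵘᵛ)
        ≡⟨ regroup (χˢ H X ℕ.+ χᶜ G X) (χˢ H Xᵘ) (χᶜ G Xᵘ) (χᶜ G Xᵛ) (χᶜ G Xᵘᵛ) ⟩
      (χˢ H X ℕ.+ χᶜ G X) ℕ.+ (χˢ H Xᵘ ℕ.+ χᶜ G Xᵘ ℕ.+ χᶜ G Xᵛ ℕ.+ χᶜ G Xᵘᵛ)
        ≤⟨ ℕ.+-mono-≤ (ℕ.+-mono-≤
             (𝟙-mono {p = solid? H X} {q = solid? G X} (solid-lifts u∉X v∉X))
             (𝟙-mono {p = cycle? G X} {q = cycle? H X} (cycle-descends u∉X v∉X))) core ⟩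
      (χˢ G X ℕ.+ χᶜ H X) ℕ.+ (n ℕ.+ (χᶜ H Xᵘ ℕ.+ χᵃ X))
        -- The added terms complete the summand of the right-hand sum on each of the four sets.
        ≤⟨ ℕ.m≤m+n _ (χᵃ Xᵘ ℕ.+ (χᶜ H Xᵛ ℕ.+ χᵃ Xᵛ) ℕ.+ (χᶜ H Xᵘᵛ ℕ.+ χᵃ Xᵘᵛ)) ⟩
      (χˢ G X ℕ.+ χᶜ H X) ℕ.+ (n ℕ.+ (χᶜ H Xᵘ ℕ.+ χᵃ X)) ℕ.+
        (χᵃ Xᵘ ℕ.+ (χᶜ H Xᵛ ℕ.+ χᵃ Xᵛ) ℕ.+ (χᶜ H Xᵘᵛ ℕ.+ χᵃ Xᵘᵛ))
        ≡⟨ regroup′ (χˢ G X) (χᶜ H X) (χᵃ X) (χˢ G Xᵘ) (χᶜ H Xᵘ) (χᵃ Xᵘ) (χˢ G Xᵛ) (χᶜ H Xᵛ ℕ.+ χᵃ Xᵛ)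
             (χˢ G Xᵘᵛ) (χᶜ H Xᵘᵛ ℕ.+ χᵃ Xᵘᵛ) ⟩
      _ ∎
      where
      open ℕ.≤-Reasoning
      regroup : ∀ a b c d f → a ℕ.+ (b ℕ.+ c) ℕ.+ (d ℕ.+ f) ≡ a ℕ.+ (b ℕ.+ c ℕ.+ d ℕ.+ f)
      regroup = solve-∀
      regroup′ : ∀ a b t c d f g h k l →
        (a ℕ.+ b) ℕ.+ (c ℕ.+ g ℕ.+ k ℕ.+ (d ℕ.+ t)) ℕ.+ (f ℕ.+ h ℕ.+ l) ≡
        (a ℕ.+ (b ℕ.+ t)) ℕ.+ (c ℕ.+ (d ℕ.+ f)) ℕ.+ ((g ℕ.+ h) ℕ.+ (k ℕ.+ l))
      regroup′ = solve-∀

  ∑χᵃ≤ : ∑ χᵃ ℕ.≤ length commons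
  ∑χᵃ≤ = begin
    ∑ χᵃ                                ≡⟨ length-filter-subsets N apex? ⟨
    length (filter apex? (subsets N))   ≤⟨ length-≤ (Unique.filter⁺ apex? (Unique-subsets N)) in-image ⟩
    length (map ⁅_⁆ commons)            ≡⟨ List.length-map ⁅_⁆ commons ⟩
    length commons                      ∎
    where
    open ℕ.≤-Reasoning
    in-image : ∀ {S} → S ∈ filter apex? (subsets N) → S ∈ map ⁅_⁆ commons
    in-image S∈ with proj₂ (∈-filter⁻ apex? {xs = subsets N} S∈)
    ... | x , common , refl = ∈-map⁺ ⁅_⁆ (∈-filter⁺ common? (∈-allFin x) common)

  solid-cycle-count : length (solids (contract G e)) ℕ.+ length (inducedCycles G) ℕ.≤
                      length (solids G) ℕ.+ (length (inducedCycles (contract G e)) ℕ.+ length commons)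
  solid-cycle-count = begin
    length (solids (contract G e)) ℕ.+ length (inducedCycles G)
      ≡⟨ cong₂ ℕ._+_ (length-solids (contract G e)) (length-inducedCycles G) ⟩
    ∑ (χˢ H) ℕ.+ ∑ (χᶜ G)
      ≡⟨ ∑-+ (χˢ H) (χᶜ G) ⟨
    ∑ (λ S → χˢ H S ℕ.+ χᶜ G S)
      ≤⟨ ∑-fold₂-mono (λ S → χˢ H S ℕ.+ χᶜ G S) (λ S → χˢ G S ℕ.+ (χᶜ H S ℕ.+ χᵃ S))
           (Induced.~⇒≢ G e) (λ _ u∉ v∉ → four-sets u∉ v∉) ⟩
    ∑ (λ S → χˢ G S ℕ.+ (χᶜ H S ℕ.+ χᵃ S))
      ≡⟨ trans (∑-+ (χˢ G) (λ S → χᶜ H S ℕ.+ χᵃ S)) (cong (∑ (χˢ G) ℕ.+_) (∑-+ (χᶜ H) χᵃ)) ⟩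
    ∑ (χˢ G) ℕ.+ (∑ (χᶜ H) ℕ.+ ∑ χᵃ)
      ≤⟨ ℕ.+-monoʳ-≤ (∑ (χˢ G)) (ℕ.+-monoʳ-≤ (∑ (χᶜ H)) ∑χᵃ≤) ⟩
    ∑ (χˢ G) ℕ.+ (∑ (χᶜ H) ℕ.+ length commons)
      ≡⟨ cong₂ (λ a b → a ℕ.+ (b ℕ.+ length commons))
           (length-solids G) (length-inducedCycles (contract G e)) ⟨
    length (solids G) ℕ.+ (length (inducedCycles (contract G e)) ℕ.+ length commons) ∎
    where open ℕ.≤-Reasoning

  total : length (solids (contract G e)) ℕ.+ length (inducedCycles G) ℕ.+
            length (edges (contract G e)) ℕ.+ ∣ VG ∣ ℕ.≤
          length (solids G) ℕ.+ length (inducedCycles (contract G e)) ℕ.+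
            length (edges G) ℕ.+ ∣ Graph.V (contract G e) ∣
  -- On the left this number stands for the lost edges, e and one for each common neighbour. On the
  -- right it consists of the triangles on e and the one lost vertex.
  total = ℕ.+-cancelʳ-≤ (suc (length commons)) _ _ (begin
    s′ ℕ.+ c ℕ.+ e′ ℕ.+ n ℕ.+ suc t                   ≡⟨ regroup s′ c e′ n t ⟩
    (s′ ℕ.+ c) ℕ.+ (e′ ℕ.+ suc t) ℕ.+ n               ≤⟨ ℕ.+-mono-≤ (ℕ.+-mono-≤ solid-cycle-count edge-count)
                                                          (∣p∣≤1+∣p-x∣ VG v) ⟩
    (s ℕ.+ (c′ ℕ.+ t)) ℕ.+ ε ℕ.+ suc n′               ≡⟨ regroup′ s c′ ε n′ t ⟩
    s ℕ.+ c′ ℕ.+ ε ℕ.+ n′ ℕ.+ suc t                   ∎)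
    where
    open ℕ.≤-Reasoning
    s = length (solids G)
    s′ = length (solids (contract G e))
    c = length (inducedCycles G)
    c′ = length (inducedCycles (contract G e))
    ε = length (edges G)
    e′ = length (edges (contract G e))
    n = ∣ VG ∣
    n′ = ∣ Graph.V (contract G e) ∣
    t = length commons
    regroup : ∀ s′ c e′ n t →
      s′ ℕ.+ c ℕ.+ e′ ℕ.+ n ℕ.+ suc t ≡ (s′ ℕ.+ c) ℕ.+ (e′ ℕ.+ suc t) ℕ.+ n
    regroup = solve-∀
    regroup′ : ∀ s c′ ε n′ t →
      (s ℕ.+ (c′ ℕ.+ t)) ℕ.+ ε ℕ.+ suc n′ ≡ s ℕ.+ c′ ℕ.+ ε ℕ.+ n′ ℕ.+ suc t
    regroup′ = solve-∀

subtract : ∀ s c e n s′ c′ e′ n′ → s′ ℕ.+ c ℕ.+ e′ ℕ.+ n ℕ.≤ s ℕ.+ c′ ℕ.+ e ℕ.+ n′ →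
           + s′ ℤ.- + c′ ℤ.+ + e′ ℤ.- + n′ ≤ + s ℤ.- + c ℤ.+ + e ℤ.- + n
subtract s c e n s′ c′ e′ n′ le = ℤ.0≤i-j⇒j≤i (subst (+ 0 ≤_)
  (difference (+ s) (+ c) (+ e) (+ n) (+ s′) (+ c′) (+ e′) (+ n′)) (ℤ.i≤j⇒0≤j-i (+≤+ le)))
  where
  difference : ∀ s c e n s′ c′ e′ n′ →
    (s ℤ.+ c′ ℤ.+ e ℤ.+ n′) ℤ.- (s′ ℤ.+ c ℤ.+ e′ ℤ.+ n) ≡
    (s ℤ.- c ℤ.+ e ℤ.- n) ℤ.- (s′ ℤ.- c′ ℤ.+ e′ ℤ.- n′)
  difference = solve-∀ℤ

theorem4p2p1 : ∀ {N : ℕ} (G : Graph N) {u v : Fin N} (e : Graph._~_ G u v) →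
    ℶ³ (contract G e) ≤ ℶ³ G
theorem4p2p1 G e = subtract
  (length (solids G)) (length (inducedCycles G)) (length (edges G)) (∣ Graph.V G ∣)
  (length (solids (contract G e))) (length (inducedCycles (contract G e)))
  (length (edges (contract G e))) (∣ Graph.V (contract G e) ∣) (Count.total G e)
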